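{- Let $T$ be a tree on $n$ vertices $1,2,\ldots,n$ with $n\ge2$. Let $\lambda_1<\mu_1<\lambda_2<\cdots<\mu_{n-1}<\lambda_n$ be $2n-1$ real numbers such that $\lambda_j=-\lambda_{n+1-j}$ for all $j=1,\ldots,n$, and $\mu_k=-\mu_{n-k}$ for all $k=1,\ldots,n-1$. Suppose $T$ is NEB at a vertex $v$. Let $A\in S^-(T)$ be the skew-symmetric matrix with eigenvalues $\mathrm{i}\lambda_1,\ldots,\mathrm{i}\lambda_n$, and with $A(v)$ having eigenvalues $\mathrm{i}\mu_1,\ldots,\mathrm{i}\mu_{n-1}$, that is produced from these data by the recursive construction described in the context. Then $A$ has the Duarte property with respect to vertex $v$.
   Context: $\mathrm{i}=\sqrt{ -1}$. For a real skew-symmetric matrix $A=[a_{k,l}]$ of order $n$, its graph $G(A)$ has vertex set $\{1,\ldots,n\}$ and edge set $\{\{k,l\}: a_{k,l}\ne 0,\ k<l\}$. $S^-(T)$ is the set of all real skew-symmetric matrices whose graph is $T$. $N(w)$ is the set of neighbors of a vertex $w$. For a vertex $w$ of a tree $T$, $T(w)$ is the forest obtained by deleting $w$; for a neighbor $u$ of $w$, $T_u(w)$ is the connected component of $T(w)$ containing $u$. For $A\in S^-(T)$, $A(w)$ and $A_u(w)$ denote the principal submatrices of $A$ corresponding to $T(w)$ and $T_u(w)$ (rows and columns keep their vertex labels). NEB (nearly even branching; recursive): let $T$ be a tree on $n$ vertices and $w$ a vertex of $T$. If $n=1$, $T$ is NEB at $w$. If $n\ge2$, $T$ is NEB at $w$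 if (i) $T(w)$ has exactly one odd component (a connected component with an odd number of vertices) when $n$ is even, and no odd component when $n$ is odd; and (ii) for each neighbor $u$ of $w$ in $T$, $T_u(w)$ is NEB at $u$. Order on $\mathrm{i}\mathbb{R}$: $a\le b$ means $-\mathrm{i}a\le-\mathrm{i}b$ as real numbers. Spectra of real skew-symmetric matrices (contained in $\mathrm{i}\mathbb{R}$) are listed with multiplicity in increasing order; $\{\beta_1,\ldots,\beta_{n-1}\}$ strictly interlaces $\{\alpha_1,\ldots,\alpha_n\}$ if $\alpha_1<\beta_1<\alpha_2<\cdots<\beta_{n-1}<\alpha_n$. Duarte property (recursive): let $A$ be a square matrix whose graph is a tree and $w$ a vertex of $G(A)$. If $G(A)$ has just one vertex, $A$ has the Duarte property with respect to $w$. If $G(A)$ has more than one vertex, $A$ has the Duarte property with respect to $w$ provided the eigenvalues of $A(w)$ strictly interlace those of $A$ and, for each neighbor $u$ of $w$, $A_u(w)$ has the Duarte property with respect to $u$. Construction of $A$ (recursive on $n$), given a tree $T$ that is NEB at $v$ and real numbers $\lambda_j,\mu_k$ as in the claim. If $n=1$, the matrix is $[0]$. If $n=2$ (so $\mu_1=0$), the matrix is $\begin{bmatrix}0&\lambda_1\\-\lambda_1&0\end{bmatrix}$. If $n\ge3$, put $f(x)=\prod_{j=1}^n(x-\mathrm{i}\lambda_j)$ and $g(x)=\prod_{k=1}^{n-1}(x-\mathrm{i}\mu_k)$. For each $j\in N(v)$ choose a monic polynomial $g_j$ of degree $|T_j(v)|$ (the number of vertices of $T_j(v)$), whose roots are $0$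 or complex conjugate pairs of purely imaginary numbers, such that $g=\prod_{j\in N(v)}g_j$; this is possible because $T$ is NEB at $v$. The partial fraction decomposition gives $$\frac{f(x)}{g(x)}=x+\sum_{j\in N(v)}y_j\frac{h_j(x)}{g_j(x)}$$ with numbers $y_j$ and unique monic polynomials $h_j$, $\deg h_j<\deg g_j$. Here each $y_j$ is a positive real number, each $h_j$ is a real polynomial involving only powers of $x$ of the same parity as $\deg h_j$, and $h_j$ has $\deg g_j-1$ distinct roots, all purely imaginary, which strictly interlace the roots of $g_j$. Since $T_j(v)$ is NEB at $j$, the construction applied to $T_j(v)$, its vertex $j$, and the roots of $g_j$ and $h_j$ (in the roles of the $\mathrm{i}\lambda$'s and $\mathrm{i}\mu$'s) gives $B_j\in S^-(T_j(v))$ with characteristic polynomial $g_j$ such that the principal submatrix of $B_j$ obtained by deleting the row and column of vertex $j$ has characteristic polynomial $h_j$. Then $A=[a_{k,l}]$ is the $n\times n$ skew-symmetric matrix with $a_{v,j}=-a_{j,v}=\sqrt{y_j}$ and $A_j(v)=B_j$ for all $j\in N(v)$, and all other entries zero. -}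

module Defs where

open import Level using (Level; Lift; _⊔_; 0ℓ) renaming (suc to lsuc)
open import Algebra.Bundles using (CommutativeRing)
open import Algebra.Bundles.Raw using (RawRing)
import Algebra.Definitions.RawMonoid as Monoid
open import Data.Bool.Base using (if_then_else_)
open import Data.Empty using (⊥)
open import Data.Fin.Base using (Fin; zero; suc; inject₁; opposite; punchIn)
  renaming (_<_ to _<ᶠ_)
open import Data.Fin.Properties using (_≟_; <-irrefl; _<?_)
open import Data.Fin.Subset using (Subset; inside; outside; _∈_; _-_; ∣_∣)
open import Data.List.Base as List using (List; []; _∷_; _++_)
open import Data.List.Relation.Unary.Linked using (Linked)
open import Data.List.Relation.Unary.Unique.Propositional using (Unique)
open import Data.Nat.Base as ℕ using (ℕ; zero; suc)
open import Data.Nat.Divisibility using (_∣_)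
open import Data.Product using (∃; ∃!; _×_; _,_)
open import Data.Sum.Base using (_⊎_; inj₁; inj₂; swap)
import Data.Vec.Base as Vec
open import Data.Vec.Functional using (Vector; removeAt)
open import Function.Bundles using (_⇔_)
open import Function.Definitions using (Injective)
open import Relation.Binary.Core using (Rel)
open import Relation.Binary.Definitions using (Decidable; Symmetric; _Respects_)
open import Relation.Binary.Structures using (IsStrictTotalOrder)
open import Relation.Binary.Construct.Closure.ReflexiveTransitive using (Star)
import Relation.Binary.Construct.StrictToNonStrict as NonStrict
open import Relation.Binary.PropositionalEquality as ≡ using (_≡_)
open import Relation.Nullary using (¬_; does)
open import Relation.Nullary.Decidable using (_×-dec_; _⊎-dec_; ¬?)
open import Relation.Unary using (Pred)

------------------------------------------------------------------------
-- Real numbers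

-- The library has no real numbers, so ℝ is introduced by its
-- characterisation as the Dedekind-complete ordered field; results
-- quantify over all models.  The order satisfies decidable trichotomy,
-- as it does classically.
record RealNumbers (c ℓ₁ ℓ₂ : Level) : Set (lsuc (c ⊔ ℓ₁ ⊔ ℓ₂)) where
  infix 4 _<_ _≤_
  field
    commutativeRing : CommutativeRing c ℓ₁
  open CommutativeRing commutativeRing public hiding (_-_)
  field
    _<_                : Rel Carrier ℓ₂
    isStrictTotalOrder : IsStrictTotalOrder _≈_ _<_
    0<1                : 0# < 1#
    +-monoˡ-<          : ∀ z {x y} → x < y → x + z < y + z
    *-pos              : ∀ {x y} → 0# < x → 0# < y → 0# < x * y
    inverse            : ∀ x → ¬ (x ≈ 0#) → ∃ λ y → x * y ≈ 1#

  _≤_ : Rel Carrier (ℓ₁ ⊔ ℓ₂)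
  _≤_ = NonStrict._≤_ _≈_ _<_

  UpperBound : ∀ {p} → Pred Carrier p → Pred Carrier (c ⊔ ℓ₁ ⊔ ℓ₂ ⊔ p)
  UpperBound P b = ∀ {x} → P x → x ≤ b

  field
    complete : (P : Pred Carrier (c ⊔ ℓ₁ ⊔ ℓ₂)) → P Respects _≈_ →
               ∃ P → ∃ (UpperBound P) →
               ∃ λ s → UpperBound P s × (∀ {b} → UpperBound P b → s ≤ b)

------------------------------------------------------------------------
-- Graphs and trees

record Graph (n : ℕ) (ℓ : Level) : Set (lsuc ℓ) where
  field
    Adj     : Rel (Fin n) ℓ
    adj?    : Decidable Adj
    sym     : Symmetric Adj
    irrefl  : ∀ {x} → ¬ Adj x x

module _ {n ℓ} (G : Graph n ℓ) where
  open Graph G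

  IsCycle : List (Fin n) → Set ℓ
  IsCycle (x ∷ y ∷ z ∷ zs) =
    Unique (x ∷ y ∷ z ∷ zs) × Linked Adj (x ∷ y ∷ z ∷ zs ++ x ∷ [])
  IsCycle _                = Lift ℓ ⊥

  IsTree : Set ℓ
  IsTree = (∀ x y → Star Adj x y) × (∀ xs → ¬ IsCycle xs)

  -- Adjacency in the subgraph induced on S.
  AdjIn : Subset n → Rel (Fin n) ℓ
  AdjIn S x y = x ∈ S × y ∈ S × Adj x y

  -- C is the vertex set of the component containing u of the subgraph
  -- induced on S.  It exists and is unique when u ∈ S, as Adj is decidable.
  IsComponent : Subset n → Fin n → Subset n → Set ℓ
  IsComponent S u C = u ∈ S × (∀ x → x ∈ C ⇔ Star (AdjIn S) u x)

  OddComponent : Subset n → Subset n → Set ℓ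
  OddComponent S C = (∃ λ u → IsComponent S u C) × ¬ (2 ∣ ∣ C ∣)

  -- NEB S w: the subtree with vertex set S is NEB at w.
  data NEB : Subset n → Fin n → Set ℓ where
    single : ∀ {S w} → w ∈ S → ∣ S ∣ ≡ 1 → NEB S w
    branch : ∀ {S w} → w ∈ S → 2 ℕ.≤ ∣ S ∣ →
             (2 ∣ ∣ S ∣ → ∃! _≡_ (OddComponent (S - w))) →
             (¬ (2 ∣ ∣ S ∣) → ¬ ∃ (OddComponent (S - w))) →
             (∀ u C → AdjIn S w u → IsComponent (S - w) u C → NEB C u) →
             NEB S w

------------------------------------------------------------------------
-- Matrices, polynomials, characteristic polynomials

Matrix : ∀ {a} → Set a → ℕ → Set a
Matrix A n = Fin n → Fin n → A

-- The elements of S in increasing order.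
elements : ∀ {n} (S : Subset n) → Fin ∣ S ∣ → Fin n
elements (inside  Vec.∷ S) zero    = zero
elements (inside  Vec.∷ S) (suc k) = suc (elements S k)
elements (outside Vec.∷ S) k       = suc (elements S k)

-- Principal submatrix.
infix 9 _[_]
_[_] : ∀ {a n} {A : Set a} → Matrix A n → (S : Subset n) → Matrix A ∣ S ∣
(A [ S ]) k l = A (elements S k) (elements S l)

module RingOps {c ℓ} (R : RawRing c ℓ) where
  open RawRing R
  open Monoid +-rawMonoid public using (sum)
  open Monoid *-rawMonoid public using () renaming (sum to product)

  alternate : ∀ {n} → Fin n → Carrier → Carrier
  alternate zero    x = x
  alternate (suc k) x = - alternate k x

  -- Laplace expansion along the first row.
  det : ∀ {n} → Matrix Carrier n → Carrier
  det {zero}  M = 1#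
  det {suc n} M = sum λ j →
    alternate j (M zero j * det (λ k l → M (suc k) (punchIn j l)))

-- Coefficient lists, constant term first; trailing zeros are immaterial
-- for the equality.
module Polynomial {c ℓ} (R : RawRing c ℓ) where
  open RawRing R

  Poly : Set c
  Poly = List Carrier

  coeff : Poly → ℕ → Carrier
  coeff []      k       = 0#
  coeff (a ∷ p) zero    = a
  coeff (a ∷ p) (suc k) = coeff p k

  addP : Poly → Poly → Poly
  addP []      q       = q
  addP (a ∷ p) []      = a ∷ p
  addP (a ∷ p) (b ∷ q) = a + b ∷ addP p q

  mulP : Poly → Poly → Poly
  mulP []      q = []
  mulP (a ∷ p) q = addP (List.map (a *_) q) (0# ∷ mulP p q)

  polyRing : RawRing c ℓ
  polyRing = record
    { Carrier = Poly
    ; _≈_     = λ p q → ∀ k → coeff p k ≈ coeff q k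
    ; _+_     = addP
    ; _*_     = mulP
    ; -_      = List.map (-_)
    ; 0#      = []
    ; 1#      = 1# ∷ []
    }

  const : Carrier → Poly
  const a = a ∷ []

  X : Poly
  X = 0# ∷ 1# ∷ []

  charPoly : ∀ {n} → Matrix Carrier n → Poly
  charPoly M = RingOps.det polyRing λ k l →
    addP (if does (k ≟ l) then X else []) (const (- M k l))

------------------------------------------------------------------------
-- Real skew-symmetric matrices

module Skew {c ℓ₁ ℓ₂} (ℝ : RealNumbers c ℓ₁ ℓ₂) where
  open RealNumbers ℝ hiding (zero) renaming (Carrier to R)

  ℂ : RawRing c ℓ₁
  ℂ = record
    { Carrier = R × R
    ; _≈_     = λ (a , b) (a′ , b′) → a ≈ a′ × b ≈ b′
    ; _+_     = λ (a , b) (a′ , b′) → a + a′ , b + b′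
    ; _*_     = λ (a , b) (a′ , b′) → a * a′ + - (b * b′) , a * b′ + b * a′
    ; -_      = λ (a , b) → - a , - b
    ; 0#      = 0# , 0#
    ; 1#      = 1# , 0#
    }

  real : R → RawRing.Carrier ℂ
  real a = a , 0#

  imag : R → RawRing.Carrier ℂ
  imag a = 0# , a

  open Polynomial ℂ public
  open RawRing polyRing public using ()
    renaming (_≈_ to _≈ᴾ_; _+_ to _+ᴾ_; _*_ to _*ᴾ_; -_ to -ᴾ_)
  open RingOps polyRing public using ()
    renaming (sum to sumᴾ; product to productᴾ)

  -- ∏ₖ (x − i αₖ)
  withRoots : ∀ {m} → Vector R m → Poly
  withRoots α = productᴾ λ k → X +ᴾ -ᴾ const (imag (α k))

  -- The eigenvalues of A, with multiplicity, are i α₁, …, i αₘ.  Comparing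
  -- degrees, m is the order of A.
  Spectrum : ∀ {n m} → Matrix R n → Vector R m → Set ℓ₁
  Spectrum A α = charPoly (λ k l → real (A k l)) ≈ᴾ withRoots α

  -- β strictly interlaces α.
  StrictlyInterlaces : ∀ {m} → Vector R m → Vector R (suc m) → Set ℓ₂
  StrictlyInterlaces β α = ∀ k → α (inject₁ k) < β k × β k < α (suc k)

  Antisymmetric : ∀ {m} → Vector R m → Set ℓ₁
  Antisymmetric α = ∀ k → α k ≈ - α (opposite k)

  Increasing : ∀ {m} → Vector R m → Set (ℓ₁ ⊔ ℓ₂)
  Increasing α = ∀ {k l} → k <ᶠ l → α k ≤ α l

  graph : ∀ {n} → Matrix R n → Graph n ℓ₁
  graph A = record
    { Adj    = λ k l → (k <ᶠ l × ¬ (A k l ≈ 0#)) ⊎ (l <ᶠ k × ¬ (A l k ≈ 0#))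
    ; adj?   = λ k l → ((k <? l) ×-dec ¬? (A k l ≈? 0#))
                       ⊎-dec ((l <? k) ×-dec ¬? (A l k ≈? 0#))
    ; sym    = swap
    ; irrefl = λ { (inj₁ (x<x , _)) → <-irrefl ≡.refl x<x
                 ; (inj₂ (x<x , _)) → <-irrefl ≡.refl x<x }
    }
    where open IsStrictTotalOrder isStrictTotalOrder using () renaming (_≟_ to _≈?_)

  SkewSymmetric : ∀ {n} → Matrix R n → Set ℓ₁
  SkewSymmetric A = ∀ k l → A k l ≈ - A l k

  record _∈S⁻_ {n} (A : Matrix R n) (T : Graph n 0ℓ) : Set ℓ₁ where
    field
      skew      : SkewSymmetric A
      sameGraph : ∀ k l → Graph.Adj (graph A) k l ⇔ Graph.Adj T k l

  -- Duarte A S w: the principal submatrix of A on S has the Duarte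
  -- property with respect to w.
  data Duarte {n} (A : Matrix R n) : Subset n → Fin n → Set (c ⊔ ℓ₁ ⊔ ℓ₂) where
    single : ∀ {S w} → w ∈ S → ∣ S ∣ ≡ 1 → Duarte A S w
    branch : ∀ {S w m} → w ∈ S → 2 ℕ.≤ ∣ S ∣ →
             (α : Vector R (suc m)) (β : Vector R m) →
             Spectrum (A [ S ]) α → Spectrum (A [ S - w ]) β →
             StrictlyInterlaces β α →
             (∀ u C → AdjIn (graph A) S w u →
                      IsComponent (graph A) (S - w) u C → Duarte A C u) →
             Duarte A S w

  ----------------------------------------------------------------------
  -- The recursive construction

  IsSqrt : R → R → Set (ℓ₁ ⊔ ℓ₂)
  IsSqrt s y = 0# ≤ s × s * s ≈ y

  -- One step of the construction, at v, on the subtree of T with vertex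
  -- set S (of size at least 3), for f with roots i λs and g with roots i μs.
  -- The neighbours of v are listed as nbr 0, nbr 1, …, and the polynomials
  -- gⱼ, hⱼ are given by their roots, i (gRoots j) and i (hRoots j); they are
  -- thereby monic, with deg gⱼ = |Tⱼ(v)| and deg hⱼ = deg gⱼ − 1.  No
  -- interlacing of these roots and no positivity of yⱼ is presupposed.
  record Step {n} (T : Graph n 0ℓ) (A : Matrix R n) (S : Subset n) (v : Fin n)
              {m} (λs : Vector R (suc m)) (μs : Vector R m) :
              Set (c ⊔ ℓ₁ ⊔ ℓ₂) where
    open Graph T
    field
      v∈S    : v ∈ S
      size   : ∣ S ∣ ≡ suc m
      size≥3 : 3 ℕ.≤ ∣ S ∣

      {d}           : ℕ
      nbr           : Fin (suc d) → Fin n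
      nbr-injective : Injective _≡_ _≡_ nbr
      nbr-complete  : ∀ u → AdjIn T S v u ⇔ (∃ λ j → nbr j ≡ u)
      comp          : Fin (suc d) → Subset n
      isComp        : ∀ j → IsComponent T (S - v) (nbr j) (comp j)

      {e}       : Fin (suc d) → ℕ
      comp-size : ∀ j → ∣ comp j ∣ ≡ suc (e j)
      gRoots    : ∀ j → Vector R (suc (e j))
      hRoots    : ∀ j → Vector R (e j)
      y         : Vector R (suc d)

    f : Poly
    f = withRoots λs

    g : Poly
    g = withRoots μs

    g′ : Vector Poly (suc d)
    g′ = λ j → withRoots (gRoots j)

    h′ : Vector Poly (suc d)
    h′ = λ j → withRoots (hRoots j)

    field
      gRoots-increasing : ∀ j → Increasing (gRoots j)
      gRoots-conjugate  : ∀ j → Antisymmetric (gRoots j)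
      hRoots-increasing : ∀ j → Increasing (hRoots j)
      factorization     : g ≈ᴾ productᴾ g′
      -- f/g = x + ∑ⱼ yⱼ hⱼ/gⱼ, multiplied by g = ∏ⱼ gⱼ.
      partialFractions  : f ≈ᴾ X *ᴾ g +ᴾ sumᴾ λ j →
        const (real (y j)) *ᴾ (h′ j *ᴾ productᴾ (removeAt g′ j))

      √y      : Vector R (suc d)
      √y-sqrt : ∀ j → IsSqrt (√y j) (y j)
      entry   : ∀ j → A v (nbr j) ≈ √y j × A (nbr j) v ≈ - √y j
      zeros   : ∀ {k l} → k ∈ S → l ∈ S →
                ¬ (k ≡ v × Adj v l) → ¬ (l ≡ v × Adj v k) →
                (∀ j → ¬ (k ∈ comp j × l ∈ comp j)) → A k l ≈ 0#

  -- Produced T A S v λs μs: the principal submatrix of A on S is produced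
  -- by the construction from the subtree of T on S, its vertex v, and the
  -- numbers λs and μs.  In size 2, rows and columns are in the order of
  -- their labels.
  data Produced {n} (T : Graph n 0ℓ) (A : Matrix R n) : Subset n → Fin n →
       ∀ {m} → Vector R (suc m) → Vector R m → Set (c ⊔ ℓ₁ ⊔ ℓ₂) where
    size-1 : ∀ {S v} {λs : Vector R 1} {μs : Vector R 0} →
             v ∈ S → ∣ S ∣ ≡ 1 → A v v ≈ 0# → Produced T A S v λs μs
    size-2 : ∀ {S v p q} {λs : Vector R 2} {μs : Vector R 1} →
             v ∈ S → ∣ S ∣ ≡ 2 → p ∈ S → q ∈ S → p <ᶠ q →
             A p p ≈ 0#         → A p q ≈ λs zero →
             A q p ≈ - λs zero  → A q q ≈ 0# →
             Produced T A S v λs μs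
    size≥3 : ∀ {S v m} {λs : Vector R (suc m)} {μs : Vector R m}
             (s : Step T A S v λs μs) → let open Step s in
             (∀ j → Produced T A (comp j) (nbr j) (gRoots j) (hRoots j)) →
             Produced T A S v λs μs

{-# OPTIONS --safe #-}

-- Two facts are established along the construction, by recursion on it.
--
-- Spectra.  Order the vertices as v followed by the components of T(v), each
-- starting with its neighbour of v.  Expanding det (xI − A) there gives
-- f = x ∏ⱼ gⱼ + ∑ⱼ yⱼ hⱼ ∏ᵢ≠ⱼ gᵢ, the cleared partial fraction decomposition,
-- so the constructed submatrices have the prescribed characteristic polynomials.
--
-- Interlacing.  At a root iβ of gⱼ that decomposition reads
-- −F(β) = yⱼ Hⱼ(β) ∏ᵢ≠ⱼ Gᵢ(β), where capitals are the real products over the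
-- roots.  The sign of such a product at β is the parity of the number of its
-- roots above β; since μ strictly interlaces λ this forces Hⱼ and Gⱼ to have the
-- same parity of roots above β.  Hence Hⱼ alternates in sign along the roots of
-- Gⱼ, and having one root less it strictly interlaces them.
module Submission where

-- Several facts that these two arguments rely on are not among the data of a step and are extracted
-- from its polynomial identities. Nonvanishing: a root β of `gⱼ` is one of the μ's, and strict
-- interlacing keeps it away from every λ. So f does not vanish at iβ, and hence no factor on the
-- right of the decomposition does: β is not a root of `hⱼ` or of another `gᵢ`, and `yⱼ` is nonzero.
-- Being a square, `yⱼ` is then positive. Disjointness: the block structure of xI - A needs the
-- components at `v` to be disjoint. They cover T(v), and by unique factorisation the μ's are
-- exactly the roots of all `gⱼ` taken together, so the sizes of the components add up to the number
-- of vertices of T(v), which leaves no room for an overlap. Order two: the matrix built there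
-- involves λ₁ alone, so A(v) has the required spectrum only if μ₁ = 0. At the top this is the
-- symmetry of μ; for a component with two vertices it is deduced from the behaviour of f and of the
-- `gᵢ` under x ↦ -x.

open import Defs
open import Level using (0ℓ; _⊔_) renaming (suc to lsuc)
open import Algebra.Bundles using (CommutativeRing)
open import Algebra.Bundles.Raw using (RawRing)
import Algebra.Properties.CommutativeMonoid.Sum
import Algebra.Properties.Monoid.Mult
import Algebra.Properties.Ring
import Algebra.Properties.Semiring.Mult
import Algebra.Properties.Semiring.Sum
import Algebra.Solver.Ring
open import Algebra.Solver.Ring.AlmostCommutativeRing using (fromCommutativeRing; _-Raw-AlmostCommutative⟶_)
open import Data.Bool.Base using (if_then_else_)
open import Data.Fin.Base using (Fin; zero; suc; inject₁; toℕ; fromℕ; opposite; punchIn; punchOut) renaming (_<_ to _<ᶠ_)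
open import Data.Fin.Induction using (<-weakInduction; >-weakInduction)
import Data.Fin.Permutation as FinPermutation
open import Data.Fin.Properties using (_≟_; suc-injective; toℕ-inject₁; toℕ-fromℕ; punchIn-punchOut; punchInᵢ≢i) renaming (<-cmp to <ᶠ-cmp; <-irrefl to <ᶠ-irrefl)
open import Data.Integer.Base as ℤ using (ℤ; +_; -[1+_]; +0; +[1+_])
import Data.Integer.Properties as ℤ
open import Data.List.Base as List using (List; []; _∷_; _++_; length; map; concat; tabulate; foldr; filter)
import Data.List.Properties as List
open import Data.List.Membership.Propositional using () renaming (_∈_ to _∈ˡ_; _∉_ to _∉ˡ_)
open import Data.List.Membership.Propositional.Properties using (∈-map⁻; ∈-∃++; ∈-++⁺ˡ; ∈-++⁺ʳ; ∈-++⁻; ∈-concat⁺′; ∈-concat⁻′; ∈-tabulate⁺; ∈-tabulate⁻)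
open import Data.List.Membership.Propositional.Properties.WithK using (unique∧set⇒bag)
open import Data.List.Relation.Binary.BagAndSetEquality using (∼bag⇒↭)
import Data.List.Relation.Binary.Permutation.Propositional as Permutation
import Data.List.Relation.Binary.Permutation.Propositional.Properties as ↭
import Data.List.Relation.Binary.Permutation.Setoid as SetoidPermutation
import Data.List.Relation.Binary.Permutation.Setoid.Properties as SetoidPermutationProperties
open import Data.List.Relation.Unary.All as All using (All; []; _∷_)
import Data.List.Relation.Unary.All.Properties as All
open import Data.List.Relation.Unary.AllPairs using (AllPairs; []; _∷_)
import Data.List.Relation.Unary.AllPairs.Properties as AllPairs
open import Data.List.Relation.Unary.Any using (Any; here; there)
import Data.List.Relation.Unary.Any.Properties as Any
open import Data.List.Relation.Unary.Unique.Propositional using (Unique)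
import Data.List.Relation.Unary.Unique.Propositional.Properties as Unique
open import Data.Maybe.Base using (just; nothing)
open import Data.Nat.Base as ℕ using (ℕ; zero; suc; parity)
import Data.Nat.Properties as ℕ
open import Data.Parity.Base as Parity using (Parity; 0ℙ; 1ℙ; _⁻¹)
import Data.Parity.Properties as Parity
open import Data.Product using (∃; _×_; _,_; proj₁; proj₂)
open import Data.Sum.Base using (_⊎_; inj₁; inj₂)
import Data.Vec.Base as Vec
open import Data.Vec.Functional using (Vector; removeAt; tail)
open import Function.Base using (_∘_; id)
open import Function.Bundles using (_⇔_; Equivalence; mk⇔)
open import Relation.Binary.Construct.Closure.ReflexiveTransitive as Star using (Star; ε; _◅_; _◅◅_)
open import Relation.Binary.Definitions using (DecidableEquality; Tri; tri<; tri≈; tri>; WeaklyDecidable)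
open import Relation.Binary.PropositionalEquality as ≡ using (_≡_; _≢_)
import Relation.Binary.Reasoning.Setoid
open import Relation.Binary.Structures using (IsStrictTotalOrder)
open import Relation.Nullary using (¬_; Dec; yes; no; does; contradiction)
open import Relation.Nullary.Decidable using (dec-true; dec-false)

-- Polynomials over a commutative ring

-- The library's ring solver, with integer coefficients so that x − x cancels
-- although equality in K is not decidable.
module IntegerRingSolver {c ℓ} (K : CommutativeRing c ℓ) where
  open CommutativeRing K
  open Algebra.Properties.Ring ring
  open Algebra.Properties.Semiring.Mult semiring using (×1-homo-*) renaming (_×_ to _·_)
  open Algebra.Properties.Monoid.Mult +-monoid using (×-homo-+; ×-homo-1)
  open Relation.Binary.Reasoning.Setoid setoid

  fromℤ : ℤ → Carrier
  fromℤ (+ n)    = n · 1#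
  fromℤ -[1+ n ] = - (suc n · 1#)

  fromℤ-⊖ : ∀ m n → fromℤ (m ℤ.⊖ n) ≈ m · 1# - n · 1#
  fromℤ-⊖ m       zero    = sym (trans (+-congˡ -0#≈0#) (+-identityʳ _))
  fromℤ-⊖ zero    (suc n) = sym (+-identityˡ _)
  fromℤ-⊖ (suc m) (suc n) = begin
    fromℤ (suc m ℤ.⊖ suc n)                      ≡⟨ ≡.cong fromℤ (ℤ.[1+m]⊖[1+n]≡m⊖n m n) ⟩
    fromℤ (m ℤ.⊖ n)                              ≈⟨ fromℤ-⊖ m n ⟩
    m · 1# - n · 1#                              ≈⟨ +-identityˡ _ ⟨
    0# + (m · 1# - n · 1#)                       ≈⟨ +-congʳ (-‿inverseʳ 1#) ⟨
    (1# - 1#) + (m · 1# - n · 1#)                ≈⟨ +-assoc _ _ _ ⟩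
    1# + (- 1# + (m · 1# - n · 1#))              ≈⟨ +-congˡ (+-assoc _ _ _) ⟨
    1# + ((- 1# + m · 1#) - n · 1#)              ≈⟨ +-congˡ (+-congʳ (+-comm _ _)) ⟩
    1# + ((m · 1# - 1#) - n · 1#)                ≈⟨ +-congˡ (+-assoc _ _ _) ⟩
    1# + (m · 1# + (- 1# - n · 1#))              ≈⟨ +-assoc _ _ _ ⟨
    suc m · 1# + (- 1# - n · 1#)                 ≈⟨ +-congˡ (-‿+-comm 1# _) ⟩
    suc m · 1# - suc n · 1#                      ∎

  fromℤ-+ : ∀ i j → fromℤ (i ℤ.+ j) ≈ fromℤ i + fromℤ j
  fromℤ-+ (+ m)    (+ n)    = ×-homo-+ 1# m n
  fromℤ-+ (+ m)    -[1+ n ] = fromℤ-⊖ m (suc n)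
  fromℤ-+ -[1+ m ] (+ n)    = trans (fromℤ-⊖ n (suc m)) (+-comm _ _)
  fromℤ-+ -[1+ m ] -[1+ n ] = begin
    - (suc (suc (m ℕ.+ n)) · 1#)     ≈⟨ -‿cong (+-congˡ (×-homo-+ 1# (suc m) n)) ⟩
    - (1# + (suc m · 1# + n · 1#))   ≈⟨ -‿cong (+-assoc _ _ _) ⟨
    - ((1# + suc m · 1#) + n · 1#)   ≈⟨ -‿cong (+-congʳ (+-comm _ _)) ⟩
    - ((suc m · 1# + 1#) + n · 1#)   ≈⟨ -‿cong (+-assoc _ _ _) ⟩
    - (suc m · 1# + suc n · 1#)      ≈⟨ -‿+-comm _ _ ⟨
    - (suc m · 1#) - (suc n · 1#)    ∎

  fromℤ-- : ∀ i → fromℤ (ℤ.- i) ≈ - fromℤ i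
  fromℤ-- +0       = sym -0#≈0#
  fromℤ-- +[1+ n ] = refl
  fromℤ-- -[1+ n ] = sym (-‿involutive _)

  -- Signs are pulled out of the integer product until both factors are nonnegative, where multiples
  -- of 1 multiply by `×1-homo-*`.
  fromℤ-* : ∀ i j → fromℤ (i ℤ.* j) ≈ fromℤ i * fromℤ j
  fromℤ-* (+ m)    (+ n)    = trans (reflexive (≡.cong fromℤ (≡.sym (ℤ.pos-* m n)))) (×1-homo-* m n)
  fromℤ-* (+ m)    -[1+ n ] = begin
    fromℤ (+ m ℤ.* -[1+ n ])         ≡⟨ ≡.cong fromℤ (≡.sym (ℤ.neg-distribʳ-* (+ m) (+[1+ n ]))) ⟩
    fromℤ (ℤ.- (+ m ℤ.* +[1+ n ]))   ≈⟨ fromℤ-- (+ m ℤ.* +[1+ n ]) ⟩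
    - fromℤ (+ m ℤ.* +[1+ n ])       ≈⟨ -‿cong (fromℤ-* (+ m) (+[1+ n ])) ⟩
    - (m · 1# * (suc n · 1#))        ≈⟨ -‿distribʳ-* _ _ ⟩
    m · 1# * - (suc n · 1#)          ∎
  fromℤ-* -[1+ m ] (+ n)    = begin
    fromℤ (-[1+ m ] ℤ.* + n)         ≡⟨ ≡.cong fromℤ (≡.sym (ℤ.neg-distribˡ-* (+[1+ m ]) (+ n))) ⟩
    fromℤ (ℤ.- (+[1+ m ] ℤ.* + n))   ≈⟨ fromℤ-- (+[1+ m ] ℤ.* + n) ⟩
    - fromℤ (+[1+ m ] ℤ.* + n)       ≈⟨ -‿cong (fromℤ-* (+[1+ m ]) (+ n)) ⟩
    - (suc m · 1# * (n · 1#))        ≈⟨ -‿distribˡ-* _ _ ⟩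
    - (suc m · 1#) * (n · 1#)        ∎
  fromℤ-* -[1+ m ] -[1+ n ] = begin
    fromℤ (+[1+ m ] ℤ.* +[1+ n ])    ≈⟨ fromℤ-* +[1+ m ] +[1+ n ] ⟩
    suc m · 1# * (suc n · 1#)        ≈⟨ -‿involutive _ ⟨
    - - (suc m · 1# * (suc n · 1#))  ≈⟨ -‿cong (-‿distribˡ-* _ _) ⟩
    - (- (suc m · 1#) * (suc n · 1#)) ≈⟨ -‿distribʳ-* _ _ ⟩
    - (suc m · 1#) * - (suc n · 1#)  ∎

  private
    morphism : ℤ.+-*-rawRing -Raw-AlmostCommutative⟶ fromCommutativeRing K
    morphism = record
      { ⟦_⟧    = fromℤ
      ; +-homo = fromℤ-+
      ; *-homo = fromℤ-*
      ; -‿homo = fromℤ--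
      ; 0-homo = refl
      ; 1-homo = ×-homo-1 1#
      }

    coeff≟ : WeaklyDecidable (λ i j → fromℤ i ≈ fromℤ j)
    coeff≟ i j with i ℤ.≟ j
    ... | yes i≡j = just (reflexive (≡.cong fromℤ i≡j))
    ... | no  _   = nothing

  open Algebra.Solver.Ring ℤ.+-*-rawRing (fromCommutativeRing K) morphism coeff≟ public
    using (solve; _:=_; _:+_; _:*_; _:-_; :-_)

module PolynomialRing {c ℓ} (K : CommutativeRing c ℓ) where
  open CommutativeRing K
  open Algebra.Properties.Ring ring using (-0#≈0#)
  open IntegerRingSolver K
  open Polynomial rawRing public
  open RawRing polyRing public using () renaming (_≈_ to _≈ᴾ_)
  open Relation.Binary.Reasoning.Setoid setoid

  scale : Carrier → Poly → Poly
  scale a = List.map (a *_)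

  shift : Poly → Poly
  shift = 0# ∷_

  coeff-add : ∀ p q k → coeff (addP p q) k ≈ coeff p k + coeff q k
  coeff-add []      q       k       = sym (+-identityˡ _)
  coeff-add (a ∷ p) []      k       = sym (+-identityʳ _)
  coeff-add (a ∷ p) (b ∷ q) zero    = refl
  coeff-add (a ∷ p) (b ∷ q) (suc k) = coeff-add p q k

  coeff-scale : ∀ a p k → coeff (scale a p) k ≈ a * coeff p k
  coeff-scale a []      k       = sym (zeroʳ a)
  coeff-scale a (b ∷ p) zero    = refl
  coeff-scale a (b ∷ p) (suc k) = coeff-scale a p k

  coeff-neg : ∀ p k → coeff (List.map (-_) p) k ≈ - coeff p k
  coeff-neg []      k       = sym -0#≈0#
  coeff-neg (b ∷ p) zero    = refl
  coeff-neg (b ∷ p) (suc k) = coeff-neg p k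

  mul-coeff : ∀ a p q k → coeff (mulP (a ∷ p) q) k ≈ a * coeff q k + coeff (shift (mulP p q)) k
  mul-coeff a p q k = trans (coeff-add (scale a q) _ k) (+-congʳ (coeff-scale a q k))

  shift-cong : ∀ {p q} → p ≈ᴾ q → shift p ≈ᴾ shift q
  shift-cong p≈q zero    = refl
  shift-cong p≈q (suc k) = p≈q k

  shift-0 : ∀ {p} → p ≈ᴾ [] → shift p ≈ᴾ []
  shift-0 p≈0 zero    = refl
  shift-0 p≈0 (suc k) = p≈0 k

  shift-add : ∀ p q k → coeff (shift (addP p q)) k ≈ coeff (shift p) k + coeff (shift q) k
  shift-add p q zero    = sym (+-identityˡ 0#)
  shift-add p q (suc k) = coeff-add p q k

  shift-scale : ∀ a p k → coeff (shift (scale a p)) k ≈ a * coeff (shift p) k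
  shift-scale a p zero    = sym (zeroʳ a)
  shift-scale a p (suc k) = coeff-scale a p k

  mul-congʳ : ∀ p {q q′} → q ≈ᴾ q′ → mulP p q ≈ᴾ mulP p q′
  mul-congʳ []      q≈q′ k = refl
  mul-congʳ (a ∷ p) {q} {q′} q≈q′ k = begin
    coeff (mulP (a ∷ p) q) k                      ≈⟨ mul-coeff a p q k ⟩
    a * coeff q k + coeff (shift (mulP p q)) k    ≈⟨ +-cong (*-congˡ (q≈q′ k)) (shift-cong (mul-congʳ p q≈q′) k) ⟩
    a * coeff q′ k + coeff (shift (mulP p q′)) k  ≈⟨ mul-coeff a p q′ k ⟨
    coeff (mulP (a ∷ p) q′) k                     ∎

  mul-zeroˡ : ∀ p q → p ≈ᴾ [] → mulP p q ≈ᴾ []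
  mul-zeroˡ []      q p≈0 k = refl
  mul-zeroˡ (a ∷ p) q p≈0 k = begin
    coeff (mulP (a ∷ p) q) k                    ≈⟨ mul-coeff a p q k ⟩
    a * coeff q k + coeff (shift (mulP p q)) k  ≈⟨ +-cong (*-congʳ (p≈0 0)) (shift-0 (mul-zeroˡ p q (λ k → p≈0 (suc k))) k) ⟩
    0# * coeff q k + 0#                         ≈⟨ trans (+-identityʳ _) (zeroˡ _) ⟩
    0#                                          ∎

  mul-zeroʳ : ∀ p → mulP p [] ≈ᴾ []
  mul-zeroʳ []      k       = refl
  mul-zeroʳ (a ∷ p) zero    = refl
  mul-zeroʳ (a ∷ p) (suc k) = mul-zeroʳ p k

  mul-congˡ : ∀ p p′ q → p ≈ᴾ p′ → mulP p q ≈ᴾ mulP p′ q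
  mul-congˡ []      p′        q p≈p′ k = sym (mul-zeroˡ p′ q (λ k → sym (p≈p′ k)) k)
  mul-congˡ (a ∷ p) []        q p≈p′ k = mul-zeroˡ (a ∷ p) q p≈p′ k
  mul-congˡ (a ∷ p) (a′ ∷ p′) q p≈p′ k = begin
    coeff (mulP (a ∷ p) q) k                       ≈⟨ mul-coeff a p q k ⟩
    a * coeff q k + coeff (shift (mulP p q)) k     ≈⟨ +-cong (*-congʳ (p≈p′ 0)) (shift-cong (mul-congˡ p p′ q (λ k → p≈p′ (suc k))) k) ⟩
    a′ * coeff q k + coeff (shift (mulP p′ q)) k   ≈⟨ mul-coeff a′ p′ q k ⟨
    coeff (mulP (a′ ∷ p′) q) k                     ∎

  -- `mulP` recurses on its first factor; this is the same recursion in the second factor, which is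
  -- what lets `mul-comm` go by induction.
  mul-∷ʳ : ∀ p b q k → coeff (mulP p (b ∷ q)) k ≈ b * coeff p k + coeff (shift (mulP p q)) k
  mul-∷ʳ []      b q zero    = sym (trans (+-identityʳ _) (zeroʳ b))
  mul-∷ʳ []      b q (suc k) = sym (trans (+-identityʳ _) (zeroʳ b))
  mul-∷ʳ (a ∷ p) b q zero    = +-congʳ (*-comm a b)
  mul-∷ʳ (a ∷ p) b q (suc k) = begin
    coeff (addP (scale a q) (mulP p (b ∷ q))) k                ≈⟨ coeff-add (scale a q) _ k ⟩
    coeff (scale a q) k + coeff (mulP p (b ∷ q)) k             ≈⟨ +-cong (coeff-scale a q k) (mul-∷ʳ p b q k) ⟩
    a * coeff q k + (b * coeff p k + coeff (shift (mulP p q)) k)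
      ≈⟨ solve 3 (λ x y z → x :+ (y :+ z) := y :+ (x :+ z)) refl (a * coeff q k) (b * coeff p k) (coeff (shift (mulP p q)) k) ⟩
    b * coeff p k + (a * coeff q k + coeff (shift (mulP p q)) k) ≈⟨ +-congˡ (mul-coeff a p q k) ⟨
    b * coeff p k + coeff (mulP (a ∷ p) q) k                   ∎

  mul-comm : ∀ p q → mulP p q ≈ᴾ mulP q p
  mul-comm []      q k = sym (mul-zeroʳ q k)
  mul-comm (a ∷ p) q k = begin
    coeff (mulP (a ∷ p) q) k                    ≈⟨ mul-coeff a p q k ⟩
    a * coeff q k + coeff (shift (mulP p q)) k  ≈⟨ +-congˡ (shift-cong (mul-comm p q) k) ⟩
    a * coeff q k + coeff (shift (mulP q p)) k  ≈⟨ mul-∷ʳ q a p k ⟨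
    coeff (mulP q (a ∷ p)) k                    ∎

  mul-distribˡ : ∀ p q r → mulP p (addP q r) ≈ᴾ addP (mulP p q) (mulP p r)
  mul-distribˡ []      q r k = refl
  mul-distribˡ (a ∷ p) q r k = begin
    coeff (mulP (a ∷ p) (addP q r)) k                             ≈⟨ mul-coeff a p (addP q r) k ⟩
    a * coeff (addP q r) k + coeff (shift (mulP p (addP q r))) k
      ≈⟨ +-cong (*-congˡ (coeff-add q r k)) (trans (shift-cong (mul-distribˡ p q r) k) (shift-add (mulP p q) (mulP p r) k)) ⟩
    a * (coeff q k + coeff r k) + (coeff (shift (mulP p q)) k + coeff (shift (mulP p r)) k)
      ≈⟨ solve 5 (λ a x y z w → a :* (x :+ y) :+ (z :+ w) := (a :* x :+ z) :+ (a :* y :+ w)) refl a (coeff q k) (coeff r k) _ _ ⟩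
    (a * coeff q k + coeff (shift (mulP p q)) k) + (a * coeff r k + coeff (shift (mulP p r)) k)
      ≈⟨ +-cong (mul-coeff a p q k) (mul-coeff a p r k) ⟨
    coeff (mulP (a ∷ p) q) k + coeff (mulP (a ∷ p) r) k           ≈⟨ coeff-add (mulP (a ∷ p) q) _ k ⟨
    coeff (addP (mulP (a ∷ p) q) (mulP (a ∷ p) r)) k              ∎

  mul-distribʳ : ∀ p q r → mulP (addP q r) p ≈ᴾ addP (mulP q p) (mulP r p)
  mul-distribʳ p q r k = begin
    coeff (mulP (addP q r) p) k                   ≈⟨ mul-comm (addP q r) p k ⟩
    coeff (mulP p (addP q r)) k                   ≈⟨ mul-distribˡ p q r k ⟩
    coeff (addP (mulP p q) (mulP p r)) k          ≈⟨ coeff-add (mulP p q) _ k ⟩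
    coeff (mulP p q) k + coeff (mulP p r) k       ≈⟨ +-cong (mul-comm p q k) (mul-comm p r k) ⟩
    coeff (mulP q p) k + coeff (mulP r p) k       ≈⟨ coeff-add (mulP q p) _ k ⟨
    coeff (addP (mulP q p) (mulP r p)) k          ∎

  mul-scaleˡ : ∀ a p q k → coeff (mulP (scale a p) q) k ≈ a * coeff (mulP p q) k
  mul-scaleˡ a []      q k = sym (zeroʳ a)
  mul-scaleˡ a (b ∷ p) q k = begin
    coeff (mulP (a * b ∷ scale a p) q) k                          ≈⟨ mul-coeff (a * b) (scale a p) q k ⟩
    a * b * coeff q k + coeff (shift (mulP (scale a p) q)) k
      ≈⟨ +-congˡ (trans (shift-cong (λ k → trans (mul-scaleˡ a p q k) (sym (coeff-scale a (mulP p q) k))) k) (shift-scale a (mulP p q) k)) ⟩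
    a * b * coeff q k + a * coeff (shift (mulP p q)) k
      ≈⟨ solve 4 (λ a b x y → a :* b :* x :+ a :* y := a :* (b :* x :+ y)) refl a b (coeff q k) _ ⟩
    a * (b * coeff q k + coeff (shift (mulP p q)) k)              ≈⟨ *-congˡ (mul-coeff b p q k) ⟨
    a * coeff (mulP (b ∷ p) q) k                                  ∎

  mul-shiftˡ : ∀ p q → mulP (shift p) q ≈ᴾ shift (mulP p q)
  mul-shiftˡ p q k = trans (mul-coeff 0# p q k) (trans (+-congʳ (zeroˡ _)) (+-identityˡ _))

  mul-assoc : ∀ p q r → mulP (mulP p q) r ≈ᴾ mulP p (mulP q r)
  mul-assoc []      q r k = refl
  mul-assoc (a ∷ p) q r k = begin
    coeff (mulP (addP (scale a q) (shift (mulP p q))) r) k                  ≈⟨ mul-distribʳ r (scale a q) _ k ⟩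
    coeff (addP (mulP (scale a q) r) (mulP (shift (mulP p q)) r)) k         ≈⟨ coeff-add (mulP (scale a q) r) _ k ⟩
    coeff (mulP (scale a q) r) k + coeff (mulP (shift (mulP p q)) r) k
      ≈⟨ +-cong (mul-scaleˡ a q r k) (trans (mul-shiftˡ (mulP p q) r k) (shift-cong (mul-assoc p q r) k)) ⟩
    a * coeff (mulP q r) k + coeff (shift (mulP p (mulP q r))) k            ≈⟨ mul-coeff a p (mulP q r) k ⟨
    coeff (mulP (a ∷ p) (mulP q r)) k                                       ∎

  mul-identityˡ : ∀ p → mulP (1# ∷ []) p ≈ᴾ p
  mul-identityˡ p k = trans (mul-coeff 1# [] p k) (trans (+-cong (*-identityˡ _) (shift-0 {[]} (λ _ → refl) k)) (+-identityʳ _))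

  polynomialRing : CommutativeRing c ℓ
  polynomialRing = record
    { Carrier = Poly
    ; _≈_     = _≈ᴾ_
    ; _+_     = addP
    ; _*_     = mulP
    ; -_      = List.map (-_)
    ; 0#      = []
    ; 1#      = 1# ∷ []
    ; isCommutativeRing = record
      { isRing = record
        { +-isAbelianGroup = record
          { isGroup = record
            { isMonoid = record
              { isSemigroup = record
                { isMagma = record
                  { isEquivalence = record
                    { refl  = λ k → refl
                    ; sym   = λ p≈q k → sym (p≈q k)
                    ; trans = λ p≈q q≈r k → trans (p≈q k) (q≈r k)
                    }
                  ; ∙-cong = λ {p} {p′} {q} {q′} p≈p′ q≈q′ k →
                      trans (coeff-add p q k) (trans (+-cong (p≈p′ k) (q≈q′ k)) (sym (coeff-add p′ q′ k)))
                  }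
                ; assoc = λ p q r k → begin
                    coeff (addP (addP p q) r) k            ≈⟨ trans (coeff-add (addP p q) r k) (+-congʳ (coeff-add p q k)) ⟩
                    (coeff p k + coeff q k) + coeff r k    ≈⟨ +-assoc _ _ _ ⟩
                    coeff p k + (coeff q k + coeff r k)    ≈⟨ trans (coeff-add p (addP q r) k) (+-congˡ (coeff-add q r k)) ⟨
                    coeff (addP p (addP q r)) k            ∎
                }
              ; identity = (λ p k → refl) , (λ p k → trans (coeff-add p [] k) (+-identityʳ _))
              }
            ; inverse = (λ p k → trans (coeff-add (List.map (-_) p) p k) (trans (+-congʳ (coeff-neg p k)) (-‿inverseˡ _)))
                      , (λ p k → trans (coeff-add p _ k) (trans (+-congˡ (coeff-neg p k)) (-‿inverseʳ _)))
            ; ⁻¹-cong = λ {p} {q} p≈q k → trans (coeff-neg p k) (trans (-‿cong (p≈q k)) (sym (coeff-neg q k)))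
            }
          ; comm = λ p q k → trans (coeff-add p q k) (trans (+-comm _ _) (sym (coeff-add q p k)))
          }
        ; *-cong = λ {p} {p′} {q} {q′} p≈p′ q≈q′ k → trans (mul-congˡ p p′ q p≈p′ k) (mul-congʳ p′ q≈q′ k)
        ; *-assoc = mul-assoc
        ; *-identity = mul-identityˡ , (λ p k → trans (mul-comm p _ k) (mul-identityˡ p k))
        ; distrib = mul-distribˡ , mul-distribʳ
        }
      ; *-comm = mul-comm
      }
    }

  eval : Poly → Carrier → Carrier
  eval []      x = 0#
  eval (a ∷ p) x = a + x * eval p x

  eval-0 : ∀ p x → p ≈ᴾ [] → eval p x ≈ 0#
  eval-0 []      x p≈0 = refl
  eval-0 (a ∷ p) x p≈0 = trans (+-cong (p≈0 0) (*-congˡ (eval-0 p x (λ k → p≈0 (suc k))))) (trans (+-identityˡ _) (zeroʳ x))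

  eval-cong : ∀ p q x → p ≈ᴾ q → eval p x ≈ eval q x
  eval-cong []      q       x p≈q = sym (eval-0 q x (λ k → sym (p≈q k)))
  eval-cong (a ∷ p) []      x p≈q = eval-0 (a ∷ p) x p≈q
  eval-cong (a ∷ p) (b ∷ q) x p≈q = +-cong (p≈q 0) (*-congˡ (eval-cong p q x (λ k → p≈q (suc k))))

  eval-add : ∀ p q x → eval (addP p q) x ≈ eval p x + eval q x
  eval-add []      q       x = sym (+-identityˡ _)
  eval-add (a ∷ p) []      x = sym (+-identityʳ _)
  eval-add (a ∷ p) (b ∷ q) x = trans (+-congˡ (*-congˡ (eval-add p q x)))
    (solve 5 (λ a b x y z → (a :+ b) :+ x :* (y :+ z) := (a :+ x :* y) :+ (b :+ x :* z)) refl a b x (eval p x) (eval q x))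

  eval-scale : ∀ a p x → eval (scale a p) x ≈ a * eval p x
  eval-scale a []      x = sym (zeroʳ a)
  eval-scale a (b ∷ p) x = trans (+-congˡ (*-congˡ (eval-scale a p x)))
    (solve 4 (λ a b x y → a :* b :+ x :* (a :* y) := a :* (b :+ x :* y)) refl a b x (eval p x))

  eval-mul : ∀ p q x → eval (mulP p q) x ≈ eval p x * eval q x
  eval-mul []      q x = sym (zeroˡ _)
  eval-mul (a ∷ p) q x = trans (eval-add (scale a q) _ x)
    (trans (+-cong (eval-scale a q x) (+-congˡ (*-congˡ (eval-mul p q x))))
    (trans (+-congˡ (+-identityˡ _))
    (solve 4 (λ a x y z → a :* z :+ x :* (y :* z) := (a :+ x :* y) :* z) refl a x (eval p x) (eval q x))))

  eval-const : ∀ a x → eval (const a) x ≈ a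
  eval-const a x = trans (+-congˡ (zeroʳ x)) (+-identityʳ a)

  eval-X : ∀ x → eval X x ≈ x
  eval-X x = trans (+-identityˡ _) (trans (*-congˡ (eval-const 1# x)) (*-identityʳ x))

  -- The product (b + X) d has coefficients b dₖ₊₁ + dₖ, so if they vanish
  -- then so do the coefficients of d, starting from the leading one.
  recurrence-0 : ∀ b d → (∀ k → b * coeff d (suc k) + coeff d k ≈ 0#) → d ≈ᴾ []
  recurrence-0 b []      rec k       = refl
  recurrence-0 b (a ∷ d) rec (suc k) = recurrence-0 b d (λ k → rec (suc k)) k
  recurrence-0 b (a ∷ d) rec zero    = begin
    a                        ≈⟨ +-identityˡ a ⟨
    0# + a                   ≈⟨ +-congʳ (trans (*-congˡ (recurrence-0 b d (λ k → rec (suc k)) 0)) (zeroʳ b)) ⟨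
    b * coeff d 0 + a        ≈⟨ rec 0 ⟩
    0#                       ∎

  -- The factor is monic, so it cancels over any commutative ring, zero divisors or not: the
  -- coefficients of the difference `d` satisfy the recurrence of `recurrence-0`. Common roots can
  -- thus be removed one at a time.
  linear-cancel : ∀ b p q → mulP (b ∷ 1# ∷ []) p ≈ᴾ mulP (b ∷ 1# ∷ []) q → p ≈ᴾ q
  linear-cancel b p q bp≈bq k = begin
    coeff p k                                ≈⟨ solve 2 (λ x y → x := (x :- y) :+ y) refl (coeff p k) (coeff q k) ⟩
    (coeff p k - coeff q k) + coeff q k      ≈⟨ +-congʳ (coeff-diff k) ⟨
    coeff d k + coeff q k                    ≈⟨ +-congʳ (recurrence-0 b d rec k) ⟩
    0# + coeff q k                           ≈⟨ +-identityˡ _ ⟩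
    coeff q k                                ∎
    where
    d = addP p (List.map (-_) q)
    coeff-diff : ∀ k → coeff d k ≈ coeff p k - coeff q k
    coeff-diff k = trans (coeff-add p _ k) (+-congˡ (coeff-neg q k))
    coefficients : ∀ e k → coeff (mulP (b ∷ 1# ∷ []) e) (suc k) ≈ b * coeff e (suc k) + coeff e k
    coefficients e k = trans (mul-coeff b (1# ∷ []) e (suc k)) (+-congˡ (mul-identityˡ e k))
    rec : ∀ k → b * coeff d (suc k) + coeff d k ≈ 0#
    rec k = begin
      b * coeff d (suc k) + coeff d k                                      ≈⟨ +-cong (*-congˡ (coeff-diff (suc k))) (coeff-diff k) ⟩
      b * (coeff p (suc k) - coeff q (suc k)) + (coeff p k - coeff q k)
        ≈⟨ solve 5 (λ b x y z w → b :* (x :- y) :+ (z :- w) := (b :* x :+ z) :- (b :* y :+ w)) refl b (coeff p (suc k)) (coeff q (suc k)) (coeff p k) (coeff q k) ⟩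
      (b * coeff p (suc k) + coeff p k) - (b * coeff q (suc k) + coeff q k)
        ≈⟨ +-cong (trans (sym (coefficients p k)) (bp≈bq (suc k))) (-‿cong (sym (coefficients q k))) ⟩
      coeff (mulP (b ∷ 1# ∷ []) q) (suc k) - coeff (mulP (b ∷ 1# ∷ []) q) (suc k) ≈⟨ -‿inverseʳ _ ⟩
      0#                                                                   ∎

-- Determinants of matrices indexed by lists

module Determinant {c ℓ} (K : CommutativeRing c ℓ) {i} (I : Set i) where
  open CommutativeRing K hiding (zero) renaming (refl to ≈-refl; sym to ≈-sym; trans to ≈-trans)
  open Algebra.Properties.Ring ring using (-0#≈0#; -‿involutive)
  open IntegerRingSolver K
  open RingOps rawRing
  open Permutation using (_↭_; refl; prep; swap; trans; ↭-sym; ↭-refl)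
  open Relation.Binary.Reasoning.Setoid setoid

  -- ∑ⱼ (−1)ʲ φ (csⱼ) (cs without csⱼ)
  expand : (I → List I → Carrier) → List I → Carrier
  expand φ []       = 0#
  expand φ (x ∷ cs) = φ x cs - expand (λ y rest → φ y (x ∷ rest)) cs

  Row : Set (c ⊔ i)
  Row = I → Carrier

  -- Rows are defined on all of `I` and the list of columns selects the entries, so sublists of
  -- columns need no reindexing. A non-square shape gets the value 0, which keeps the rules for
  -- swapping rows and columns free of side conditions on lengths.
  minor : List Row → List I → Carrier
  minor []       []      = 1#
  minor []       (_ ∷ _) = 0#
  minor (r ∷ rs) cs      = expand (λ x rest → r x * minor rs rest) cs

  expand-cong : ∀ cs {φ ψ} → (∀ x rest → x ∈ˡ cs → suc (length rest) ≡ length cs → φ x rest ≈ ψ x rest) →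
                expand φ cs ≈ expand ψ cs
  expand-cong []       φ≈ψ = ≈-refl
  expand-cong (x ∷ cs) φ≈ψ = +-cong (φ≈ψ x cs (here ≡.refl) ≡.refl)
    (-‿cong (expand-cong cs (λ y rest y∈cs eq → φ≈ψ y (x ∷ rest) (there y∈cs) (≡.cong suc eq))))

  expand-cong′ : ∀ cs {φ ψ} → (∀ x rest → φ x rest ≈ ψ x rest) → expand φ cs ≈ expand ψ cs
  expand-cong′ cs φ≈ψ = expand-cong cs (λ x rest _ _ → φ≈ψ x rest)

  expand-0 : ∀ cs {φ} → (∀ x rest → x ∈ˡ cs → φ x rest ≈ 0#) → expand φ cs ≈ 0#
  expand-0 []       φ≈0 = ≈-refl
  expand-0 (x ∷ cs) φ≈0 = ≈-trans (+-cong (φ≈0 x cs (here ≡.refl)) (-‿cong (expand-0 cs (λ y rest y∈cs → φ≈0 y (x ∷ rest) (there y∈cs)))))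
    (-‿inverseʳ 0#)

  expand-+ : ∀ cs φ ψ → expand (λ x rest → φ x rest + ψ x rest) cs ≈ expand φ cs + expand ψ cs
  expand-+ []       φ ψ = ≈-sym (+-identityˡ 0#)
  expand-+ (x ∷ cs) φ ψ = ≈-trans (+-congˡ (-‿cong (expand-+ cs _ _)))
    (solve 4 (λ a b c d → (a :+ b) :- (c :+ d) := (a :- c) :+ (b :- d)) ≈-refl _ _ _ _)

  expand-* : ∀ cs a φ → expand (λ x rest → a * φ x rest) cs ≈ a * expand φ cs
  expand-* []       a φ = ≈-sym (zeroʳ a)
  expand-* (x ∷ cs) a φ = ≈-trans (+-congˡ (-‿cong (expand-* cs a _)))
    (solve 3 (λ a x y → a :* x :- a :* y := a :* (x :- y)) ≈-refl a _ _)

  expand-neg : ∀ cs φ → expand (λ x rest → - φ x rest) cs ≈ - expand φ cs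
  expand-neg []       φ = ≈-sym -0#≈0#
  expand-neg (x ∷ cs) φ = ≈-trans (+-congˡ (-‿cong (expand-neg cs _)))
    (solve 2 (λ x y → :- x :- (:- y) := :- (x :- y)) ≈-refl _ _)

  expand₂ : (I → I → List I → Carrier) → List I → Carrier
  expand₂ ψ = expand λ x → expand (ψ x)

  -- Ordered pairs of columns are sorted into those with `x` first, those with `x` second and those
  -- avoiding `x`. In the last family `x` is passed over twice, so the two signs that it causes
  -- cancel.
  expand₂-∷ : ∀ ψ x cs → expand₂ ψ (x ∷ cs) ≈
              (expand (ψ x) cs - expand (λ y → ψ y x) cs) + expand₂ (λ y z rest → ψ y z (x ∷ rest)) cs
  expand₂-∷ ψ x cs = begin
    expand (ψ x) cs - expand (λ y rest → ψ y x rest - expand (λ z rest′ → ψ y z (x ∷ rest′)) rest) cs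
      ≈⟨ +-congˡ (-‿cong (≈-trans (expand-+ cs _ _) (+-congˡ (expand-neg cs _)))) ⟩
    expand (ψ x) cs - (expand (λ y → ψ y x) cs - expand₂ (λ y z rest → ψ y z (x ∷ rest)) cs)
      ≈⟨ solve 3 (λ a b c → a :- (b :- c) := (a :- b) :+ c) ≈-refl _ _ _ ⟩
    _ ∎

  -- Reversing the order of removal exchanges the first two families of `expand₂-∷`, which carry
  -- opposite signs; the third is the induction hypothesis.
  expand₂-antisym : ∀ ψ cs → expand₂ ψ cs ≈ - expand₂ (λ x y → ψ y x) cs
  expand₂-antisym ψ []       = ≈-sym -0#≈0#
  expand₂-antisym ψ (x ∷ cs) = begin
    expand₂ ψ (x ∷ cs)
      ≈⟨ expand₂-∷ ψ x cs ⟩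
    (expand (ψ x) cs - expand (λ y → ψ y x) cs) + expand₂ (λ y z rest → ψ y z (x ∷ rest)) cs
      ≈⟨ +-congˡ (expand₂-antisym _ cs) ⟩
    (expand (ψ x) cs - expand (λ y → ψ y x) cs) - expand₂ (λ y z rest → ψ z y (x ∷ rest)) cs
      ≈⟨ solve 3 (λ a b c → (a :- b) :- c := :- ((b :- a) :+ c)) ≈-refl _ _ _ ⟩
    - ((expand (λ y → ψ y x) cs - expand (ψ x) cs) + expand₂ (λ y z rest → ψ z y (x ∷ rest)) cs)
      ≈⟨ -‿cong (expand₂-∷ (λ x y → ψ y x) x cs) ⟨
    - expand₂ (λ x y → ψ y x) (x ∷ cs) ∎

  -- Expanding along two leading rows is an `expand₂`, and its antisymmetry is the sign; further
  -- rows in front only wrap another expansion around it.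
  minor-swap-rows : ∀ rs r r′ rs′ cs → minor (rs ++ r ∷ r′ ∷ rs′) cs ≈ - minor (rs ++ r′ ∷ r ∷ rs′) cs
  minor-swap-rows []       r r′ rs′ cs = begin
    expand (λ x rest → r x * expand (λ y rest′ → r′ y * minor rs′ rest′) rest) cs
      ≈⟨ expand-cong′ cs (λ x rest → expand-* rest (r x) _) ⟨
    expand₂ (λ x y rest → r x * (r′ y * minor rs′ rest)) cs
      ≈⟨ expand₂-antisym _ cs ⟩
    - expand₂ (λ x y rest → r y * (r′ x * minor rs′ rest)) cs
      ≈⟨ -‿cong (expand-cong′ cs λ x rest → ≈-trans
           (expand-cong′ rest (λ y rest′ → solve 3 (λ a b c → a :* (b :* c) := b :* (a :* c)) ≈-refl _ _ _))
           (expand-* rest (r′ x) _)) ⟩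
    - expand (λ x rest → r′ x * expand (λ y rest′ → r y * minor rs′ rest′) rest) cs ∎
  minor-swap-rows (s ∷ rs) r r′ rs′ cs = ≈-trans
    (expand-cong′ cs λ x rest → ≈-trans (*-congˡ (minor-swap-rows rs r r′ rs′ rest))
      (solve 2 (λ a b → a :* (:- b) := :- (a :* b)) ≈-refl _ _))
    (expand-neg cs _)

  -- Removing `x` or `y` itself leaves the same list on both sides, but from neighbouring positions
  -- and so with opposite signs. Removing any other column leaves `x` and `y` adjacent, and `anti`
  -- supplies the sign.
  expand-swap : ∀ φ cs x y cs′ → (∀ z ds ds′ → φ z (ds ++ x ∷ y ∷ ds′) ≈ - φ z (ds ++ y ∷ x ∷ ds′)) →
                expand φ (cs ++ x ∷ y ∷ cs′) ≈ - expand φ (cs ++ y ∷ x ∷ cs′)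
  expand-swap φ [] x y cs′ anti = begin
    φ x (y ∷ cs′) - (φ y (x ∷ cs′) - expand (λ z rest → φ z (x ∷ y ∷ rest)) cs′)
      ≈⟨ +-congˡ (-‿cong (+-congˡ (-‿cong (≈-trans (expand-cong′ cs′ (λ z rest → anti z [] rest)) (expand-neg cs′ _))))) ⟩
    φ x (y ∷ cs′) - (φ y (x ∷ cs′) - (- expand (λ z rest → φ z (y ∷ x ∷ rest)) cs′))
      ≈⟨ solve 3 (λ a b c → a :- (b :- (:- c)) := :- (b :- (a :- c))) ≈-refl _ _ _ ⟩
    - (φ y (x ∷ cs′) - (φ x (y ∷ cs′) - expand (λ z rest → φ z (y ∷ x ∷ rest)) cs′)) ∎
  expand-swap φ (c ∷ cs) x y cs′ anti = ≈-trans
    (+-cong (anti c cs cs′) (-‿cong (expand-swap (λ z rest → φ z (c ∷ rest)) cs x y cs′ (λ z ds → anti z (c ∷ ds)))))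
    (solve 2 (λ a b → (:- a) :- (:- b) := :- (a :- b)) ≈-refl _ _)

  minor-swap-columns : ∀ rs cs x y cs′ → minor rs (cs ++ x ∷ y ∷ cs′) ≈ - minor rs (cs ++ y ∷ x ∷ cs′)
  minor-swap-columns []       []       x y cs′ = ≈-sym -0#≈0#
  minor-swap-columns []       (_ ∷ _)  x y cs′ = ≈-sym -0#≈0#
  minor-swap-columns (r ∷ rs) cs       x y cs′ = expand-swap _ cs x y cs′ λ z ds ds′ →
    ≈-trans (*-congˡ (minor-swap-columns rs ds x y ds′)) (solve 2 (λ a b → a :* (:- b) := :- (a :* b)) ≈-refl _ _)

  expand-++ : ∀ φ cs cs′ → (∀ x rest → x ∈ˡ cs′ → φ x rest ≈ 0#) →
              expand φ (cs ++ cs′) ≈ expand (λ x rest → φ x (rest ++ cs′)) cs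
  expand-++ φ []       cs′ φ≈0 = expand-0 cs′ φ≈0
  expand-++ φ (x ∷ cs) cs′ φ≈0 = +-congˡ (-‿cong (expand-++ _ cs cs′ (λ y rest y∈cs′ → φ≈0 y (x ∷ rest) y∈cs′)))

  -- Block triangularity: the rows `rs` vanish on `cs′`, so expanding along them only ever removes
  -- columns of `cs`, and equal lengths make `rs` and `cs` run out together. Nothing is asked of the
  -- opposite block.
  minor-++ : ∀ rs rs′ cs cs′ → length rs ≡ length cs → (∀ {r x} → r ∈ˡ rs → x ∈ˡ cs′ → r x ≈ 0#) →
             minor (rs ++ rs′) (cs ++ cs′) ≈ minor rs cs * minor rs′ cs′
  minor-++ []       rs′ []  cs′ eq r≈0 = ≈-sym (*-identityˡ _)
  minor-++ (r ∷ rs) rs′ cs  cs′ eq r≈0 = begin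
    expand (λ x rest → r x * minor (rs ++ rs′) rest) (cs ++ cs′)
      ≈⟨ expand-++ _ cs cs′ (λ x rest x∈cs′ → ≈-trans (*-congʳ (r≈0 (here ≡.refl) x∈cs′)) (zeroˡ _)) ⟩
    expand (λ x rest → r x * minor (rs ++ rs′) (rest ++ cs′)) cs
      ≈⟨ expand-cong cs (λ x rest _ eq′ → ≈-trans
           (*-congˡ (minor-++ rs rs′ rest cs′ (ℕ.suc-injective (≡.trans eq (≡.sym eq′))) (λ r∈rs → r≈0 (there r∈rs))))
           (solve 3 (λ a b c → a :* (b :* c) := c :* (a :* b)) ≈-refl _ _ _)) ⟩
    expand (λ x rest → minor rs′ cs′ * (r x * minor rs rest)) cs
      ≈⟨ ≈-trans (expand-* cs (minor rs′ cs′) _) (*-comm _ _) ⟩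
    minor (r ∷ rs) cs * minor rs′ cs′ ∎

  -- det-pairs lists each row together with the column at the same position,
  -- so permuting the list permutes rows and columns simultaneously.
  det-pairs : List (Row × I) → Carrier
  det-pairs ps = minor (map proj₁ ps) (map proj₂ ps)

  private
    prefix : ∀ ps qs → det-pairs (ps ++ qs) ≡ minor (map proj₁ ps ++ map proj₁ qs) (map proj₂ ps ++ map proj₂ qs)
    prefix ps qs = ≡.cong₂ minor (List.map-++ proj₁ ps qs) (List.map-++ proj₂ ps qs)

  -- The fixed prefix `zs` is what the induction needs, since a `prep` leaves a pair in front of the
  -- permuted part. Exchanging two neighbouring pairs exchanges two rows and two columns, and the
  -- two signs cancel.
  det-pairs-↭-prefix : ∀ zs {ps qs} → ps ↭ qs → det-pairs (zs ++ ps) ≈ det-pairs (zs ++ qs)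
  det-pairs-↭-prefix zs refl = ≈-refl
  det-pairs-↭-prefix zs (prep {ps} {qs} p ps↭qs) = begin
    det-pairs (zs ++ p ∷ ps)         ≡⟨ ≡.cong det-pairs (List.∷ʳ-++ zs p ps) ⟨
    det-pairs ((zs List.∷ʳ p) ++ ps)      ≈⟨ det-pairs-↭-prefix (zs List.∷ʳ p) ps↭qs ⟩
    det-pairs ((zs List.∷ʳ p) ++ qs)      ≡⟨ ≡.cong det-pairs (List.∷ʳ-++ zs p qs) ⟩
    det-pairs (zs ++ p ∷ qs)         ∎
  det-pairs-↭-prefix zs (swap {ps} {qs} p@(r , x) q@(s , y) ps↭qs) = begin
    det-pairs (zs ++ p ∷ q ∷ ps)                           ≡⟨ ≡.cong det-pairs (List.++-assoc zs (p ∷ q ∷ []) ps) ⟨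
    det-pairs ((zs ++ p ∷ q ∷ []) ++ ps)                   ≈⟨ det-pairs-↭-prefix (zs ++ p ∷ q ∷ []) ps↭qs ⟩
    det-pairs ((zs ++ p ∷ q ∷ []) ++ qs)                   ≡⟨ ≡.cong det-pairs (List.++-assoc zs (p ∷ q ∷ []) qs) ⟩
    det-pairs (zs ++ p ∷ q ∷ qs)                           ≡⟨ prefix zs (p ∷ q ∷ qs) ⟩
    minor (zr ++ r ∷ s ∷ qr) (zc ++ x ∷ y ∷ qc)            ≈⟨ minor-swap-rows zr r s qr _ ⟩
    - minor (zr ++ s ∷ r ∷ qr) (zc ++ x ∷ y ∷ qc)          ≈⟨ -‿cong (minor-swap-columns (zr ++ s ∷ r ∷ qr) zc x y qc) ⟩
    - - minor (zr ++ s ∷ r ∷ qr) (zc ++ y ∷ x ∷ qc)        ≈⟨ -‿involutive _ ⟩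
    minor (zr ++ s ∷ r ∷ qr) (zc ++ y ∷ x ∷ qc)            ≡⟨ prefix zs (q ∷ p ∷ qs) ⟨
    det-pairs (zs ++ q ∷ p ∷ qs)                           ∎
    where
    zr = map proj₁ zs
    zc = map proj₂ zs
    qr = map proj₁ qs
    qc = map proj₂ qs
  det-pairs-↭-prefix zs (trans ps↭qs qs↭rs) = ≈-trans (det-pairs-↭-prefix zs ps↭qs) (det-pairs-↭-prefix zs qs↭rs)

  det-pairs-↭ : ∀ {ps qs} → ps ↭ qs → det-pairs ps ≈ det-pairs qs
  det-pairs-↭ = det-pairs-↭-prefix []

  det-pairs-++ : ∀ ps qs → (∀ {r x s y} → (r , x) ∈ˡ ps → (s , y) ∈ˡ qs → r y ≈ 0#) →
                 det-pairs (ps ++ qs) ≈ det-pairs ps * det-pairs qs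
  det-pairs-++ ps qs block = ≈-trans (reflexive (prefix ps qs))
    (minor-++ (map proj₁ ps) (map proj₁ qs) (map proj₂ ps) (map proj₂ qs)
      (≡.trans (List.length-map proj₁ ps) (≡.sym (List.length-map proj₂ ps))) zero-block)
    where
    zero-block : ∀ {r x} → r ∈ˡ map proj₁ ps → x ∈ˡ map proj₂ qs → r x ≈ 0#
    zero-block r∈ x∈ with ∈-map⁻ proj₁ r∈ | ∈-map⁻ proj₂ x∈
    ... | _ , p∈ps , ≡.refl | _ , q∈qs , ≡.refl = block p∈ps q∈qs

  det-pairs-singleton : ∀ r x → det-pairs ((r , x) ∷ []) ≈ r x
  det-pairs-singleton r x = ≈-trans (+-cong (*-identityʳ _) -0#≈0#) (+-identityʳ _)

  det-pairs-row-cong : ∀ r r′ x ps → (∀ {y} → y ∈ˡ x ∷ map proj₂ ps → r y ≈ r′ y) →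
                       det-pairs ((r , x) ∷ ps) ≈ det-pairs ((r′ , x) ∷ ps)
  det-pairs-row-cong r r′ x ps r≈r′ = expand-cong (x ∷ map proj₂ ps) (λ y rest y∈ _ → *-congʳ {minor (map proj₁ ps) rest} (r≈r′ y∈))

  det-pairs-row-+ : ∀ r r′ x ps → det-pairs (((λ y → r y + r′ y) , x) ∷ ps) ≈
                    det-pairs ((r , x) ∷ ps) + det-pairs ((r′ , x) ∷ ps)
  det-pairs-row-+ r r′ x ps = ≈-trans
    (expand-cong′ (x ∷ map proj₂ ps) (λ y rest → distribʳ (minor (map proj₁ ps) rest) (r y) (r′ y)))
    (expand-+ (x ∷ map proj₂ ps) (λ y rest → r y * minor (map proj₁ ps) rest) (λ y rest → r′ y * minor (map proj₁ ps) rest))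

  det-pairs-swap-columns : ∀ r x s y ps → det-pairs ((r , x) ∷ (s , y) ∷ ps) ≈ - det-pairs ((r , y) ∷ (s , x) ∷ ps)
  det-pairs-swap-columns r x s y ps = minor-swap-columns (r ∷ s ∷ map proj₁ ps) [] x y (map proj₂ ps)

  -- The product `product (removeAt G j)`, in a form that follows the recursion over branches in
  -- `principal-star`.
  others : ∀ {n} → Vector Carrier n → Fin n → Carrier
  others G zero    = product (tail G)
  others G (suc j) = G zero * others (tail G) j

  product-removeAt : ∀ {n} (G : Vector Carrier (suc n)) j → product (removeAt G j) ≈ others G j
  product-removeAt         G zero    = ≈-refl
  product-removeAt {suc n} G (suc j) = *-congˡ (product-removeAt (tail G) j)

  expand-tabulate : ∀ {n} φ (xs : Fin (suc n) → I) →
    expand φ (tabulate xs) ≈ sum (λ j → alternate j (φ (xs j) (tabulate (xs ∘ punchIn j))))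
  expand-tabulate {zero}  φ xs = +-congˡ -0#≈0#
  expand-tabulate {suc n} φ xs = +-congˡ (≈-trans (-‿cong (expand-tabulate (λ y rest → φ y (xs zero ∷ rest)) (xs ∘ suc)))
    (neg-sum (λ j → alternate j (φ (xs (suc j)) (xs zero ∷ tabulate (xs ∘ suc ∘ punchIn j))))))
    where
    neg-sum : ∀ {m} (t : Vector Carrier m) → - sum t ≈ sum (λ j → - t j)
    neg-sum {zero}  t = -0#≈0#
    neg-sum {suc m} t = ≈-trans (solve 2 (λ a b → :- (a :+ b) := :- a :+ :- b) ≈-refl _ _) (+-congˡ (neg-sum (tail t)))

  alternate-cong : ∀ {n} (j : Fin n) {a b} → a ≈ b → alternate j a ≈ alternate j b
  alternate-cong zero    a≈b = a≈b
  alternate-cong (suc j) a≈b = -‿cong (alternate-cong j a≈b)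

  det-minor : ∀ {n} (M : Fin n → Row) (xs : Fin n → I) (N : Matrix Carrier n) → (∀ k l → N k l ≈ M k (xs l)) →
              det N ≈ minor (tabulate M) (tabulate xs)
  det-minor {zero}  M xs N N≈M = ≈-refl
  det-minor {suc n} M xs N N≈M = ≈-trans
    (sum-cong (λ j → alternate-cong j (*-cong (N≈M zero j)
      (det-minor (M ∘ suc) (xs ∘ punchIn j) _ (λ k l → N≈M (suc k) (punchIn j l))))))
    (≈-sym (expand-tabulate (λ x rest → M zero x * minor (tabulate (M ∘ suc)) rest) xs))
    where
    open Algebra.Properties.CommutativeMonoid.Sum +-commutativeMonoid using () renaming (sum-cong-≋ to sum-cong)

  module Principal (_≟_ : DecidableEquality I) (M : I → Row) where
    pairs : List I → List (Row × I)
    pairs = map λ x → M x , x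

    principal : List I → Carrier
    principal xs = det-pairs (pairs xs)

    principal-tabulate : ∀ {n} (xs : Fin n → I) (N : Matrix Carrier n) → (∀ k l → N k l ≈ M (xs k) (xs l)) →
                         det N ≈ principal (tabulate xs)
    principal-tabulate xs N N≈M = ≈-trans (det-minor (M ∘ xs) xs N N≈M) (reflexive (≡.sym (≡.cong₂ minor
      (≡.trans (≡.cong (map proj₁) (List.map-tabulate xs _)) (List.map-tabulate _ proj₁))
      (≡.trans (≡.cong (map proj₂) (List.map-tabulate xs _)) (List.map-tabulate _ proj₂)))))

    principal-↭ : ∀ {xs ys} → xs ↭ ys → principal xs ≈ principal ys
    principal-↭ xs↭ys = det-pairs-↭ (↭.map⁺ _ xs↭ys)

    ∈-pairs⁻ : ∀ {r x} xs → (r , x) ∈ˡ pairs xs → r ≡ M x × x ∈ˡ xs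
    ∈-pairs⁻ xs p∈ with ∈-map⁻ _ p∈
    ... | _ , x∈xs , ≡.refl = ≡.refl , x∈xs

    Disconnected : List I → List I → Set _
    Disconnected xs ys = ∀ {x y} → x ∈ˡ xs → y ∈ˡ ys → M x y ≈ 0# × M y x ≈ 0#

    principal-++ : ∀ xs ys → Disconnected xs ys → principal (xs ++ ys) ≈ principal xs * principal ys
    principal-++ xs ys disc = ≈-trans (reflexive (≡.cong det-pairs (List.map-++ _ xs ys)))
      (det-pairs-++ (pairs xs) (pairs ys) block)
      where
      block : ∀ {r x s y} → (r , x) ∈ˡ pairs xs → (s , y) ∈ˡ pairs ys → r y ≈ 0#
      block p∈ q∈ with ∈-pairs⁻ xs p∈ | ∈-pairs⁻ ys q∈
      ... | ≡.refl , x∈ | ≡.refl , y∈ = proj₁ (disc x∈ y∈)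

    ∈-proj₂-pairs : ∀ {x} xs → x ∈ˡ map proj₂ (pairs xs) → x ∈ˡ xs
    ∈-proj₂-pairs xs x∈ with ∈-map⁻ proj₂ x∈
    ... | _ , p∈ , ≡.refl = proj₂ (∈-pairs⁻ xs p∈)

    module _ {v n} (xs ys : List I) (v∉xs : ∀ {x} → x ∈ˡ n ∷ xs → x ≢ v) (v∉ys : ∀ {y} → y ∈ˡ ys → y ≢ v)
             (v-xs : Disconnected (v ∷ []) xs) (xs-ys : Disconnected (n ∷ xs) ys) where
      private
        -- By linearity the row of `n` is split into its part away from `v` and its entry at `v`.
        -- With `off`, the branch `n ∷ xs` decouples from `v ∷ ys`; with `at`, the link between `v`
        -- and `n` is used in both directions.
        off at : Row
        off x with x ≟ v
        ... | yes _ = 0#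
        ... | no  _ = M n x
        at x with x ≟ v
        ... | yes _ = M n v
        ... | no  _ = 0#

        off+at : ∀ x → M n x ≈ off x + at x
        off+at x with x ≟ v
        ... | yes ≡.refl = ≈-sym (+-identityˡ _)
        ... | no  _      = ≈-sym (+-identityʳ _)

        off-v : off v ≈ 0#
        off-v with v ≟ v
        ... | yes _   = ≈-refl
        ... | no  v≢v = contradiction ≡.refl v≢v

        off-other : ∀ {x} → x ≢ v → off x ≈ M n x
        off-other {x} x≢v with x ≟ v
        ... | yes x≡v = contradiction x≡v x≢v
        ... | no  _   = ≈-refl

        at-v : at v ≈ M n v
        at-v with v ≟ v
        ... | yes _   = ≈-refl
        ... | no  v≢v = contradiction ≡.refl v≢v

        at-other : ∀ {x} → x ≢ v → at x ≈ 0#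
        at-other {x} x≢v with x ≟ v
        ... | yes x≡v = contradiction x≡v x≢v
        ... | no  _   = ≈-refl

        off-part : det-pairs ((off , n) ∷ pairs (xs ++ v ∷ ys)) ≈ principal (n ∷ xs) * principal (v ∷ ys)
        off-part = begin
          det-pairs ((off , n) ∷ pairs (xs ++ v ∷ ys))
            ≡⟨ ≡.cong (λ ps → det-pairs ((off , n) ∷ ps)) (List.map-++ _ xs (v ∷ ys)) ⟩
          det-pairs (((off , n) ∷ pairs xs) ++ pairs (v ∷ ys))
            ≈⟨ det-pairs-++ ((off , n) ∷ pairs xs) (pairs (v ∷ ys)) block ⟩
          det-pairs ((off , n) ∷ pairs xs) * principal (v ∷ ys)
            ≈⟨ *-congʳ (det-pairs-row-cong off (M n) n (pairs xs) λ where
                 (here ≡.refl) → off-other (v∉xs (here ≡.refl))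
                 (there x∈)    → off-other (v∉xs (there (∈-proj₂-pairs xs x∈)))) ⟩
          principal (n ∷ xs) * principal (v ∷ ys) ∎
          where
          block : ∀ {r x s y} → (r , x) ∈ˡ (off , n) ∷ pairs xs → (s , y) ∈ˡ pairs (v ∷ ys) → r y ≈ 0#
          block p∈ q∈ with ∈-pairs⁻ (v ∷ ys) q∈
          block (here ≡.refl) q∈ | ≡.refl , here ≡.refl = off-v
          block (here ≡.refl) q∈ | ≡.refl , there y∈ys = ≈-trans (off-other (v∉ys y∈ys)) (proj₁ (xs-ys (here ≡.refl) y∈ys))
          block (there p∈)    q∈ | ≡.refl , y∈ with ∈-pairs⁻ xs p∈ | y∈
          ... | ≡.refl , x∈ | here ≡.refl = proj₂ (v-xs (here ≡.refl) x∈)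
          ... | ≡.refl , x∈ | there y∈ys  = proj₁ (xs-ys (there x∈) y∈ys)

        at-part : det-pairs ((at , n) ∷ (M v , v) ∷ pairs (xs ++ ys)) ≈ - (M n v * (principal ys * (M v n * principal xs)))
        at-part = begin
          det-pairs ((at , n) ∷ (M v , v) ∷ pairs (xs ++ ys))
            ≈⟨ det-pairs-swap-columns at n (M v) v (pairs (xs ++ ys)) ⟩
          - det-pairs ((at , v) ∷ (M v , n) ∷ pairs (xs ++ ys))
            ≈⟨ -‿cong (≈-trans (det-pairs-++ ((at , v) ∷ []) ((M v , n) ∷ pairs (xs ++ ys)) at-block)
                 (*-congʳ (≈-trans (det-pairs-singleton at v) at-v))) ⟩
          - (M n v * det-pairs ((M v , n) ∷ pairs (xs ++ ys)))
            ≈⟨ -‿cong (*-congˡ (≈-trans (reflexive (≡.cong (λ ps → det-pairs ((M v , n) ∷ ps)) (List.map-++ _ xs ys)))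
                 (det-pairs-↭ (↭.++-comm ((M v , n) ∷ pairs xs) (pairs ys))))) ⟩
          -- The row of `v` may be nonzero on `ys`, so `ys` has to come first: its rows vanish on
          -- `n ∷ xs`, which is the block that must be zero.
          - (M n v * det-pairs (pairs ys ++ (M v , n) ∷ pairs xs))
            ≈⟨ -‿cong (*-congˡ (det-pairs-++ (pairs ys) ((M v , n) ∷ pairs xs) ys-block)) ⟩
          - (M n v * (principal ys * det-pairs ((M v , n) ∷ pairs xs)))
            ≈⟨ -‿cong (*-congˡ (*-congˡ (≈-trans (det-pairs-++ ((M v , n) ∷ []) (pairs xs) v-block)
                 (*-congʳ (det-pairs-singleton (M v) n))))) ⟩
          - (M n v * (principal ys * (M v n * principal xs))) ∎
          where
          at-block : ∀ {r x s y} → (r , x) ∈ˡ (at , v) ∷ [] → (s , y) ∈ˡ (M v , n) ∷ pairs (xs ++ ys) → r y ≈ 0#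
          at-block (here ≡.refl) (here ≡.refl) = at-other (v∉xs (here ≡.refl))
          at-block (here ≡.refl) (there q∈) with ∈-++⁻ xs (proj₂ (∈-pairs⁻ (xs ++ ys) q∈))
          ... | inj₁ y∈xs = at-other (v∉xs (there y∈xs))
          ... | inj₂ y∈ys = at-other (v∉ys y∈ys)
          ys-block : ∀ {r x s y} → (r , x) ∈ˡ pairs ys → (s , y) ∈ˡ (M v , n) ∷ pairs xs → r y ≈ 0#
          ys-block p∈ q∈ with ∈-pairs⁻ ys p∈
          ys-block p∈ (here ≡.refl) | ≡.refl , x∈ = proj₂ (xs-ys (here ≡.refl) x∈)
          ys-block p∈ (there q∈)    | ≡.refl , x∈ = proj₂ (xs-ys (there (proj₂ (∈-pairs⁻ xs q∈))) x∈)
          v-block : ∀ {r x s y} → (r , x) ∈ˡ (M v , n) ∷ [] → (s , y) ∈ˡ pairs xs → r y ≈ 0#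
          v-block (here ≡.refl) q∈ = proj₁ (v-xs (here ≡.refl) (proj₂ (∈-pairs⁻ xs q∈)))

      principal-glue : principal (v ∷ (n ∷ xs) ++ ys) ≈
        principal (v ∷ ys) * principal (n ∷ xs) - M v n * M n v * (principal xs * principal ys)
      principal-glue = begin
        principal (v ∷ n ∷ xs ++ ys)
          ≈⟨ principal-↭ (swap v n (↭-refl {x = xs ++ ys})) ⟩
        principal (n ∷ v ∷ xs ++ ys)
          ≈⟨ det-pairs-row-cong (M n) _ n (pairs (v ∷ xs ++ ys)) (λ {x} _ → off+at x) ⟩
        det-pairs (((λ x → off x + at x) , n) ∷ pairs (v ∷ xs ++ ys))
          ≈⟨ det-pairs-row-+ off at n (pairs (v ∷ xs ++ ys)) ⟩
        det-pairs ((off , n) ∷ pairs (v ∷ xs ++ ys)) + det-pairs ((at , n) ∷ pairs (v ∷ xs ++ ys))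
          ≈⟨ +-cong (≈-trans (det-pairs-↭ (prep _ (↭-sym (↭.map⁺ _ (↭.shift v xs ys))))) off-part) at-part ⟩
        principal (n ∷ xs) * principal (v ∷ ys) - M n v * (principal ys * (M v n * principal xs))
          ≈⟨ solve 6 (λ a b c d e f → a :* b :- c :* (d :* (e :* f)) := b :* a :- e :* c :* (f :* d))
               ≈-refl (principal (n ∷ xs)) (principal (v ∷ ys)) (M n v) (principal ys) (M v n) (principal xs) ⟩
        principal (v ∷ ys) * principal (n ∷ xs) - M v n * M n v * (principal xs * principal ys) ∎

    ∈-concat-tabulate⁻ : ∀ {d x} (C : Fin d → List I) → x ∈ˡ concat (tabulate C) → ∃ λ j → x ∈ˡ C j
    ∈-concat-tabulate⁻ C x∈ with ∈-concat⁻′ (tabulate C) x∈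
    ... | _ , x∈xs , xs∈ with ∈-tabulate⁻ xs∈
    ... | j , ≡.refl = j , x∈xs

    principal-concat : ∀ {d} (C : Fin d → List I) → (∀ {i j} → i ≢ j → Disconnected (C i) (C j)) →
                       principal (concat (tabulate C)) ≈ product (λ j → principal (C j))
    principal-concat {zero}  C disc = ≈-refl
    principal-concat {suc d} C disc = ≈-trans (principal-++ (C zero) _ disc₀)
      (*-congˡ (principal-concat (C ∘ suc) (λ i≢j → disc (i≢j ∘ suc-injective))))
      where
      disc₀ : Disconnected (C zero) (concat (tabulate (C ∘ suc)))
      disc₀ x∈ y∈ with ∈-concat-tabulate⁻ (C ∘ suc) y∈
      ... | j , y∈C = disc (λ ()) x∈ y∈C

    -- Branches are detached from `v` one at a time by `principal-glue`. If the link to the first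
    -- branch is used, `v` is consumed and the remaining branches are mutually disconnected, so they
    -- contribute the plain product of `principal-concat`.
    principal-star : ∀ {d v} (nbr : Fin d → I) (rest : Fin d → List I) → let C = λ j → nbr j ∷ rest j in
      (∀ j {x} → x ∈ˡ C j → x ≢ v) →
      (∀ j → Disconnected (v ∷ []) (rest j)) →
      (∀ {i j} → i ≢ j → Disconnected (C i) (C j)) →
      principal (v ∷ concat (tabulate C)) ≈
        M v v * product (λ j → principal (C j)) -
        sum (λ j → M v (nbr j) * M (nbr j) v * (principal (rest j) * others (λ i → principal (C i)) j))
    principal-star {zero} {v} nbr rest v∉ v-rest disc = ≈-trans (det-pairs-singleton (M v) v)
      (≈-sym (≈-trans (+-cong (*-identityʳ _) -0#≈0#) (+-identityʳ _)))
    principal-star {suc d} {v} nbr rest v∉ v-rest disc = begin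
      principal (v ∷ C zero ++ ys)
        ≈⟨ principal-glue (rest zero) ys (v∉ zero) v∉ys (v-rest zero) disc₀ ⟩
      principal (v ∷ ys) * G zero - W zero * (H zero * principal ys)
        ≈⟨ +-cong (*-congʳ (principal-star (nbr ∘ suc) (rest ∘ suc) (v∉ ∘ suc) (v-rest ∘ suc) disc′))
                  (-‿cong (*-congˡ (*-congˡ (principal-concat (C ∘ suc) disc′)))) ⟩
      (M v v * product (tail G) - sum (λ j → W (suc j) * (H (suc j) * others (tail G) j))) * G zero -
        W zero * (H zero * product (tail G))
        ≈⟨ solve 5 (λ a p s g w → (a :* p :- s) :* g :- w := a :* (g :* p) :- (w :+ g :* s)) ≈-refl _ _ _ _ _ ⟩
      M v v * product G - (W zero * (H zero * product (tail G)) +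
        G zero * sum (λ j → W (suc j) * (H (suc j) * others (tail G) j)))
        ≈⟨ +-congˡ (-‿cong (+-congˡ (≈-trans (*-distribˡ-sum (G zero) (λ j → W (suc j) * (H (suc j) * others (tail G) j))) (sum-cong λ j →
             solve 4 (λ g w h o → g :* (w :* (h :* o)) := w :* (h :* (g :* o))) ≈-refl
               (G zero) (W (suc j)) (H (suc j)) (others (tail G) j))))) ⟩
      M v v * product G - sum (λ j → W j * (H j * others G j)) ∎
      where
      open Algebra.Properties.CommutativeMonoid.Sum +-commutativeMonoid using () renaming (sum-cong-≋ to sum-cong)
      open Algebra.Properties.Semiring.Sum semiring using (*-distribˡ-sum)
      C = λ j → nbr j ∷ rest j
      ys = concat (tabulate (C ∘ suc))
      G H W : Vector Carrier (suc d)
      G j = principal (C j)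
      H j = principal (rest j)
      W j = M v (nbr j) * M (nbr j) v
      disc′ : ∀ {i j} → i ≢ j → Disconnected (C (suc i)) (C (suc j))
      disc′ i≢j = disc (i≢j ∘ suc-injective)
      v∉ys : ∀ {y} → y ∈ˡ ys → y ≢ v
      v∉ys y∈ with ∈-concat-tabulate⁻ (C ∘ suc) y∈
      ... | j , y∈C = v∉ (suc j) y∈C
      disc₀ : Disconnected (C zero) ys
      disc₀ x∈ y∈ with ∈-concat-tabulate⁻ (C ∘ suc) y∈
      ... | j , y∈C = disc (λ ()) x∈ y∈C

-- Signs and interlacing

module SignCounting {c ℓ₁ ℓ₂} (ℝ : RealNumbers c ℓ₁ ℓ₂) where
  open RealNumbers ℝ hiding (zero) renaming (Carrier to R; refl to ≈-refl; sym to ≈-sym; trans to ≈-trans) public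
  open CommutativeRing commutativeRing public using (_-_)
  open IsStrictTotalOrder isStrictTotalOrder public using (compare; _<?_; irrefl; asym; <-respʳ-≈; <-respˡ-≈)
    renaming (trans to <-trans; _≟_ to _≈?_)
  open IntegerRingSolver commutativeRing public
  open Algebra.Properties.Ring ring public using (-0#≈0#; -‿involutive; -‿distribˡ-*; -‿distribʳ-*)
  open Relation.Binary.Reasoning.Setoid setoid
  open Skew ℝ using (StrictlyInterlaces; Increasing)
  open SetoidPermutation setoid using (_↭_)
  open SetoidPermutationProperties setoid using (xs↭ys⇒|xs|≡|ys|; filter⁺)

  <-resp : ∀ {x x′ y y′} → x ≈ x′ → y ≈ y′ → x < y → x′ < y′
  <-resp x≈x′ y≈y′ = <-respʳ-≈ y≈y′ ∘ <-respˡ-≈ x≈x′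

  <-≤-trans : ∀ {x y z} → x < y → y ≤ z → x < z
  <-≤-trans x<y (inj₁ y<z) = <-trans x<y y<z
  <-≤-trans x<y (inj₂ y≈z) = <-respʳ-≈ y≈z x<y

  x<y⇒0<y-x : ∀ {x y} → x < y → 0# < y - x
  x<y⇒0<y-x {x} {y} x<y = <-respˡ-≈ (-‿inverseʳ x) (+-monoˡ-< (- x) x<y)

  x<0⇒0<-x : ∀ {x} → x < 0# → 0# < - x
  x<0⇒0<-x x<0 = <-respʳ-≈ (+-identityˡ _) (x<y⇒0<y-x x<0)

  -- Indexed by `Parity` so that the rule of signs is addition of parities.
  Sign : Parity → R → Set ℓ₂
  Sign 0ℙ x = 0# < x
  Sign 1ℙ x = 0# < - x

  sign-resp : ∀ p {x y} → x ≈ y → Sign p x → Sign p y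
  sign-resp 0ℙ x≈y = <-respʳ-≈ x≈y
  sign-resp 1ℙ x≈y = <-respʳ-≈ (-‿cong x≈y)

  sign-neg : ∀ p {x} → Sign p x → Sign (p ⁻¹) (- x)
  sign-neg 0ℙ = <-respʳ-≈ (≈-sym (-‿involutive _))
  sign-neg 1ℙ = id

  sign-* : ∀ p q {x y} → Sign p x → Sign q y → Sign (p Parity.+ q) (x * y)
  sign-* 0ℙ 0ℙ 0<x 0<y = *-pos 0<x 0<y
  sign-* 0ℙ 1ℙ 0<x 0<y = <-respʳ-≈ (≈-sym (-‿distribʳ-* _ _)) (*-pos 0<x 0<y)
  sign-* 1ℙ 0ℙ 0<x 0<y = <-respʳ-≈ (≈-sym (-‿distribˡ-* _ _)) (*-pos 0<x 0<y)
  sign-* 1ℙ 1ℙ {x} {y} 0<x 0<y = <-respʳ-≈ (solve 2 (λ x y → (:- x) :* (:- y) := x :* y) ≈-refl x y) (*-pos 0<x 0<y)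

  sign-nonzero : ∀ p {x} → Sign p x → ¬ x ≈ 0#
  sign-nonzero 0ℙ 0<x x≈0 = irrefl (≈-sym x≈0) 0<x
  sign-nonzero 1ℙ 0<x x≈0 = irrefl (≈-sym (≈-trans (-‿cong x≈0) -0#≈0#)) 0<x

  sign-unique : ∀ p q {x} → Sign p x → Sign q x → p ≡ q
  sign-unique 0ℙ 0ℙ _   _    = ≡.refl
  sign-unique 1ℙ 1ℙ _   _    = ≡.refl
  sign-unique 0ℙ 1ℙ {x} 0<x 0<-x = contradiction (<-respʳ-≈ (-‿inverseʳ x) (<-trans 0<x
    (<-resp (+-identityˡ x) (+-comm _ _) (+-monoˡ-< x 0<-x)))) (irrefl ≈-refl)
  sign-unique 1ℙ 0ℙ 0<-x 0<x = ≡.sym (sign-unique 0ℙ 1ℙ 0<x 0<-x)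

  sign-total : ∀ {x} → ¬ x ≈ 0# → ∃ λ p → Sign p x
  sign-total {x} x≉0 with compare 0# x
  ... | tri< 0<x _ _ = 0ℙ , 0<x
  ... | tri≈ _ 0≈x _ = contradiction (≈-sym 0≈x) x≉0
  ... | tri> _ _ x<0 = 1ℙ , x<0⇒0<-x x<0

  x+x≈0⇒x≈0 : ∀ {x} → x + x ≈ 0# → x ≈ 0#
  x+x≈0⇒x≈0 {x} x+x≈0 with compare 0# x
  ... | tri< 0<x _ _ = contradiction (<-resp (+-identityˡ x) x+x≈0 (+-monoˡ-< x 0<x)) (asym 0<x)
  ... | tri≈ _ 0≈x _ = ≈-sym 0≈x
  ... | tri> _ _ x<0 = contradiction (<-resp x+x≈0 (+-identityˡ x) (+-monoˡ-< x x<0)) (asym x<0)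

  -- Nonzero numbers have signs, and a product of numbers with signs has one too.
  x*y≈0⇒x≈0⊎y≈0 : ∀ {x y} → x * y ≈ 0# → x ≈ 0# ⊎ y ≈ 0#
  x*y≈0⇒x≈0⊎y≈0 {x} {y} xy≈0 with x ≈? 0# | y ≈? 0#
  ... | yes x≈0 | _       = inj₁ x≈0
  ... | no  _   | yes y≈0 = inj₂ y≈0
  ... | no  x≉0 | no  y≉0 =
    let p , sx = sign-total x≉0
        q , sy = sign-total y≉0
    in contradiction xy≈0 (sign-nonzero (p Parity.+ q) (sign-* p q sx sy))

  value : R → List R → R
  value t xs = foldr _*_ 1# (map (λ x → t - x) xs)

  above : R → List R → ℕ
  above t xs = length (filter (t <?_) xs)

  above-↭ : ∀ t {xs ys} → xs ↭ ys → above t xs ≡ above t ys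
  above-↭ t xs↭ys = xs↭ys⇒|xs|≡|ys| (filter⁺ (t <?_) <-respʳ-≈ xs↭ys)

  above-++ : ∀ t xs ys → above t (xs ++ ys) ≡ above t xs ℕ.+ above t ys
  above-++ t xs ys = ≡.trans (≡.cong length (List.filter-++ (t <?_) xs ys)) (List.length-++ (filter (t <?_) xs))

  above-≤-length : ∀ t xs → above t xs ℕ.≤ length xs
  above-≤-length t = List.length-filter (t <?_)

  above-accept : ∀ {t x} xs → t < x → above t (x ∷ xs) ≡ suc (above t xs)
  above-accept {t} xs t<x = ≡.cong length (List.filter-accept (t <?_) {xs = xs} t<x)

  above-reject : ∀ {t x} xs → ¬ t < x → above t (x ∷ xs) ≡ above t xs
  above-reject {t} xs t≮x = ≡.cong length (List.filter-reject (t <?_) {xs = xs} t≮x)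

  above-antitone : ∀ {s t} xs → s < t → above t xs ℕ.≤ above s xs
  above-antitone []       s<t = ℕ.z≤n
  above-antitone {s} {t} (x ∷ xs) s<t with t <? x
  ... | yes t<x = ℕ.≤-trans (ℕ.s≤s (above-antitone xs s<t)) (ℕ.≤-reflexive (≡.sym (above-accept xs (<-trans s<t t<x))))
  ... | no  _   with s <? x
  ...   | yes _ = ℕ.m≤n⇒m≤1+n (above-antitone xs s<t)
  ...   | no  _ = above-antitone xs s<t

  above-all : ∀ {t n} (α : Vector R n) → (∀ k → t < α k) → above t (tabulate α) ≡ n
  above-all {n = zero}  α t<α = ≡.refl
  above-all {n = suc n} α t<α = ≡.trans (above-accept _ (t<α zero)) (≡.cong suc (above-all (α ∘ suc) (t<α ∘ suc)))

  parity-suc : ∀ n → parity (suc n) ≡ parity n ⁻¹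
  parity-suc n = ≡.sym (Parity.⁻¹-selfInverse {parity (suc n)} (Parity.suc-homo-⁻¹ n))

  sign-value : ∀ t xs → All (λ x → ¬ t ≈ x) xs → Sign (parity (above t xs)) (value t xs)
  sign-value t []       []           = 0<1
  sign-value t (x ∷ xs) (t≉x ∷ t∉xs) = by-cases (compare t x)
    where
    transport : ∀ {n p} → above t (x ∷ xs) ≡ n → parity n ≡ p → Sign p (value t (x ∷ xs)) → Sign (parity (above t (x ∷ xs))) (value t (x ∷ xs))
    transport eq eq′ = ≡.subst (λ p → Sign p (value t (x ∷ xs))) (≡.sym (≡.trans (≡.cong parity eq) eq′))
    by-cases : Tri (t < x) (t ≈ x) (x < t) → Sign (parity (above t (x ∷ xs))) (value t (x ∷ xs))
    by-cases (tri< t<x _ _) = transport (above-accept xs t<x) (parity-suc (above t xs))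
      (sign-* 1ℙ (parity (above t xs)) (<-respʳ-≈ (solve 2 (λ t x → x :- t := :- (t :- x)) ≈-refl t x) (x<y⇒0<y-x t<x)) (sign-value t xs t∉xs))
    by-cases (tri≈ _ t≈x _) = contradiction t≈x t≉x
    by-cases (tri> t≮x _ x<t) = transport (above-reject xs t≮x) ≡.refl
      (sign-* 0ℙ (parity (above t xs)) (x<y⇒0<y-x x<t) (sign-value t xs t∉xs))

  Increasing< : ∀ {n} → Vector R n → Set ℓ₂
  Increasing< α = ∀ {k l} → k <ᶠ l → α k < α l

  increasing-adjacent : ∀ {n} (α : Vector R (suc n)) → (∀ k → α (inject₁ k) < α (suc k)) → Increasing< α
  increasing-adjacent {suc n} α adj {zero}  {suc zero}    k<l = adj zero
  increasing-adjacent {suc n} α adj {zero}  {suc (suc l)} k<l = <-trans (adj zero)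
    (increasing-adjacent (α ∘ suc) (adj ∘ suc) {zero} {suc l} ℕ.z<s)
  increasing-adjacent {suc n} α adj {suc k} {suc l} (ℕ.s≤s k<l) = increasing-adjacent (α ∘ suc) (adj ∘ suc) k<l

  -- All entries from index `k` on lie above `t`, and there are n - k of them; the additive form
  -- avoids truncated subtraction.
  above-≥ : ∀ {n t} (α : Vector R n) → Increasing α → ∀ k → t < α k → n ℕ.≤ above t (tabulate α) ℕ.+ toℕ k
  above-≥ {suc n} {t} α inc zero t<α = ℕ.≤-reflexive (≡.sym (≡.trans (ℕ.+-identityʳ _) (above-all α t<αₖ)))
    where
    t<αₖ : ∀ k → t < α k
    t<αₖ zero    = t<α
    t<αₖ (suc k) = <-≤-trans t<α (inc ℕ.z<s)
  above-≥ {suc n} {t} α inc (suc k) t<α = begin′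
    where
    tail-≤ : above t (tabulate (α ∘ suc)) ℕ.≤ above t (tabulate α)
    tail-≤ with t <? α zero
    ... | yes _ = ℕ.n≤1+n _
    ... | no  _ = ℕ.≤-refl
    begin′ : suc n ℕ.≤ above t (tabulate α) ℕ.+ suc (toℕ k)
    begin′ = ℕ.≤-trans (ℕ.s≤s (ℕ.≤-trans (above-≥ (α ∘ suc) (inc ∘ ℕ.s≤s) k t<α) (ℕ.+-monoˡ-≤ _ tail-≤)))
      (ℕ.≤-reflexive (≡.sym (ℕ.+-suc _ _)))

  -- None of the entries up to and including index `k` lies above `t`, whence the `suc`.
  above-≤ : ∀ {n t} (α : Vector R n) → Increasing α → ∀ k → ¬ t < α k → above t (tabulate α) ℕ.+ suc (toℕ k) ℕ.≤ n
  above-≤ {suc n} {t} α inc zero t≮α = ℕ.≤-trans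
    (ℕ.≤-reflexive (≡.trans (≡.cong (ℕ._+ 1) (above-reject _ t≮α)) (ℕ.+-comm _ 1)))
    (ℕ.s≤s (ℕ.≤-trans (above-≤-length t (tabulate (α ∘ suc))) (ℕ.≤-reflexive (List.length-tabulate (α ∘ suc)))))
  above-≤ {suc n} {t} α inc (suc k) t≮α = ℕ.≤-trans
    (ℕ.≤-reflexive (≡.trans (≡.cong (ℕ._+ suc (suc (toℕ k))) (above-reject _ (λ t<α₀ → t≮α (<-≤-trans t<α₀ (inc ℕ.z<s))))) (ℕ.+-suc _ _)))
    (ℕ.s≤s (above-≤ (α ∘ suc) (inc ∘ ℕ.s≤s) k t≮α))

  above-self : ∀ {n} (α : Vector R (suc n)) → Increasing< α → ∀ k → above (α k) (tabulate α) ℕ.+ toℕ k ≡ n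
  above-self α inc zero = ≡.trans (ℕ.+-identityʳ _) (≡.trans (above-reject _ (irrefl ≈-refl)) (above-all (α ∘ suc) (λ k → inc ℕ.z<s)))
  above-self {suc n} α inc (suc k) = ≡.trans
    (≡.cong (ℕ._+ suc (toℕ k)) (above-reject _ (asym (inc {zero} {suc k} ℕ.z<s))))
    (≡.trans (ℕ.+-suc _ _) (≡.cong suc (above-self (α ∘ suc) (inc ∘ ℕ.s≤s) k)))

  <⇒Increasing : ∀ {n} {α : Vector R n} → Increasing< α → Increasing α
  <⇒Increasing inc k<l = inj₁ (inc k<l)

  interlaced-increasing : ∀ {m} (α : Vector R (suc m)) (β : Vector R m) → StrictlyInterlaces β α → Increasing< α
  interlaced-increasing α β inter = increasing-adjacent α (λ k → <-trans (proj₁ (inter k)) (proj₂ (inter k)))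

  interlacing-increasing : ∀ {m} (α : Vector R (suc m)) (β : Vector R m) → StrictlyInterlaces β α → Increasing< β
  interlacing-increasing {suc m} α β inter = increasing-adjacent β (λ k → <-trans (proj₂ (inter (inject₁ k))) (proj₁ (inter (suc k))))

  -- `β k` separates the entries of α up to index k from those after it, so the two counting bounds
  -- meet. The surplus of one is the entry of α just above `β k` itself.
  interlace-above : ∀ {m} (α : Vector R (suc m)) (β : Vector R m) → StrictlyInterlaces β α → ∀ k →
                    above (β k) (tabulate α) ≡ suc (above (β k) (tabulate β))
  interlace-above {suc m} α β inter k = ℕ.+-cancelʳ-≡ (toℕ k) _ _ (≡.trans
      (ℕ.≤-antisym
        (ℕ.s≤s⁻¹ (ℕ.≤-trans (ℕ.≤-reflexive (≡.trans (≡.sym (ℕ.+-suc _ _)) (≡.cong (λ i → above (β k) (tabulate α) ℕ.+ suc i) (≡.sym (toℕ-inject₁ k)))))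
          (above-≤ α α-inc (inject₁ k) (asym (proj₁ (inter k))))))
        (ℕ.s≤s⁻¹ (ℕ.≤-trans (above-≥ α α-inc (suc k) (proj₂ (inter k))) (ℕ.≤-reflexive (ℕ.+-suc _ _)))))
      (≡.sym (≡.cong suc (above-self β β-inc k))))
    where
    α-inc : Increasing α
    α-inc = <⇒Increasing (interlaced-increasing α β inter)
    β-inc : Increasing< β
    β-inc = interlacing-increasing α β inter

  interlace-avoids : ∀ {m} (α : Vector R (suc m)) (β : Vector R m) → StrictlyInterlaces β α → ∀ k l → ¬ β k ≈ α l
  interlace-avoids α β inter k l β≈α with <ᶠ-cmp l (suc k)
  ... | tri≈ _ ≡.refl _ = irrefl β≈α (proj₂ (inter k))
  ... | tri> _ _ k<l    = irrefl β≈α (<-trans (proj₂ (inter k)) (interlaced-increasing α β inter k<l))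
  ... | tri< l<1+k _ _  with <ᶠ-cmp l (inject₁ k)
  ...   | tri≈ _ ≡.refl _ = irrefl (≈-sym β≈α) (proj₁ (inter k))
  ...   | tri< l<k _ _    = irrefl (≈-sym β≈α) (<-trans (interlaced-increasing α β inter l<k) (proj₁ (inter k)))
  ...   | tri> _ _ k<l    = contradiction (ℕ.s≤s⁻¹ l<1+k) (ℕ.<⇒≱ (≡.subst (ℕ._< toℕ l) (toℕ-inject₁ k) k<l))

  above-cong : ∀ {s t} xs → s ≈ t → above s xs ≡ above t xs
  above-cong {s} {t} xs s≈t = ≡.cong length (List.filter-≐ (s <?_) (t <?_) (<-respˡ-≈ s≈t , <-respˡ-≈ (≈-sym s≈t)) xs)

  -- The number of η's above γₖ is weakly decreasing in k, at most e, and by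
  -- parity changes at every step, so it decreases by exactly one.
  interlace-from-parity : ∀ {e} (γ : Vector R (suc e)) (η : Vector R e) → Increasing< γ → Increasing η →
    (∀ l k → ¬ γ l ≈ η k) →
    (∀ l → parity (above (γ l) (tabulate η)) ≡ parity (above (γ l) (tabulate γ))) →
    StrictlyInterlaces η γ
  interlace-from-parity {e} γ η γ-inc η-inc γ≉η same-parity k = γ<η , η<γ
    where
    A B : Fin (suc e) → ℕ
    A l = above (γ l) (tabulate η)
    B l = above (γ l) (tabulate γ)

    B-exact : ∀ l → B l ℕ.+ toℕ l ≡ e
    B-exact = above-self γ γ-inc

    B-suc : ∀ l → B (inject₁ l) ≡ suc (B (suc l))
    B-suc l = ℕ.+-cancelʳ-≡ (toℕ l) _ _ (≡.trans (≡.cong (B (inject₁ l) ℕ.+_) (≡.sym (toℕ-inject₁ l)))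
      (≡.trans (B-exact (inject₁ l)) (≡.trans (≡.sym (B-exact (suc l))) (ℕ.+-suc _ _))))

    A-mono : ∀ l → A (suc l) ℕ.≤ A (inject₁ l)
    A-mono l = above-antitone (tabulate η) (γ-inc (ℕ.s≤s (ℕ.≤-reflexive (toℕ-inject₁ l))))

    A≢1+B : ∀ l → A l ≢ suc (B l)
    A≢1+B l A≡1+B = Parity.p≢p⁻¹ _ (≡.trans (≡.sym (same-parity l)) (≡.trans (≡.cong parity A≡1+B) (parity-suc (B l))))

    B≢1+A : ∀ l → B l ≢ suc (A l)
    B≢1+A l B≡1+A = Parity.p≢p⁻¹ _ (≡.trans (same-parity l) (≡.trans (≡.cong parity B≡1+A) (parity-suc (A l))))

    A≤B : ∀ l → A l ℕ.≤ B l
    A≤B = <-weakInduction (λ l → A l ℕ.≤ B l)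
      (ℕ.≤-trans (above-≤-length _ (tabulate η)) (ℕ.≤-reflexive
        (≡.trans (List.length-tabulate η) (≡.sym (≡.trans (≡.sym (ℕ.+-identityʳ _)) (B-exact zero))))))
      -- `A` does not increase and `B` drops by one, so at the next index `A` exceeds `B` by at most
      -- one; an excess of exactly one has the wrong parity.
      (λ l A≤B → ℕ.s≤s⁻¹ (ℕ.≤∧≢⇒< (ℕ.≤-trans (A-mono l) (ℕ.≤-trans A≤B (ℕ.≤-reflexive (B-suc l)))) (A≢1+B (suc l))))

    B≤A : ∀ l → B l ℕ.≤ A l
    B≤A = >-weakInduction (λ l → B l ℕ.≤ A l)
      -- This induction runs downward from the last index, where no γ lies above and `B` is 0.
      (ℕ.≤-trans (ℕ.≤-reflexive (ℕ.+-cancelʳ-≡ e _ 0 (≡.trans (≡.cong (B (fromℕ e) ℕ.+_) (≡.sym (toℕ-fromℕ e))) (B-exact (fromℕ e))))) ℕ.z≤n)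
      (λ l B≤A → ℕ.≤-trans (ℕ.≤-reflexive (B-suc l)) (ℕ.≤∧≢⇒< (ℕ.≤-trans B≤A (A-mono l))
        (λ B≡A → B≢1+A (inject₁ l) (≡.trans (B-suc l) (≡.cong suc B≡A)))))

    A-exact : ∀ l → A l ℕ.+ toℕ l ≡ e
    A-exact l = ≡.trans (≡.cong (ℕ._+ toℕ l) (ℕ.≤-antisym (A≤B l) (B≤A l))) (B-exact l)

    γ<η : γ (inject₁ k) < η k
    γ<η with γ (inject₁ k) <? η k
    ... | yes γ<η = γ<η
    ... | no  γ≮η = contradiction (≡.trans (≡.cong (A (inject₁ k) ℕ.+_) (≡.sym (toℕ-inject₁ k))) (A-exact (inject₁ k)))
      (ℕ.<⇒≢ (ℕ.≤-trans (ℕ.≤-reflexive (≡.sym (ℕ.+-suc _ _))) (above-≤ η η-inc k γ≮η)))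

    η<γ : η k < γ (suc k)
    η<γ with compare (η k) (γ (suc k))
    ... | tri< η<γ _ _ = η<γ
    -- `above` counts strictly, so the count does not exclude equality on this side; the hypothesis
    -- that γ and η share no value does.
    ... | tri≈ _ η≈γ _ = contradiction (≈-sym η≈γ) (γ≉η (suc k) k)
    ... | tri> _ _ γ<η = contradiction (≡.trans (≡.sym (ℕ.+-suc _ _)) (A-exact (suc k)))
      (ℕ.<⇒≢ (ℕ.s≤s (above-≥ η η-inc k γ<η)) ∘ ≡.sym)

-- Polynomials with imaginary roots

module LinearFactors {c ℓ} (K : CommutativeRing c ℓ) where
  open CommutativeRing K hiding (zero) renaming (refl to ≈-refl; sym to ≈-sym; trans to ≈-trans)
  open PolynomialRing K
  open RingOps polyRing using (product)
  open SetoidPermutation setoid using (_↭_)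
  open SetoidPermutationProperties setoid using (map⁺)
  open CommutativeRing polynomialRing public using () renaming
    ( refl to ≈ᴾ-refl; sym to ≈ᴾ-sym; trans to ≈ᴾ-trans; setoid to ≈ᴾ-setoid; reflexive to ≈ᴾ-reflexive; 1# to 1ᴾ
    ; *-congˡ to *ᴾ-congˡ; *-assoc to *ᴾ-assoc; *-identityˡ to *ᴾ-identityˡ
    ; *-commutativeMonoid to *ᴾ-commutativeMonoid; *-isCommutativeMonoid to *ᴾ-isCommutativeMonoid )

  linear : Carrier → Poly
  linear a = addP X (List.map (-_) (const a))

  poly : List Carrier → Poly
  poly as = foldr mulP 1ᴾ (map linear as)

  product-linear : ∀ {m} (α : Vector Carrier m) → product (linear ∘ α) ≡ poly (tabulate α)
  product-linear {zero}  α = ≡.refl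
  product-linear {suc m} α = ≡.cong (mulP (linear (α zero))) (product-linear (α ∘ suc))

  poly-++ : ∀ as bs → poly (as ++ bs) ≈ᴾ mulP (poly as) (poly bs)
  poly-++ []       bs = ≈ᴾ-sym {mulP (poly []) (poly bs)} {poly bs} (*ᴾ-identityˡ (poly bs))
  poly-++ (a ∷ as) bs = ≈ᴾ-trans {poly (a ∷ as ++ bs)} {mulP (linear a) (mulP (poly as) (poly bs))} {mulP (poly (a ∷ as)) (poly bs)}
    (*ᴾ-congˡ {linear a} {poly (as ++ bs)} {mulP (poly as) (poly bs)} (poly-++ as bs))
    (≈ᴾ-sym {mulP (poly (a ∷ as)) (poly bs)} {mulP (linear a) (mulP (poly as) (poly bs))} (*ᴾ-assoc (linear a) (poly as) (poly bs)))

  product-poly : ∀ {d} (L : Vector (List Carrier) d) → product (poly ∘ L) ≈ᴾ poly (concat (tabulate L))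
  product-poly {zero}  L = ≈ᴾ-refl {1ᴾ}
  product-poly {suc d} L = ≈ᴾ-trans {product (poly ∘ L)} {mulP (poly (L zero)) (poly rest)} {poly (L zero ++ rest)}
    (*ᴾ-congˡ {poly (L zero)} {product (poly ∘ L ∘ suc)} {poly rest} (product-poly (L ∘ suc)))
    (≈ᴾ-sym {poly (L zero ++ rest)} {mulP (poly (L zero)) (poly rest)} (poly-++ (L zero) rest))
    where rest = concat (tabulate (L ∘ suc))

  poly-↭ : ∀ {as bs} → as ↭ bs → poly as ≈ᴾ poly bs
  poly-↭ as↭bs = SetoidPermutationProperties.foldr-commMonoid ≈ᴾ-setoid *ᴾ-isCommutativeMonoid (map⁺ ≈ᴾ-setoid linear-cong as↭bs)
    where
    linear-cong : ∀ {a b} → a ≈ b → linear a ≈ᴾ linear b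
    linear-cong a≈b zero    = +-congˡ (-‿cong a≈b)
    linear-cong a≈b (suc k) = ≈-refl

  poly-cancel : ∀ a as bs → poly (a ∷ as) ≈ᴾ poly (a ∷ bs) → poly as ≈ᴾ poly bs
  poly-cancel a as bs = linear-cancel (0# - a) (poly as) (poly bs)

  eval-linear : ∀ a x → eval (linear a) x ≈ x - a
  eval-linear a x = ≈-trans (eval-add X (List.map (-_) (const a)) x) (+-cong (eval-X x) (eval-const (- a) x))

  eval-poly-∷ : ∀ a as x → eval (poly (a ∷ as)) x ≈ (x - a) * eval (poly as) x
  eval-poly-∷ a as x = ≈-trans (eval-mul (linear a) (poly as) x) (*-congʳ (eval-linear a x))

  eval-sum : ∀ {d} (t : Vector Poly d) x → eval (RingOps.sum polyRing t) x ≈ RingOps.sum rawRing (λ j → eval (t j) x)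
  eval-sum {zero}  t x = ≈-refl
  eval-sum {suc d} t x = ≈-trans (eval-add (t zero) _ x) (+-congˡ (eval-sum (t ∘ suc) x))

-- An interface, so that the arguments about imaginary roots never see ℂ as pairs.
record ComplexNumbers {c ℓ₁ ℓ₂} (ℝ : RealNumbers c ℓ₁ ℓ₂) : Set (lsuc (c ⊔ ℓ₁)) where
  module ℝ = RealNumbers ℝ
  field
    ring : CommutativeRing c ℓ₁
  open CommutativeRing ring
  field
    real imag      : ℝ.Carrier → Carrier
    real-injective : ∀ {a b} → real a ≈ real b → a ℝ.≈ b
    real-cong      : ∀ {a b} → a ℝ.≈ b → real a ≈ real b
    real-0         : real ℝ.0# ≈ 0#
    real-1         : real ℝ.1# ≈ 1#
    real-*         : ∀ a b → real (a ℝ.* b) ≈ real a * real b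
    real-neg       : ∀ a → real (ℝ.- a) ≈ - real a
    real-+         : ∀ a b → real (a ℝ.+ b) ≈ real a + real b
    imag≈i*real    : ∀ a → imag a ≈ imag ℝ.1# * real a
    i*i≈-1         : imag ℝ.1# * imag ℝ.1# ≈ - 1#

module ComplexPairs {c ℓ₁ ℓ₂} (ℝ : RealNumbers c ℓ₁ ℓ₂) where
  open SignCounting ℝ
  open Skew ℝ using (real; imag)

  ℂ-ring : CommutativeRing c ℓ₁
  ℂ-ring = record
    { Carrier = R × R
    ; _≈_     = λ (a , b) (a′ , b′) → a ≈ a′ × b ≈ b′
    ; _+_     = λ (a , b) (a′ , b′) → a + a′ , b + b′
    ; _*_     = λ (a , b) (a′ , b′) → a * a′ + - (b * b′) , a * b′ + b * a′
    ; -_      = λ (a , b) → - a , - b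
    ; 0#      = 0# , 0#
    ; 1#      = 1# , 0#
    ; isCommutativeRing = record
      { isRing = record
        { +-isAbelianGroup = record
          { isGroup = record
            { isMonoid = record
              { isSemigroup = record
                { isMagma = record
                  { isEquivalence = record
                    { refl  = ≈-refl , ≈-refl
                    ; sym   = λ (p , q) → ≈-sym p , ≈-sym q
                    ; trans = λ (p , q) (p′ , q′) → ≈-trans p p′ , ≈-trans q q′
                    }
                  ; ∙-cong = λ (p , q) (p′ , q′) → +-cong p p′ , +-cong q q′
                  }
                ; assoc = λ _ _ _ → +-assoc _ _ _ , +-assoc _ _ _
                }
              ; identity = (λ _ → +-identityˡ _ , +-identityˡ _) , (λ _ → +-identityʳ _ , +-identityʳ _)
              }
            ; inverse = (λ _ → -‿inverseˡ _ , -‿inverseˡ _) , (λ _ → -‿inverseʳ _ , -‿inverseʳ _)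
            ; ⁻¹-cong = λ (p , q) → -‿cong p , -‿cong q
            }
          ; comm = λ _ _ → +-comm _ _ , +-comm _ _
          }
        ; *-cong = λ (p , q) (p′ , q′) → +-cong (*-cong p p′) (-‿cong (*-cong q q′)) , +-cong (*-cong p q′) (*-cong q p′)
        ; *-assoc = λ (a , b) (a′ , b′) (a″ , b″) →
              solve 6 (λ a b c d e f → (a :* c :+ :- (b :* d)) :* e :+ :- ((a :* d :+ b :* c) :* f)
                := a :* (c :* e :+ :- (d :* f)) :+ :- (b :* (c :* f :+ d :* e))) ≈-refl a b a′ b′ a″ b″
            , solve 6 (λ a b c d e f → (a :* c :+ :- (b :* d)) :* f :+ (a :* d :+ b :* c) :* e
                := a :* (c :* f :+ d :* e) :+ b :* (c :* e :+ :- (d :* f))) ≈-refl a b a′ b′ a″ b″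
        ; *-identity = (λ _ → ≈-trans (+-cong (*-identityˡ _) (≈-trans (-‿cong (zeroˡ _)) -0#≈0#)) (+-identityʳ _)
                             , ≈-trans (+-cong (*-identityˡ _) (zeroˡ _)) (+-identityʳ _))
                     , (λ _ → ≈-trans (+-cong (*-identityʳ _) (≈-trans (-‿cong (zeroʳ _)) -0#≈0#)) (+-identityʳ _)
                             , ≈-trans (+-cong (zeroʳ _) (*-identityʳ _)) (+-identityˡ _))
        ; distrib = (λ (a , b) (a′ , b′) (a″ , b″) →
              solve 6 (λ a b c d e f → a :* (c :+ e) :+ :- (b :* (d :+ f))
                := (a :* c :+ :- (b :* d)) :+ (a :* e :+ :- (b :* f))) ≈-refl a b a′ b′ a″ b″
            , solve 6 (λ a b c d e f → a :* (d :+ f) :+ b :* (c :+ e)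
                := (a :* d :+ b :* c) :+ (a :* f :+ b :* e)) ≈-refl a b a′ b′ a″ b″)
          , (λ (a , b) (a′ , b′) (a″ , b″) →
              solve 6 (λ a b c d e f → (c :+ e) :* a :+ :- ((d :+ f) :* b)
                := (c :* a :+ :- (d :* b)) :+ (e :* a :+ :- (f :* b))) ≈-refl a b a′ b′ a″ b″
            , solve 6 (λ a b c d e f → (c :+ e) :* b :+ (d :+ f) :* a
                := (c :* b :+ d :* a) :+ (e :* b :+ f :* a)) ≈-refl a b a′ b′ a″ b″)
        }
      ; *-comm = λ _ _ → +-cong (*-comm _ _) (-‿cong (*-comm _ _))
                       , ≈-trans (+-comm _ _) (+-cong (*-comm _ _) (*-comm _ _))
      }
    }

  complexNumbers : ComplexNumbers ℝ
  complexNumbers = record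
    { ring = ℂ-ring
    ; real = real
    ; imag = imag
    ; real-injective = proj₁
    ; real-cong = _, ≈-refl
    ; real-0 = ≈-refl , ≈-refl
    ; real-1 = ≈-refl , ≈-refl
    ; real-* = λ a b → ≈-sym (≈-trans (+-congˡ (≈-trans (-‿cong (zeroˡ _)) -0#≈0#)) (+-identityʳ _))
                     , ≈-sym (≈-trans (+-cong (zeroʳ _) (zeroˡ _)) (+-identityˡ _))
    ; real-neg = λ a → ≈-refl , ≈-sym -0#≈0#
    ; real-+ = λ a b → ≈-refl , ≈-sym (+-identityʳ 0#)
    ; imag≈i*real = λ a → ≈-sym (≈-trans (+-cong (zeroˡ _) (≈-trans (-‿cong (zeroʳ _)) -0#≈0#)) (+-identityʳ _))
                        , ≈-sym (≈-trans (+-cong (zeroˡ _) (*-identityˡ _)) (+-identityˡ _))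
    ; i*i≈-1 = ≈-trans (+-cong (zeroˡ _) (-‿cong (*-identityˡ _))) (+-identityˡ _)
             , ≈-trans (+-cong (zeroˡ _) (zeroʳ _)) (≈-trans (+-identityˡ _) (≈-sym -0#≈0#))
    }

module ImaginaryRoots {c ℓ₁ ℓ₂} (ℝ : RealNumbers c ℓ₁ ℓ₂) (ℂ : ComplexNumbers ℝ) where
  open SignCounting ℝ
  open ComplexNumbers ℂ using () renaming (ring to ℂ-ring)
  open ComplexNumbers ℂ using (real; imag; real-injective; real-cong; real-0; real-1; real-*; real-neg; real-+; imag≈i*real; i*i≈-1)
  open SetoidPermutation setoid using (_↭_; prep; ↭-refl; ↭-sym; ↭-trans; ↭-prep; ↭-swap)
  open SetoidPermutationProperties setoid using (map⁺)
  module C where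
    open CommutativeRing ℂ-ring public
    open IntegerRingSolver ℂ-ring public
    open Relation.Binary.Reasoning.Setoid (CommutativeRing.setoid ℂ-ring) public
  open PolynomialRing ℂ-ring
  open LinearFactors ℂ-ring

  i : C.Carrier
  i = imag 1#

  -- Multiplication by iⁿ. At an imaginary point, a polynomial with n imaginary roots takes the
  -- value iⁿ times a real number (`eval-rootPoly`), so equations between such values become real
  -- ones once the powers of i are matched.
  turn : ℕ → C.Carrier → C.Carrier
  turn zero    z = z
  turn (suc n) z = i C.* turn n z

  turn-cong : ∀ n {z w} → z C.≈ w → turn n z C.≈ turn n w
  turn-cong zero    z≈w = z≈w
  turn-cong (suc n) z≈w = C.*-congˡ (turn-cong n z≈w)

  turn-2 : ∀ n z → turn (suc (suc n)) z C.≈ C.- turn n z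
  turn-2 n z = C.begin
    i C.* (i C.* turn n z)     C.≈⟨ C.*-assoc _ _ _ ⟨
    (i C.* i) C.* turn n z     C.≈⟨ C.*-congʳ i*i≈-1 ⟩
    (C.- C.1#) C.* turn n z    C.≈⟨ C.solve 2 (λ o z → (C.:- o) C.:* z C.:= C.:- (o C.:* z)) C.refl C.1# (turn n z) ⟩
    C.- (C.1# C.* turn n z)    C.≈⟨ C.-‿cong (C.*-identityˡ _) ⟩
    C.- turn n z               C.∎

  turn-neg : ∀ n z → turn n (C.- z) C.≈ C.- turn n z
  turn-neg zero    z = C.refl
  turn-neg (suc n) z = C.trans (C.*-congˡ (turn-neg n z))
    (C.solve 2 (λ i z → i C.:* (C.:- z) C.:= C.:- (i C.:* z)) C.refl i (turn n z))

  -- i is invertible, because multiplying by it twice is negation.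
  turn-injective : ∀ n {z w} → turn n z C.≈ turn n w → z C.≈ w
  turn-injective zero    eq = eq
  turn-injective (suc n) {z} {w} eq = turn-injective n (C.begin
    turn n z                       C.≈⟨ C.solve 1 (λ z → C.:- (C.:- z) C.:= z) C.refl (turn n z) ⟨
    C.- (C.- turn n z)             C.≈⟨ C.-‿cong (turn-2 n z) ⟨
    C.- (i C.* turn (suc n) z)     C.≈⟨ C.-‿cong (C.*-congˡ eq) ⟩
    C.- (i C.* turn (suc n) w)     C.≈⟨ C.-‿cong (turn-2 n w) ⟩
    C.- (C.- turn n w)             C.≈⟨ C.solve 1 (λ z → C.:- (C.:- z) C.:= z) C.refl (turn n w) ⟩
    turn n w                       C.∎)

  turn-* : ∀ m n z w → turn m z C.* turn n w C.≈ turn (m ℕ.+ n) (z C.* w)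
  turn-* zero    zero    z w = C.refl
  turn-* zero    (suc n) z w = C.trans
    (C.solve 3 (λ i z w → z C.:* (i C.:* w) C.:= i C.:* (z C.:* w)) C.refl i z (turn n w))
    (C.*-congˡ (turn-* zero n z w))
  turn-* (suc m) n       z w = C.trans (C.*-assoc _ _ _) (C.*-congˡ (turn-* m n z w))

  turn-0 : ∀ n → turn n C.0# C.≈ C.0#
  turn-0 zero    = C.refl
  turn-0 (suc n) = C.trans (C.*-congˡ (turn-0 n)) (C.zeroʳ _)

  turn-real-* : ∀ m n a b → turn m (real a) C.* turn n (real b) C.≈ turn (m ℕ.+ n) (real (a * b))
  turn-real-* m n a b = C.trans (turn-* m n _ _) (turn-cong (m ℕ.+ n) (C.sym (real-* a b)))

  turn-real-0 : ∀ n {a} → a ≈ 0# → turn n (real a) C.≈ C.0#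
  turn-real-0 n a≈0 = C.trans (turn-cong n (C.trans (real-cong a≈0) real-0)) (turn-0 n)

  turn-real-injective : ∀ n {a b} → turn n (real a) C.≈ turn n (real b) → a ≈ b
  turn-real-injective n eq = real-injective (turn-injective n eq)

  imag-imag : ∀ a b → imag a C.- imag b C.≈ i C.* real (a - b)
  imag-imag a b = C.begin
    imag a C.- imag b                      C.≈⟨ C.+-cong (imag≈i*real a) (C.-‿cong (imag≈i*real b)) ⟩
    i C.* real a C.- i C.* real b          C.≈⟨ C.solve 3 (λ i x y → i C.:* x C.:- i C.:* y C.:= i C.:* (x C.:+ C.:- y)) C.refl i (real a) (real b) ⟩
    i C.* (real a C.- real b)              C.≈⟨ C.*-congˡ (C.+-congˡ (real-neg b)) ⟨
    i C.* (real a C.+ real (- b))          C.≈⟨ C.*-congˡ (real-+ a (- b)) ⟨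
    i C.* real (a - b)                     C.∎

  rootPoly : List R → Poly
  rootPoly xs = poly (map imag xs)

  eval-rootPoly : ∀ t xs → eval (rootPoly xs) (imag t) C.≈ turn (length xs) (real (value t xs))
  eval-rootPoly t []       = C.trans (eval-const C.1# (imag t)) (C.sym real-1)
  eval-rootPoly t (x ∷ xs) = C.begin
    eval (rootPoly (x ∷ xs)) (imag t)                                C.≈⟨ eval-poly-∷ (imag x) (map imag xs) (imag t) ⟩
    (imag t C.- imag x) C.* eval (rootPoly xs) (imag t)              C.≈⟨ C.*-cong (imag-imag t x) (eval-rootPoly t xs) ⟩
    turn 1 (real (t - x)) C.* turn (length xs) (real (value t xs))   C.≈⟨ turn-real-* 1 (length xs) _ _ ⟩
    turn (suc (length xs)) (real (value t (x ∷ xs)))                 C.∎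

  imag-cong : ∀ {a b} → a ≈ b → imag a C.≈ imag b
  imag-cong a≈b = C.trans (imag≈i*real _) (C.trans (C.*-congˡ (real-cong a≈b)) (C.sym (imag≈i*real _)))

  value-root : ∀ {t} xs → Any (t ≈_) xs → value t xs ≈ 0#
  value-root {t} (x ∷ xs) (here t≈x)  = ≈-trans (*-congʳ (≈-trans (+-congʳ t≈x) (-‿inverseʳ x))) (zeroˡ _)
  value-root (x ∷ xs) (there t∈xs) = ≈-trans (*-congˡ (value-root xs t∈xs)) (zeroʳ _)

  value-0⇒root : ∀ {t} xs → value t xs ≈ 0# → Any (t ≈_) xs
  value-0⇒root []       1≈0 = contradiction 1≈0 (sign-nonzero Parity.0ℙ 0<1)
  value-0⇒root {t} (x ∷ xs) eq with x*y≈0⇒x≈0⊎y≈0 eq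
  ... | inj₁ t-x≈0 = here (≈-trans (solve 2 (λ t x → t := (t :- x) :+ x) ≈-refl t x) (≈-trans (+-congʳ t-x≈0) (+-identityˡ x)))
  ... | inj₂ v≈0   = there (value-0⇒root xs v≈0)

  bring-to-front : ∀ {x} ys → Any (x ≈_) ys → ∃ λ ys′ → ys ↭ x ∷ ys′
  bring-to-front (y ∷ ys) (here x≈y)   = ys , prep (≈-sym x≈y) ↭-refl
  bring-to-front (y ∷ ys) (there x∈ys) = let ys′ , ys↭ = bring-to-front ys x∈ys in
    y ∷ ys′ , ↭-trans (↭-prep y ys↭) (↭-swap y _ ↭-refl)

  rootPoly-↭ : ∀ {xs ys} → xs ↭ ys → rootPoly xs ≈ᴾ rootPoly ys
  rootPoly-↭ xs↭ys = poly-↭ (map⁺ C.setoid imag-cong xs↭ys)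

  -- Evaluation at the imaginary point of `t` detects the root on both sides. A power of i in front
  -- does not affect vanishing, so the two lists may have different lengths here.
  root-transfer : ∀ {t} xs ys → rootPoly xs ≈ᴾ rootPoly ys → Any (t ≈_) xs → Any (t ≈_) ys
  root-transfer {t} xs ys eq t∈xs = value-0⇒root ys (turn-real-injective (length ys) (C.begin
    turn (length ys) (real (value t ys))   C.≈⟨ eval-rootPoly t ys ⟨
    eval (rootPoly ys) (imag t)            C.≈⟨ eval-cong (rootPoly xs) (rootPoly ys) (imag t) eq ⟨
    eval (rootPoly xs) (imag t)            C.≈⟨ eval-rootPoly t xs ⟩
    turn (length xs) (real (value t xs))   C.≈⟨ turn-real-0 (length xs) (value-root xs t∈xs) ⟩
    C.0#                                   C.≈⟨ turn-real-0 (length ys) ≈-refl ⟨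
    turn (length ys) (real 0#)             C.∎))

  rootPoly-cancel : ∀ x xs ys zs → ys ↭ x ∷ zs → rootPoly (x ∷ xs) ≈ᴾ rootPoly ys → rootPoly xs ≈ᴾ rootPoly zs
  rootPoly-cancel x xs ys zs ys↭ eq = poly-cancel (imag x) (map imag xs) (map imag zs)
    (≈ᴾ-trans {rootPoly (x ∷ xs)} {rootPoly ys} {rootPoly (x ∷ zs)} eq (rootPoly-↭ {ys} {x ∷ zs} ys↭))

  rootPoly-nonconstant : ∀ y ys → ¬ rootPoly [] ≈ᴾ rootPoly (y ∷ ys)
  rootPoly-nonconstant y ys eq = contradiction
    (root-transfer {y} (y ∷ ys) [] (≈ᴾ-sym {rootPoly []} {rootPoly (y ∷ ys)} eq) (here ≈-refl)) λ ()

  -- Unique factorisation for imaginary roots: each root on the left occurs on the right by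
  -- evaluation, is brought to the front there, and its linear factor is cancelled.
  rootPoly-injective : ∀ xs ys → rootPoly xs ≈ᴾ rootPoly ys → xs ↭ ys
  rootPoly-injective []       []       eq = ↭-refl
  rootPoly-injective []       (y ∷ ys) eq = contradiction eq (rootPoly-nonconstant y ys)
  rootPoly-injective (x ∷ xs) ys       eq = step (bring-to-front ys (root-transfer {x} (x ∷ xs) ys eq (here ≈-refl)))
    where
    step : (∃ λ zs → ys ↭ x ∷ zs) → x ∷ xs ↭ ys
    step (zs , ys↭) = ↭-trans (↭-prep x (rootPoly-injective xs zs (rootPoly-cancel x xs ys zs ys↭ eq))) (↭-sym ys↭)

  -- The polynomial of `Skew.withRoots` over an arbitrary `ComplexNumbers`; for pairs of reals the
  -- two coincide by definition.
  withRoots : ∀ {m} → Vector R m → Poly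
  withRoots α = RingOps.product polyRing λ k → addP X (List.map (C.-_) (const (imag (α k))))

  withRoots≡rootPoly : ∀ {m} (α : Vector R m) → withRoots α ≡ rootPoly (tabulate α)
  withRoots≡rootPoly α = ≡.trans (product-linear (imag ∘ α)) (≡.cong poly (≡.sym (List.map-tabulate α imag)))

  product-rootPoly : ∀ {d} (L : Vector (List R) d) → RingOps.product polyRing (rootPoly ∘ L) ≈ᴾ rootPoly (concat (tabulate L))
  product-rootPoly L = ≈ᴾ-trans {RingOps.product polyRing (rootPoly ∘ L)} {poly (concat (tabulate (map imag ∘ L)))} {rootPoly (concat (tabulate L))}
    (product-poly (map imag ∘ L)) (≈ᴾ-reflexive (≡.cong poly
      (≡.trans (≡.cong concat (≡.sym (List.map-tabulate L (map imag)))) (List.concat-map (tabulate L)))))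

-- Root multisets symmetric about zero

module SymmetricRoots {c ℓ₁ ℓ₂} (ℝ : RealNumbers c ℓ₁ ℓ₂) where
  open SignCounting ℝ
  open Skew ℝ using (Antisymmetric)
  open RingOps rawRing using (product)
  open Algebra.Properties.CommutativeMonoid.Sum *-commutativeMonoid using ()
    renaming (sum-permute to product-permute; sum-cong-≋ to product-cong)

  flip : ℕ → R → R
  flip zero    x = x
  flip (suc n) x = - flip n x

  flip-cong : ∀ n {x y} → x ≈ y → flip n x ≈ flip n y
  flip-cong zero    x≈y = x≈y
  flip-cong (suc n) x≈y = -‿cong (flip-cong n x≈y)

  flip-injective : ∀ n {x y} → flip n x ≈ flip n y → x ≈ y
  flip-injective zero    eq = eq
  flip-injective (suc n) eq = flip-injective n (≈-trans (≈-sym (-‿involutive _)) (≈-trans (-‿cong eq) (-‿involutive _)))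

  flip-* : ∀ n x y → flip n (x * y) ≈ x * flip n y
  flip-* zero    x y = ≈-refl
  flip-* (suc n) x y = ≈-trans (-‿cong (flip-* n x y)) (-‿distribʳ-* x _)

  flip-+ : ∀ m n x y → flip m x * flip n y ≈ flip (m ℕ.+ n) (x * y)
  flip-+ zero    n x y = ≈-sym (flip-* n x y)
  flip-+ (suc m) n x y = ≈-trans (≈-sym (-‿distribˡ-* _ _)) (-‿cong (flip-+ m n x y))

  -- Equivalently, xs is symmetric about 0 as a multiset.
  Symmetric : List R → Set _
  Symmetric xs = ∀ t → value (- t) xs ≈ flip (length xs) (value t xs)

  value-++ : ∀ t xs ys → value t (xs ++ ys) ≈ value t xs * value t ys
  value-++ t []       ys = ≈-sym (*-identityˡ _)
  value-++ t (x ∷ xs) ys = ≈-trans (*-congˡ (value-++ t xs ys)) (≈-sym (*-assoc _ _ _))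

  symmetric-++ : ∀ xs ys → Symmetric xs → Symmetric ys → Symmetric (xs ++ ys)
  symmetric-++ xs ys sym-xs sym-ys t = begin
    value (- t) (xs ++ ys)                                           ≈⟨ value-++ (- t) xs ys ⟩
    value (- t) xs * value (- t) ys                                  ≈⟨ *-cong (sym-xs t) (sym-ys t) ⟩
    flip (length xs) (value t xs) * flip (length ys) (value t ys)    ≈⟨ flip-+ (length xs) (length ys) _ _ ⟩
    flip (length xs ℕ.+ length ys) (value t xs * value t ys)         ≡⟨ ≡.cong (λ n → flip n (value t xs * value t ys)) (List.length-++ xs) ⟨
    flip (length (xs ++ ys)) (value t xs * value t ys)               ≈⟨ flip-cong (length (xs ++ ys)) (value-++ t xs ys) ⟨
    flip (length (xs ++ ys)) (value t (xs ++ ys))                    ∎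
    where open Relation.Binary.Reasoning.Setoid setoid

  symmetric-concat : ∀ {d} (L : Vector (List R) d) → (∀ j → Symmetric (L j)) → Symmetric (concat (tabulate L))
  symmetric-concat {zero}  L sym-L = λ t → ≈-refl
  symmetric-concat {suc d} L sym-L = symmetric-++ (L zero) _ (sym-L zero) (symmetric-concat (L ∘ suc) (sym-L ∘ suc))

  value-tabulate : ∀ {n} t (α : Vector R n) → value t (tabulate α) ≈ product (λ k → t - α k)
  value-tabulate {zero}  t α = ≈-refl
  value-tabulate {suc n} t α = *-congˡ (value-tabulate t (α ∘ suc))

  flip-product : ∀ {n} (t : Vector R n) → product (λ k → - t k) ≈ flip n (product t)
  flip-product {zero}  t = ≈-refl
  flip-product {suc n} t = ≈-trans (*-congˡ (flip-product (t ∘ suc)))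
    (≈-trans (≈-sym (-‿distribˡ-* _ _)) (-‿cong (≈-sym (flip-* n _ _))))

  -- Each factor -t - αₖ is the negative of t minus the opposite root, and reversing the indices
  -- only permutes the product.
  antisymmetric⇒symmetric : ∀ {n} (α : Vector R n) → Antisymmetric α → Symmetric (tabulate α)
  antisymmetric⇒symmetric {n} α anti t = begin
    value (- t) (tabulate α)                     ≈⟨ value-tabulate (- t) α ⟩
    product (λ k → - t - α k)                    ≈⟨ product-cong (λ k → ≈-trans (+-congˡ (-‿cong (anti k)))
                                                      (solve 2 (λ t a → :- t :- (:- a) := :- (t :- a)) ≈-refl t _)) ⟩
    product (λ k → - (t - α (opposite k)))       ≈⟨ flip-product (λ k → t - α (opposite k)) ⟩
    flip n (product (λ k → t - α (opposite k)))  ≈⟨ flip-cong n (product-permute (λ k → t - α k) FinPermutation.reverse) ⟨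
    flip n (product (λ k → t - α k))             ≈⟨ flip-cong n (value-tabulate t α) ⟨
    flip n (value t (tabulate α))                ≡⟨ ≡.cong (λ m → flip m (value t (tabulate α))) (List.length-tabulate α) ⟨
    flip (length (tabulate α)) (value t (tabulate α)) ∎
    where open Relation.Binary.Reasoning.Setoid setoid

-- Consequences of the partial fraction decomposition at the roots of the components

module PartialFractions {c ℓ₁ ℓ₂} (ℝ : RealNumbers c ℓ₁ ℓ₂) (ℂ : ComplexNumbers ℝ) where
  open SignCounting ℝ
  open ImaginaryRoots ℝ ℂ
  open SymmetricRoots ℝ
  open ComplexNumbers ℂ using (real; imag; real-*; real-neg) renaming (ring to ℂ-ring)
  open Skew ℝ using (StrictlyInterlaces; Increasing; Antisymmetric)
  open PolynomialRing ℂ-ring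
  open LinearFactors ℂ-ring
  open RingOps polyRing using (sum; product)
  open SetoidPermutation setoid using (_↭_; ↭-refl; ↭-sym; ↭-trans)
  open SetoidPermutationProperties setoid using (++⁺ˡ; shifts; xs↭ys⇒|xs|≡|ys|; Any-resp-↭; AllPairs-resp-↭)
  module CSum where
    open RingOps C.rawRing public using (sum)
    open Algebra.Properties.CommutativeMonoid.Sum C.+-commutativeMonoid public using (sum-remove; sum-cong-≋; sum-replicate-zero)
  open Algebra.Properties.CommutativeMonoid.Sum *ᴾ-commutativeMonoid using () renaming (sum-cong-≋ to product-cong)

  allButOne : ∀ {d} → Vector (List R) (suc d) → Fin (suc d) → List R
  allButOne L j = concat (tabulate (removeAt L j))

  concat-remove : ∀ {d} (L : Vector (List R) (suc d)) j → concat (tabulate L) ↭ L j ++ allButOne L j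
  concat-remove         L zero    = ↭-refl
  concat-remove {suc d} L (suc j) = ↭-trans (++⁺ˡ (L zero) (concat-remove (L ∘ suc) j)) (shifts (L zero) (L (suc j)))

  ∈-allButOne : ∀ {d p} {P : R → Set p} (L : Vector (List R) (suc d)) {i j} → i ≢ j → Any P (L j) → Any P (allButOne L i)
  ∈-allButOne {P = P} L {i} {j} i≢j p = Any.concat⁺ (Any.tabulate⁺ (punchOut i≢j)
    (≡.subst (λ k → Any P (L k)) (≡.sym (punchIn-punchOut i≢j)) p))

  sum-single : ∀ {d} (t : Vector C.Carrier (suc d)) j → (∀ {i} → i ≢ j → t i C.≈ C.0#) → CSum.sum t C.≈ t j
  sum-single {d} t j t≈0 = C.trans (CSum.sum-remove {i = j} t) (C.trans
    (C.+-congˡ (C.trans (CSum.sum-cong-≋ (λ k → t≈0 (punchInᵢ≢i j k))) (CSum.sum-replicate-zero d))) (C.+-identityʳ _))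

  eval-withRoots : ∀ {n} (α : Vector R n) t → eval (withRoots α) (imag t) C.≈ turn (length (tabulate α)) (real (value t (tabulate α)))
  eval-withRoots α t = C.trans (C.reflexive (≡.cong (λ p → eval p (imag t)) (withRoots≡rootPoly α))) (eval-rootPoly t (tabulate α))

  product-withRoots : ∀ {d} {e : Fin d → ℕ} (γ : ∀ j → Vector R (e j)) →
    product (λ j → withRoots (γ j)) ≈ᴾ rootPoly (concat (tabulate (λ j → tabulate (γ j))))
  product-withRoots γ = ≈ᴾ-trans
    {product (λ j → withRoots (γ j))} {product (λ j → rootPoly (tabulate (γ j)))} {rootPoly (concat (tabulate (λ j → tabulate (γ j))))}
    (product-cong (λ j → ≈ᴾ-reflexive (withRoots≡rootPoly (γ j)))) (product-rootPoly (λ j → tabulate (γ j)))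

  module _ {d m} {e : Fin (suc d) → ℕ} (λs : Vector R (suc m)) (μs : Vector R m)
    (gRoots : ∀ j → Vector R (suc (e j))) (hRoots : ∀ j → Vector R (e j)) (y : Vector R (suc d))
    (factorization : withRoots μs ≈ᴾ product λ j → withRoots (gRoots j))
    (partialFractions : withRoots λs ≈ᴾ addP (mulP X (withRoots μs)) (sum λ j →
        mulP (const (real (y j))) (mulP (withRoots (hRoots j)) (product (removeAt (λ i → withRoots (gRoots i)) j)))))
    where

    private
      Λ Μ : List R
      Λ = tabulate λs
      Μ = tabulate μs

      G H : Vector (List R) (suc d)
      G j = tabulate (gRoots j)
      H j = tabulate (hRoots j)

      O : Fin (suc d) → List R
      O = allButOne G

      n : Fin (suc d) → ℕ
      n j = length (H j) ℕ.+ length (O j)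

      term : Fin (suc d) → Poly
      term j = mulP (const (real (y j))) (mulP (withRoots (hRoots j)) (product (removeAt (λ i → withRoots (gRoots i)) j)))

    -- Unique factorisation turns the polynomial identity into one of multisets. It carries over to
    -- the roots of the `gⱼ` what interlacing says about the μ's, and it counts the vertices of the
    -- components.
    roots-↭ : Μ ↭ concat (tabulate G)
    roots-↭ = rootPoly-injective Μ (concat (tabulate G))
      (≈ᴾ-trans {rootPoly Μ} {withRoots μs} {rootPoly (concat (tabulate G))}
        (≈ᴾ-reflexive (≡.sym (withRoots≡rootPoly μs)))
        (≈ᴾ-trans {withRoots μs} {product (λ j → withRoots (gRoots j))} {rootPoly (concat (tabulate G))}
          factorization (product-withRoots gRoots)))

    split : ∀ j → Μ ↭ G j ++ O j
    split j = ↭-trans roots-↭ (concat-remove G j)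

    -- f has one root more than g, and `gⱼ` one more than `hⱼ`. The excess of two is the factor i² =
    -- -1 that gives `residue` its minus sign.
    length-Λ : ∀ j → length Λ ≡ suc (suc (n j))
    length-Λ j = ≡.trans (List.length-tabulate λs) (≡.cong suc (≡.trans (≡.sym (List.length-tabulate μs))
      (≡.trans (xs↭ys⇒|xs|≡|ys| (split j)) (≡.trans (List.length-++ (G j))
        (≡.cong (ℕ._+ length (O j)) (≡.trans (List.length-tabulate (gRoots j)) (≡.cong suc (≡.sym (List.length-tabulate (hRoots j))))))))))

    private
      eval-others : ∀ j t → eval (product (removeAt (λ i → withRoots (gRoots i)) j)) (imag t) C.≈ turn (length (O j)) (real (value t (O j)))
      eval-others j t = C.trans
        (eval-cong (product (removeAt (λ i → withRoots (gRoots i)) j)) (rootPoly (O j)) (imag t) (product-withRoots (λ k → gRoots (punchIn j k))))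
        (eval-rootPoly t (O j))

      eval-term : ∀ j t → eval (term j) (imag t) C.≈ turn (n j) (real (y j * (value t (H j) * value t (O j))))
      eval-term j t = C.begin
        eval (term j) (imag t)
          C.≈⟨ C.trans (eval-mul (const (real (y j))) (mulP (withRoots (hRoots j)) (product (removeAt (λ i → withRoots (gRoots i)) j))) (imag t))
                 (C.*-cong (eval-const (real (y j)) (imag t))
                 (C.trans (eval-mul (withRoots (hRoots j)) (product (removeAt (λ i → withRoots (gRoots i)) j)) (imag t))
                   (C.*-cong (eval-withRoots (hRoots j) t) (eval-others j t)))) ⟩
        real (y j) C.* (turn (length (H j)) (real (value t (H j))) C.* turn (length (O j)) (real (value t (O j))))
          C.≈⟨ C.*-congˡ (turn-real-* (length (H j)) (length (O j)) _ _) ⟩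
        real (y j) C.* turn (n j) (real (value t (H j) * value t (O j)))
          C.≈⟨ turn-real-* 0 (n j) _ _ ⟩
        turn (n j) (real (y j * (value t (H j) * value t (O j)))) C.∎

    ∈-μs : ∀ {β} j → Any (β ≈_) (G j) → Any (β ≈_) Μ
    ∈-μs j β∈ = Any-resp-↭ (λ x≈y β≈x → ≈-trans β≈x x≈y) (↭-sym (split j)) (Any.++⁺ˡ β∈)

    -- Evaluate f = x g + ∑ᵢ yᵢ hᵢ ∏ₖ gₖ at iβ, a root of gⱼ: only the j-th
    -- term survives, and the powers of i on the two sides differ by i² = −1.
    residue : ∀ {β} j → Any (β ≈_) (G j) → - value β Λ ≈ y j * (value β (H j) * value β (O j))
    residue {β} j β∈ = turn-real-injective (n j) (C.begin
      turn (n j) (real (- value β Λ))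
        C.≈⟨ C.trans (turn-cong (n j) (real-neg _)) (turn-neg (n j) _) ⟩
      C.- turn (n j) (real (value β Λ))
        C.≈⟨ turn-2 (n j) _ ⟨
      turn (suc (suc (n j))) (real (value β Λ))
        C.≡⟨ ≡.cong (λ k → turn k (real (value β Λ))) (length-Λ j) ⟨
      turn (length Λ) (real (value β Λ))
        C.≈⟨ eval-withRoots λs β ⟨
      eval (withRoots λs) (imag β)
        C.≈⟨ eval-cong (withRoots λs) (addP (mulP X (withRoots μs)) (sum term)) (imag β) partialFractions ⟩
      eval (addP (mulP X (withRoots μs)) (sum term)) (imag β)
        C.≈⟨ eval-add (mulP X (withRoots μs)) (sum term) (imag β) ⟩
      eval (mulP X (withRoots μs)) (imag β) C.+ eval (sum term) (imag β)
        C.≈⟨ C.+-cong x-term (C.trans (eval-sum term (imag β)) (sum-single (λ i → eval (term i) (imag β)) j other-terms)) ⟩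
      C.0# C.+ eval (term j) (imag β)
        C.≈⟨ C.+-identityˡ _ ⟩
      eval (term j) (imag β)
        C.≈⟨ eval-term j β ⟩
      turn (n j) (real (y j * (value β (H j) * value β (O j)))) C.∎)
      where
      x-term : eval (mulP X (withRoots μs)) (imag β) C.≈ C.0#
      x-term = C.trans (eval-mul X (withRoots μs) (imag β)) (C.trans
        (C.*-congˡ (C.trans (eval-withRoots μs β) (turn-real-0 (length Μ) (value-root Μ (∈-μs j β∈))))) (C.zeroʳ _))
      other-terms : ∀ {i} → i ≢ j → eval (term i) (imag β) C.≈ C.0#
      other-terms {i} i≢j = C.trans (eval-term i β) (turn-real-0 (n i)
        (≈-trans (*-congˡ (≈-trans (*-congˡ (value-root (O i) (∈-allButOne G i≢j β∈))) (zeroʳ _))) (zeroʳ _)))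

    module _ (interlaces : StrictlyInterlaces μs λs) (gRoots-increasing : ∀ j → Increasing (gRoots j))
      (hRoots-increasing : ∀ j → Increasing (hRoots j)) (√y : Vector R (suc d)) (√y²≈y : ∀ j → √y j * √y j ≈ y j)
      where

      λ-free : ∀ {β} j → Any (β ≈_) (G j) → ¬ Any (β ≈_) Λ
      λ-free j β∈ β∈Λ =
        let k , β≈μ = Any.tabulate⁻ (∈-μs j β∈)
            l , β≈λ = Any.tabulate⁻ {f = λs} β∈Λ
        in interlace-avoids λs μs interlaces k l (≈-trans (≈-sym β≈μ) β≈λ)

      above-Λ : ∀ {β} j → Any (β ≈_) (G j) → above β Λ ≡ suc (above β (G j) ℕ.+ above β (O j))
      above-Λ {β} j β∈ =
        let k , β≈μ = Any.tabulate⁻ (∈-μs j β∈) in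
        ≡.trans (above-cong Λ β≈μ) (≡.trans (interlace-above λs μs interlaces k) (≡.cong suc
          (≡.trans (≡.sym (above-cong Μ β≈μ)) (≡.trans (above-↭ β (split j)) (above-++ β (G j) (O j))))))

      -- A root of `gⱼ` is one of the μ's, hence none of the λ's, so the left side of `residue` is
      -- nonzero. Each factor on the right is then nonzero, which `h-free`, `others-free` and `y≉0`
      -- read off.
      residue≉0 : ∀ {β} j → Any (β ≈_) (G j) → ¬ y j * (value β (H j) * value β (O j)) ≈ 0#
      residue≉0 {β} j β∈ eq = λ-free j β∈ (value-0⇒root Λ (≈-trans (≈-sym (-‿involutive _))
        (≈-trans (-‿cong (≈-trans (residue j β∈) eq)) -0#≈0#)))

      h-free : ∀ {β} j → Any (β ≈_) (G j) → ¬ Any (β ≈_) (H j)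
      h-free j β∈ β∈H = residue≉0 j β∈ (≈-trans (*-congˡ (≈-trans (*-congʳ (value-root (H j) β∈H)) (zeroˡ _))) (zeroʳ _))

      others-free : ∀ {β} j → Any (β ≈_) (G j) → ¬ Any (β ≈_) (O j)
      others-free j β∈ β∈O = residue≉0 j β∈ (≈-trans (*-congˡ (≈-trans (*-congˡ (value-root (O j) β∈O)) (zeroʳ _))) (zeroʳ _))

      y≉0 : ∀ j → ¬ y j ≈ 0#
      y≉0 j y≈0 = residue≉0 {gRoots j zero} j (here ≈-refl) (≈-trans (*-congʳ y≈0) (zeroˡ _))

      -- A nonzero square is positive: whatever sign p the square root has, p + p is even.
      y>0 : ∀ j → 0# < y j
      y>0 j =
        let p , s = sign-total {√y j} (λ √y≈0 → y≉0 j (≈-trans (≈-sym (√y²≈y j)) (≈-trans (*-congʳ √y≈0) (zeroˡ _)))) in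
        sign-resp 0ℙ (√y²≈y j) (≡.subst (λ q → Sign q (√y j * √y j)) (Parity.p+p≡0ℙ p) (sign-* p p s s))

      -- Signs are compared on the two sides of `residue`. The minus sign on the left is absorbed by
      -- the extra λ above β from `above-Λ`, the positive `yⱼ` contributes nothing, and the roots of
      -- the other `gᵢ` count equally on both sides and cancel.
      same-parity : ∀ {β} j → Any (β ≈_) (G j) → parity (above β (H j)) ≡ parity (above β (G j))
      same-parity {β} j β∈ = Parity.+-cancelʳ-≡ (parity (above β (O j))) _ _ (begin
        parity (above β (H j)) Parity.+ parity (above β (O j))
          ≡⟨ sign-unique (parity (above β (H j)) Parity.+ parity (above β (O j))) (parity (above β Λ) ⁻¹)
               (sign-* 0ℙ (parity (above β (H j)) Parity.+ parity (above β (O j))) (y>0 j) (sign-* (parity (above β (H j))) (parity (above β (O j)))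
                 (sign-value β (H j) (All.¬Any⇒All¬ _ (h-free j β∈))) (sign-value β (O j) (All.¬Any⇒All¬ _ (others-free j β∈)))))
               (sign-resp (parity (above β Λ) ⁻¹) (residue j β∈) (sign-neg (parity (above β Λ)) (sign-value β Λ (All.¬Any⇒All¬ _ (λ-free j β∈))))) ⟩
        parity (above β Λ) ⁻¹
          ≡⟨ ≡.cong (λ k → parity k ⁻¹) (above-Λ j β∈) ⟩
        parity (suc (above β (G j) ℕ.+ above β (O j))) ⁻¹
          ≡⟨ Parity.suc-homo-⁻¹ (above β (G j) ℕ.+ above β (O j)) ⟩
        parity (above β (G j) ℕ.+ above β (O j))
          ≡⟨ Parity.+-homo-+ (above β (G j)) (above β (O j)) ⟩
        parity (above β (G j)) Parity.+ parity (above β (O j)) ∎)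
        where open ≡.≡-Reasoning

      Distinct : List R → Set _
      Distinct = AllPairs (λ x z → ¬ x ≈ z)

      μs-distinct : Distinct Μ
      μs-distinct = AllPairs.tabulate⁺-< λ k<l μ≈μ → irrefl μ≈μ (interlacing-increasing λs μs interlaces k<l)

      tabulate-distinct : ∀ {k} (α : Vector R k) ys → Distinct (tabulate α ++ ys) → ∀ {i l} → i <ᶠ l → ¬ α i ≈ α l
      tabulate-distinct α ys (α₀≉ ∷ _) {zero}  {suc l} _           = All.tabulate⁻ (All.++⁻ˡ (tabulate (α ∘ suc)) α₀≉) l
      tabulate-distinct α ys (_ ∷ d)   {suc i} {suc l} (ℕ.s≤s i<l) = tabulate-distinct (α ∘ suc) ys d i<l

      -- The roots of `gⱼ` are given as weakly increasing, but they form part of the multiset of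
      -- μ's, which are distinct by interlacing.
      gRoots-strict : ∀ j → Increasing< (gRoots j)
      gRoots-strict j {k} {l} k<l = case-≤ (gRoots-increasing j k<l)
        where
        distinct : ¬ gRoots j k ≈ gRoots j l
        distinct = tabulate-distinct (gRoots j) (O j) (AllPairs-resp-↭ (λ x≉z z≈x → x≉z (≈-sym z≈x))
          ((λ y≈z x≉y x≈z → x≉y (≈-trans x≈z (≈-sym y≈z))) , (λ y≈z y≉x z≈x → y≉x (≈-trans y≈z z≈x))) (split j) μs-distinct) k<l
        case-≤ : gRoots j k ≤ gRoots j l → gRoots j k < gRoots j l
        case-≤ (inj₁ γ<γ) = γ<γ
        case-≤ (inj₂ γ≈γ) = contradiction γ≈γ distinct

      children-interlace : ∀ j → StrictlyInterlaces (hRoots j) (gRoots j)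
      children-interlace j = interlace-from-parity (gRoots j) (hRoots j) (gRoots-strict j) (hRoots-increasing j)
        (λ l k γ≈η → h-free j (Any.tabulate⁺ {f = gRoots j} l ≈-refl) (Any.tabulate⁺ k γ≈η))
        (λ l → same-parity j (Any.tabulate⁺ {f = gRoots j} l ≈-refl))

      -- With gⱼ of degree 2 and hⱼ = x − iη, compare the residues at the
      -- opposite roots ±iβ of gⱼ, using that f and ∏ₖ≠ⱼ gₖ are even or odd.
      child-root-0 : Antisymmetric λs → (∀ i → Antisymmetric (gRoots i)) → ∀ j → e j ≡ 1 → ∀ k → hRoots j k ≈ 0#
      child-root-0 λs-anti gRoots-anti j e≡1 k = x+x≈0⇒x≈0 (solution (x*y≈0⇒x≈0⊎y≈0 equation))
        where
        open Relation.Binary.Reasoning.Setoid setoid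
        β η v : R
        β = gRoots j zero
        η = hRoots j k
        v = value β (O j)
        q : ℕ
        q = length (O j)

        β∈ : Any (β ≈_) (G j)
        β∈ = here ≈-refl

        -β∈ : Any (- β ≈_) (G j)
        -β∈ = Any.tabulate⁺ {f = gRoots j} (opposite zero) (≈-trans (-‿cong (gRoots-anti j zero)) (-‿involutive _))

        value-H : ∀ {n} (h : Vector R n) → n ≡ 1 → ∀ k t → value t (tabulate h) ≈ t - h k
        value-H h ≡.refl zero t = *-identityʳ _

        length-H : length (H j) ≡ 1
        length-H = ≡.trans (List.length-tabulate (hRoots j)) e≡1

        at-β : - value β Λ ≈ y j * ((β - η) * v)
        at-β = ≈-trans (residue j β∈) (*-congˡ (*-congʳ (value-H (hRoots j) e≡1 k β)))

        at--β : value β Λ ≈ y j * ((- β - η) * v)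
        at--β = flip-injective q (begin
          flip q (value β Λ)
            -- `Λ` has `q + 3` entries, as `hⱼ` has a single root here; with the minus sign of the
            -- residue this makes `q + 4` negations, the same as `q`.
            ≈⟨ solve 1 (λ x → x := :- (:- (:- (:- x)))) ≈-refl _ ⟩
          - flip (suc (suc (suc q))) (value β Λ)
            ≡⟨ ≡.cong (λ n → - flip n (value β Λ)) (≡.trans (length-Λ j) (≡.cong (λ k → suc (suc (k ℕ.+ q))) length-H)) ⟨
          - flip (length Λ) (value β Λ)
            ≈⟨ -‿cong (antisymmetric⇒symmetric λs λs-anti β) ⟨
          - value (- β) Λ
            ≈⟨ residue j -β∈ ⟩
          y j * (value (- β) (H j) * value (- β) (O j))
            ≈⟨ *-congˡ (*-cong (value-H (hRoots j) e≡1 k (- β))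
                 (symmetric-concat (removeAt G j) (λ i → antisymmetric⇒symmetric (gRoots (punchIn j i)) (gRoots-anti (punchIn j i))) β)) ⟩
          y j * ((- β - η) * flip q v)
            ≈⟨ *-congˡ (flip-* q _ _) ⟨
          y j * flip q ((- β - η) * v)
            ≈⟨ flip-* q _ _ ⟨
          flip q (y j * ((- β - η) * v)) ∎)

        equation : (y j * v) * (η + η) ≈ 0#
        equation = begin
          (y j * v) * (η + η)
            -- The left sides at β and -β are opposite, so the two right sides add up to zero; in
            -- their sum β cancels and only the multiple of 2η survives.
            ≈⟨ solve 4 (λ y v η β → (y :* v) :* (η :+ η) := :- (y :* ((β :- η) :* v) :+ y :* ((:- β :- η) :* v))) ≈-refl (y j) v η β ⟩
          - (y j * ((β - η) * v) + y j * ((- β - η) * v))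
            ≈⟨ -‿cong (+-cong at-β at--β) ⟨
          - (- value β Λ + value β Λ)
            ≈⟨ ≈-trans (-‿cong (-‿inverseˡ _)) -0#≈0# ⟩
          0# ∎

        solution : y j * v ≈ 0# ⊎ η + η ≈ 0# → η + η ≈ 0#
        solution (inj₂ η+η≈0) = η+η≈0
        solution (inj₁ yv≈0)  = contradiction (begin
          y j * (value β (H j) * v)   ≈⟨ solve 3 (λ y h v → y :* (h :* v) := h :* (y :* v)) ≈-refl (y j) (value β (H j)) v ⟩
          value β (H j) * (y j * v)   ≈⟨ ≈-trans (*-congˡ yv≈0) (zeroʳ _) ⟩
          0#                          ∎) (residue≉0 j β∈)

-- Vertex sets and components

open import Data.Fin.Subset using (Subset; inside; outside; ⊤; _∈_; _∉_; _⊆_; _-_; ∣_∣)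
open import Data.Fin.Subset.Properties using (p─q⊆p; x∈p∧x≢y⇒x∈p-y; ⊆-antisym; ∈⊤)
open Permutation using (_↭_; refl; prep; ↭-sym; ↭-trans; ↭⇒↭ₛ)

module _ {a} {A : Set a} where

  -- Pigeonhole: a duplicate-free list contained in one that is no longer exhausts it. The larger
  -- list is thereby seen to be duplicate-free as well.
  unique-⊆⇒↭ : ∀ {xs ys : List A} → Unique xs → (∀ {x} → x ∈ˡ xs → x ∈ˡ ys) → length ys ℕ.≤ length xs → xs ↭ ys
  unique-⊆⇒↭ {[]}     {[]} _         _     _   = refl
  unique-⊆⇒↭ {x ∷ xs} {ys} (x∉ ∷ uxs) xs⊆ys len with ∈-∃++ (xs⊆ys (here ≡.refl))
  ... | as , bs , ≡.refl = ↭-trans (prep x (unique-⊆⇒↭ uxs xs⊆ len′)) (↭-sym (↭.shift x as bs))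
    where
    xs⊆ : ∀ {z} → z ∈ˡ xs → z ∈ˡ as ++ bs
    xs⊆ z∈ with ∈-++⁻ as (xs⊆ys (there z∈))
    ... | inj₁ z∈as           = ∈-++⁺ˡ z∈as
    ... | inj₂ (here ≡.refl)  = contradiction ≡.refl (All.lookup x∉ z∈)
    ... | inj₂ (there z∈bs)   = ∈-++⁺ʳ as z∈bs
    len′ : length (as ++ bs) ℕ.≤ length xs
    len′ = ℕ.s≤s⁻¹ (ℕ.≤-trans (ℕ.≤-reflexive (≡.sym (↭.↭-length (↭.shift x as bs)))) len)

  unique-++-disjoint : ∀ (xs {ys} : List A) → Unique (xs ++ ys) → ∀ {z} → z ∈ˡ xs → z ∉ˡ ys
  unique-++-disjoint (x ∷ xs) (x∉ ∷ u) (here ≡.refl) z∈ys = All.lookup (All.++⁻ʳ xs x∉) z∈ys ≡.refl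
  unique-++-disjoint (x ∷ xs) (x∉ ∷ u) (there z∈xs)  z∈ys = unique-++-disjoint xs u z∈xs z∈ys

  unique-++⁻ʳ : ∀ (xs {ys} : List A) → Unique (xs ++ ys) → Unique ys
  unique-++⁻ʳ []       u       = u
  unique-++⁻ʳ (x ∷ xs) (_ ∷ u) = unique-++⁻ʳ xs u

  ∈-concat-tabulate⁺ : ∀ {d z} (L : Fin d → List A) j → z ∈ˡ L j → z ∈ˡ concat (tabulate L)
  ∈-concat-tabulate⁺ L j z∈ = ∈-concat⁺′ z∈ (∈-tabulate⁺ j)

  unique-concat-disjoint : ∀ {d} (L : Fin d → List A) → Unique (concat (tabulate L)) →
                           ∀ {i j} → i ≢ j → ∀ {z} → z ∈ˡ L i → z ∉ˡ L j
  unique-concat-disjoint L u {zero}  {zero}  i≢j = contradiction ≡.refl i≢j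
  unique-concat-disjoint L u {zero}  {suc j} i≢j z∈i z∈j =
    unique-++-disjoint (L zero) u z∈i (∈-concat-tabulate⁺ (L ∘ suc) j z∈j)
  unique-concat-disjoint L u {suc i} {zero}  i≢j z∈i z∈j =
    unique-++-disjoint (L zero) u z∈j (∈-concat-tabulate⁺ (L ∘ suc) i z∈i)
  unique-concat-disjoint L u {suc i} {suc j} i≢j =
    unique-concat-disjoint (L ∘ suc) (unique-++⁻ʳ (L zero) u) (i≢j ∘ ≡.cong suc)

  concat-tabulate-↭ : ∀ {d} (L L′ : Fin d → List A) → (∀ j → L j ↭ L′ j) → concat (tabulate L) ↭ concat (tabulate L′)
  concat-tabulate-↭ {zero}  L L′ L↭L′ = refl
  concat-tabulate-↭ {suc d} L L′ L↭L′ = ↭.++⁺ (L↭L′ zero) (concat-tabulate-↭ (L ∘ suc) (L′ ∘ suc) (L↭L′ ∘ suc))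

length-concat-tabulate : ∀ {a b d} {A : Set a} {B : Set b} (L : Fin d → List A) (L′ : Fin d → List B) →
                         (∀ j → length (L j) ≡ length (L′ j)) →
                         length (concat (tabulate L)) ≡ length (concat (tabulate L′))
length-concat-tabulate {d = zero}  L L′ eq = ≡.refl
length-concat-tabulate {d = suc d} L L′ eq = ≡.trans (List.length-++ (L zero)) (≡.trans
  (≡.cong₂ ℕ._+_ (eq zero) (length-concat-tabulate (L ∘ suc) (L′ ∘ suc) (eq ∘ suc))) (≡.sym (List.length-++ (L′ zero))))

elementList : ∀ {n} → Subset n → List (Fin n)
elementList S = tabulate (elements S)

elements-sound : ∀ {n} (S : Subset n) k → elements S k ∈ S
elements-sound (inside  Vec.∷ S) zero    = Vec.here
elements-sound (inside  Vec.∷ S) (suc k) = Vec.there (elements-sound S k)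
elements-sound (outside Vec.∷ S) k       = Vec.there (elements-sound S k)

elements-complete : ∀ {n x} (S : Subset n) → x ∈ S → ∃ λ k → x ≡ elements S k
elements-complete (inside  Vec.∷ S) Vec.here        = zero , ≡.refl
elements-complete (inside  Vec.∷ S) (Vec.there x∈S) with elements-complete S x∈S
... | k , ≡.refl = suc k , ≡.refl
elements-complete (outside Vec.∷ S) (Vec.there x∈S) with elements-complete S x∈S
... | k , ≡.refl = k , ≡.refl

elements-injective : ∀ {n} (S : Subset n) {k l} → elements S k ≡ elements S l → k ≡ l
elements-injective (inside  Vec.∷ S) {zero}  {zero}  eq = ≡.refl
elements-injective (inside  Vec.∷ S) {suc k} {suc l} eq = ≡.cong suc (elements-injective S (suc-injective eq))
elements-injective (outside Vec.∷ S) eq = elements-injective S (suc-injective eq)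

∈-elementList⁺ : ∀ {n x} {S : Subset n} → x ∈ S → x ∈ˡ elementList S
∈-elementList⁺ {S = S} x∈S with elements-complete S x∈S
... | k , ≡.refl = ∈-tabulate⁺ k

∈-elementList⁻ : ∀ {n x} {S : Subset n} → x ∈ˡ elementList S → x ∈ S
∈-elementList⁻ {S = S} x∈ with ∈-tabulate⁻ x∈
... | k , ≡.refl = elements-sound S k

elementList-unique : ∀ {n} (S : Subset n) → Unique (elementList S)
elementList-unique S = Unique.tabulate⁺ (elements-injective S)

elementList-length : ∀ {n} (S : Subset n) → length (elementList S) ≡ ∣ S ∣
elementList-length S = List.length-tabulate (elements S)

x∉p-x : ∀ {n} (S : Subset n) x → x ∉ S - x
x∉p-x (inside  Vec.∷ S) zero    ()
x∉p-x (outside Vec.∷ S) zero    ()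
x∉p-x (_ Vec.∷ S)       (suc x) (Vec.there x∈) = x∉p-x S x x∈

x∈p-y⇒x≢y : ∀ {n} {S : Subset n} {x y} → x ∈ S - y → x ≢ y
x∈p-y⇒x≢y {S = S} x∈ ≡.refl = x∉p-x S _ x∈

elementList-remove : ∀ {n x} {S : Subset n} → x ∈ S → elementList S ↭ x ∷ elementList (S - x)
elementList-remove {x = x} {S} x∈S = ∼bag⇒↭ (unique∧set⇒bag (elementList-unique S) unique (mk⇔ to from))
  where
  unique : Unique (x ∷ elementList (S - x))
  unique = All.tabulate (λ z∈ x≡z → x∈p-y⇒x≢y (∈-elementList⁻ z∈) (≡.sym x≡z)) ∷ elementList-unique (S - x)
  from : ∀ {z} → z ∈ˡ x ∷ elementList (S - x) → z ∈ˡ elementList S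
  from (here ≡.refl) = ∈-elementList⁺ x∈S
  from (there z∈)    = ∈-elementList⁺ (p─q⊆p S _ (∈-elementList⁻ z∈))
  to : ∀ {z} → z ∈ˡ elementList S → z ∈ˡ x ∷ elementList (S - x)
  to {z} z∈ with z ≟ x
  ... | yes ≡.refl = here ≡.refl
  ... | no  z≢x    = there (∈-elementList⁺ (x∈p∧x≢y⇒x∈p-y (∈-elementList⁻ z∈) z≢x))

size-remove : ∀ {n x} {S : Subset n} → x ∈ S → ∣ S ∣ ≡ suc ∣ S - x ∣
size-remove {x = x} {S} x∈S = ≡.trans (≡.sym (elementList-length S))
  (≡.trans (↭.↭-length (elementList-remove x∈S)) (≡.cong suc (elementList-length (S - x))))

module Components {n} (T : Graph n 0ℓ) where
  open Graph T

  ReachableFrom : Subset n → Fin n → Set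
  ReachableFrom S v = ∀ {x} → x ∈ S → Star (AdjIn T S) v x

  star-∈ : ∀ {S x y} → x ∈ S → Star (AdjIn T S) x y → y ∈ S
  star-∈ x∈S ε                       = x∈S
  star-∈ x∈S ((_ , y∈S , _) ◅ rest)  = star-∈ y∈S rest

  component-⊆ : ∀ {S u C} → IsComponent T S u C → C ⊆ S
  component-⊆ (u∈S , C⇔) x∈C = star-∈ u∈S (Equivalence.to (C⇔ _) x∈C)

  component-root : ∀ {S u C} → IsComponent T S u C → u ∈ C
  component-root (u∈S , C⇔) = Equivalence.from (C⇔ _) ε

  -- Every vertex on a walk from the root is itself reached from the root, so the walk never leaves
  -- `C`. This lets a component take the place of `S` one level down.
  component-reachable : ∀ {S u C} → IsComponent T S u C → ReachableFrom C u
  component-reachable {S} {u} {C} (u∈S , C⇔) x∈C = inside-C ε (Equivalence.to (C⇔ _) x∈C)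
    where
    inside-C : ∀ {y x} → Star (AdjIn T S) u y → Star (AdjIn T S) y x → Star (AdjIn T C) y x
    inside-C u⟶y ε                  = ε
    inside-C u⟶y (y-z ◅ z⟶x) = (from u⟶y , from (u⟶y ◅◅ y-z ◅ ε) , proj₂ (proj₂ y-z)) ◅ inside-C (u⟶y ◅◅ y-z ◅ ε) z⟶x
      where
      from : ∀ {w} → Star (AdjIn T S) u w → w ∈ C
      from = Equivalence.from (C⇔ _)

  component-unique : ∀ {S u C C′} → IsComponent T S u C → IsComponent T S u C′ → C ≡ C′
  component-unique (_ , C⇔) (_ , C′⇔) = ⊆-antisym
    (λ x∈C → Equivalence.from (C′⇔ _) (Equivalence.to (C⇔ _) x∈C))
    (λ x∈C′ → Equivalence.from (C⇔ _) (Equivalence.to (C′⇔ _) x∈C′))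

  module _ {S v d} (v∈S : v ∈ S) (reach : ReachableFrom S v)
    (nbr : Fin d → Fin n) (nbr-complete : ∀ u → AdjIn T S v u ⇔ (∃ λ j → nbr j ≡ u))
    (comp : Fin d → Subset n) (isComp : ∀ j → IsComponent T (S - v) (nbr j) (comp j))
    where

    nbr-adjacent : ∀ j → AdjIn T S v (nbr j)
    nbr-adjacent j = Equivalence.from (nbr-complete (nbr j)) (j , ≡.refl)

    -- Along a walk from `v` to `x`, each departure from `v` enters some component through its
    -- neighbour of `v`, and the walk stays in that component until it next meets `v`. `Covered` is
    -- this invariant.
    components-cover : ∀ {x} → x ∈ S - v → ∃ λ j → x ∈ comp j
    components-cover {x} x∈ = conclude (walk (inj₁ ≡.refl) (reach (p─q⊆p S _ x∈)))
      where
      Covered : Fin n → Set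
      Covered y = y ≡ v ⊎ (∃ λ j → y ∈ comp j)
      conclude : Covered x → ∃ λ j → x ∈ comp j
      conclude (inj₁ x≡v) = contradiction x≡v (x∈p-y⇒x≢y x∈)
      conclude (inj₂ res) = res
      next : ∀ {y z} → Dec (z ≡ v) → Covered y → AdjIn T S y z → Covered z
      next (yes z≡v) _ _ = inj₁ z≡v
      next {z = z} (no z≢v) (inj₁ ≡.refl) v-z with Equivalence.to (nbr-complete z) v-z
      ... | j , ≡.refl = inj₂ (j , component-root (isComp j))
      next {y} {z} (no z≢v) (inj₂ (j , y∈)) (_ , z∈S , y-z) = inj₂ (j , Equivalence.from (proj₂ (isComp j) z)
        (Equivalence.to (proj₂ (isComp j) y) y∈ ◅◅ (component-⊆ (isComp j) y∈ , x∈p∧x≢y⇒x∈p-y z∈S z≢v , y-z) ◅ ε))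
      walk : ∀ {y x} → Covered y → Star (AdjIn T S) y x → Covered x
      walk covered ε = covered
      walk covered (_◅_ {j = z} y-z z⟶x) = walk (next (z ≟ v) covered y-z) z⟶x

    -- The components cover S − v, so they are disjoint once their sizes add up.
    components-↭ : length (concat (tabulate (elementList ∘ comp))) ≡ ∣ S - v ∣ →
                   elementList (S - v) ↭ concat (tabulate (elementList ∘ comp))
    components-↭ eq = unique-⊆⇒↭ (elementList-unique (S - v)) covered
      (ℕ.≤-reflexive (≡.trans eq (≡.sym (elementList-length (S - v)))))
      where
      covered : ∀ {x} → x ∈ˡ elementList (S - v) → x ∈ˡ concat (tabulate (elementList ∘ comp))
      covered x∈ with components-cover (∈-elementList⁻ x∈)
      ... | j , x∈C = ∈-concat-tabulate⁺ (elementList ∘ comp) j (∈-elementList⁺ x∈C)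

    components-disjoint : elementList (S - v) ↭ concat (tabulate (elementList ∘ comp)) →
                          ∀ {i j x} → i ≢ j → x ∈ comp i → x ∉ comp j
    components-disjoint S-v↭ i≢j x∈i x∈j = unique-concat-disjoint (elementList ∘ comp)
      (SetoidPermutationProperties.Unique-resp-↭ (≡.setoid _) (↭⇒↭ₛ S-v↭) (elementList-unique (S - v)))
       i≢j (∈-elementList⁺ x∈i) (∈-elementList⁺ x∈j)

-- Characteristic polynomials of principal submatrices

module PrincipalCharPoly {c ℓ} (K : CommutativeRing c ℓ) {n} (B : Matrix (CommutativeRing.Carrier K) n) where
  open CommutativeRing K hiding (zero; _-_) renaming (refl to ≈-refl; sym to ≈-sym; trans to ≈-trans)
  open Algebra.Properties.Ring ring using (-0#≈0#)
  open IntegerRingSolver K using (solve; _:=_; _:*_; :-_)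
  open PolynomialRing K
  module P = CommutativeRing polynomialRing
  module PProps = Algebra.Properties.Ring P.ring
  open RingOps polyRing using (sum; product)
  open Determinant polynomialRing (Fin n)
  open Algebra.Properties.CommutativeMonoid.Sum P.+-commutativeMonoid using (sum-cong-≋)
  open Algebra.Properties.CommutativeMonoid.Sum P.*-commutativeMonoid using () renaming (sum-cong-≋ to product-cong-≋)
  module ≈ᴾ-Reasoning = Relation.Binary.Reasoning.Setoid P.setoid

  sum-cong : ∀ {m} (s t : Vector Poly m) → (∀ j → s j ≈ᴾ t j) → sum s ≈ᴾ sum t
  sum-cong s t = sum-cong-≋ {x = s} {t}

  product-cong : ∀ {m} (s t : Vector Poly m) → (∀ j → s j ≈ᴾ t j) → product s ≈ᴾ product t
  product-cong s t = product-cong-≋ {x = s} {t}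

  entry : Fin n → Fin n → Poly
  entry x y = addP (if does (x ≟ y) then X else []) (const (- B x y))

  open Principal _≟_ entry public

  does-elements : ∀ (S : Subset n) k l → does (k ≟ l) ≡ does (elements S k ≟ elements S l)
  does-elements S k l with k ≟ l
  ... | yes k≡l = ≡.sym (dec-true (elements S k ≟ elements S l) (≡.cong (elements S) k≡l))
  ... | no  k≢l = ≡.sym (dec-false (elements S k ≟ elements S l) (k≢l ∘ elements-injective S))

  -- `charPoly` tests for the diagonal by positions within `S`, `entry` by vertex labels. The tests
  -- agree because `elements` is injective, and then all principal submatrices share the one
  -- function `entry`.
  charPoly-principal : ∀ S → charPoly (B [ S ]) ≈ᴾ principal (elementList S)
  charPoly-principal S = principal-tabulate (elements S)
    (λ k l → addP (if does (k ≟ l) then X else []) (const (- B (elements S k) (elements S l))))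
    (λ k l → P.reflexive (≡.cong (λ b → addP (if b then X else []) (const (- B (elements S k) (elements S l)))) (does-elements S k l)))

  const-cong : ∀ {a b} → a ≈ b → const a ≈ᴾ const b
  const-cong a≈b zero    = a≈b
  const-cong a≈b (suc k) = ≈-refl

  const-* : ∀ a b → mulP (const a) (const b) ≈ᴾ const (a * b)
  const-* a b zero    = +-identityʳ _
  const-* a b (suc k) = ≈-refl

  const-0 : ∀ {a} → a ≈ 0# → const a ≈ᴾ []
  const-0 a≈0 zero    = a≈0
  const-0 a≈0 (suc k) = ≈-refl

  entry-offdiagonal : ∀ {x y} → x ≢ y → entry x y ≈ᴾ const (- B x y)
  entry-offdiagonal {x} {y} x≢y = P.reflexive (≡.cong (λ b → addP (if b then X else []) (const (- B x y))) (dec-false (x ≟ y) x≢y))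

  entry-0 : ∀ {x y} → x ≢ y → B x y ≈ 0# → entry x y ≈ᴾ []
  entry-0 {x} {y} x≢y B≈0 = P.trans {entry x y} {const (- B x y)} {[]} (entry-offdiagonal x≢y)
    (const-0 (≈-trans (-‿cong B≈0) -0#≈0#))

  entry-diagonal : ∀ {x} → B x x ≈ 0# → entry x x ≈ᴾ X
  entry-diagonal {x} B≈0 = P.trans {entry x x} {addP X (const (- B x x))} {X}
    (P.reflexive (≡.cong (λ b → addP (if b then X else []) (const (- B x x))) (dec-true (x ≟ x) ≡.refl)))
    (λ where
      zero    → ≈-trans (+-identityˡ _) (≈-trans (-‿cong B≈0) -0#≈0#)
      (suc k) → ≈-refl)

  entry-*-entry : ∀ {x y} → x ≢ y → mulP (entry x y) (entry y x) ≈ᴾ const (B x y * B y x)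
  entry-*-entry {x} {y} x≢y = ≈ᴾ-Reasoning.begin
    mulP (entry x y) (entry y x)                  ≈ᴾ-Reasoning.≈⟨ P.*-cong {entry x y} {const (- B x y)} {entry y x} {const (- B y x)}
                                                       (entry-offdiagonal x≢y) (entry-offdiagonal (x≢y ∘ ≡.sym)) ⟩
    mulP (const (- B x y)) (const (- B y x))      ≈ᴾ-Reasoning.≈⟨ const-* (- B x y) (- B y x) ⟩
    const (- B x y * - B y x)                     ≈ᴾ-Reasoning.≈⟨ const-cong (solve 2 (λ a b → :- a :* :- b := a :* b) ≈-refl (B x y) (B y x)) ⟩
    const (B x y * B y x)                         ≈ᴾ-Reasoning.∎

  principal-singleton : ∀ {x} → B x x ≈ 0# → principal (x ∷ []) ≈ᴾ X
  principal-singleton {x} B≈0 = P.trans {principal (x ∷ [])} {entry x x} {X} (det-pairs-singleton (entry x) x) (entry-diagonal B≈0)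

  principal-pair : ∀ {x y} → x ≢ y → B x x ≈ 0# → B y y ≈ 0# →
                   principal (x ∷ y ∷ []) ≈ᴾ addP (mulP X X) (P.- const (B x y * B y x))
  principal-pair {x} {y} x≢y Bxx≈0 Byy≈0 = ≈ᴾ-Reasoning.begin
    principal (x ∷ y ∷ [])
      ≈ᴾ-Reasoning.≈⟨ principal-glue [] [] (λ { (here ≡.refl) y≡x → x≢y (≡.sym y≡x) }) (λ ()) (λ _ ()) (λ _ ()) ⟩
    addP (mulP (principal (x ∷ [])) (principal (y ∷ []))) (P.- mulP (mulP (entry x y) (entry y x)) (mulP P.1# P.1#))
      ≈ᴾ-Reasoning.≈⟨ P.+-cong {mulP (principal (x ∷ [])) (principal (y ∷ []))} {mulP X X}
             {P.- mulP (mulP (entry x y) (entry y x)) (mulP P.1# P.1#)} {P.- const (B x y * B y x)}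
           (P.*-cong {principal (x ∷ [])} {X} {principal (y ∷ [])} {X} (principal-singleton Bxx≈0) (principal-singleton Byy≈0))
           (P.-‿cong {mulP (mulP (entry x y) (entry y x)) (mulP P.1# P.1#)} {const (B x y * B y x)}
             (P.trans {mulP (mulP (entry x y) (entry y x)) (mulP P.1# P.1#)} {mulP (entry x y) (entry y x)} {const (B x y * B y x)}
               (P.trans {mulP (mulP (entry x y) (entry y x)) (mulP P.1# P.1#)} {mulP (mulP (entry x y) (entry y x)) P.1#} {mulP (entry x y) (entry y x)}
                 (P.*-congˡ {mulP (entry x y) (entry y x)} {mulP P.1# P.1#} {P.1#} (P.*-identityˡ P.1#))
                 (P.*-identityʳ (mulP (entry x y) (entry y x))))
               (entry-*-entry x≢y))) ⟩
    addP (mulP X X) (P.- const (B x y * B y x)) ≈ᴾ-Reasoning.∎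

  module _ {d v} (nbr : Fin (suc d) → Fin n) (rest : Fin (suc d) → List (Fin n)) (y : Vector Carrier (suc d))
    (v∉ : ∀ j {x} → x ∈ˡ nbr j ∷ rest j → x ≢ v)
    (v-v : B v v ≈ 0#)
    (v-nbr : ∀ j → B v (nbr j) * B (nbr j) v ≈ - y j)
    (v-rest : ∀ j {x} → x ∈ˡ rest j → B v x ≈ 0# × B x v ≈ 0#)
    (separate : ∀ {i j x z} → i ≢ j → x ∈ˡ nbr i ∷ rest i → z ∈ˡ nbr j ∷ rest j → x ≢ z × B x z ≈ 0# × B z x ≈ 0#)
    {G H : Vector Poly (suc d)} (G≈ : ∀ j → principal (nbr j ∷ rest j) ≈ᴾ G j) (H≈ : ∀ j → principal (rest j) ≈ᴾ H j)
    where

    private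
      C : Fin (suc d) → List (Fin n)
      C j = nbr j ∷ rest j

      PC : Vector Poly (suc d)
      PC j = principal (C j)

      disconnected : ∀ {i j} → i ≢ j → Disconnected (C i) (C j)
      disconnected i≢j x∈ z∈ with separate i≢j x∈ z∈
      ... | x≢z , xz≈0 , zx≈0 = entry-0 x≢z xz≈0 , entry-0 (x≢z ∘ ≡.sym) zx≈0

      v-disconnected : ∀ j → Disconnected (v ∷ []) (rest j)
      v-disconnected j (here ≡.refl) x∈ =
        entry-0 (v∉ j (there x∈) ∘ ≡.sym) (proj₁ (v-rest j x∈)) , entry-0 (v∉ j (there x∈)) (proj₂ (v-rest j x∈))

      neg-sum : ∀ {m} (t : Vector Poly m) → P.- sum t ≈ᴾ sum (λ j → P.- t j)
      neg-sum {zero}  t = P.refl {[]}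
      neg-sum {suc m} t = P.trans {P.- sum t} {addP (P.- t zero) (P.- sum (t ∘ suc))} {sum (λ j → P.- t j)}
        (P.sym {addP (P.- t zero) (P.- sum (t ∘ suc))} {P.- sum t} (PProps.-‿+-comm (t zero) (sum (t ∘ suc))))
        (P.+-congˡ {P.- t zero} {P.- sum (t ∘ suc)} {sum (λ j → P.- t (suc j))} (neg-sum (t ∘ suc)))

      weight : ∀ j → mulP (entry v (nbr j)) (entry (nbr j) v) ≈ᴾ P.- const (y j)
      weight j = P.trans {mulP (entry v (nbr j)) (entry (nbr j) v)} {const (B v (nbr j) * B (nbr j) v)} {P.- const (y j)}
        (entry-*-entry (v∉ j (here ≡.refl) ∘ ≡.sym)) (const-cong (v-nbr j))

      others≈ : ∀ j → others PC j ≈ᴾ product (removeAt G j)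
      others≈ j = P.trans {others PC j} {product (removeAt PC j)} {product (removeAt G j)}
        (P.sym {product (removeAt PC j)} {others PC j} (product-removeAt PC j)) (product-cong (removeAt PC j) (removeAt G j) (λ k → G≈ (punchIn j k)))

      term≈ : ∀ j → P.- mulP (mulP (entry v (nbr j)) (entry (nbr j) v)) (mulP (principal (rest j)) (others PC j)) ≈ᴾ
                    mulP (const (y j)) (mulP (H j) (product (removeAt G j)))
      term≈ j = ≈ᴾ-Reasoning.begin
        P.- mulP (mulP (entry v (nbr j)) (entry (nbr j) v)) (mulP (principal (rest j)) (others PC j))
          ≈ᴾ-Reasoning.≈⟨ P.-‿cong {mulP (mulP (entry v (nbr j)) (entry (nbr j) v)) (mulP (principal (rest j)) (others PC j))} {mulP (P.- const (y j)) rhs}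
               (P.*-cong {mulP (entry v (nbr j)) (entry (nbr j) v)} {P.- const (y j)} {mulP (principal (rest j)) (others PC j)} {rhs} (weight j)
                 (P.*-cong {principal (rest j)} {H j} {others PC j} {product (removeAt G j)} (H≈ j) (others≈ j))) ⟩
        P.- mulP (P.- const (y j)) rhs
          ≈ᴾ-Reasoning.≈⟨ P.trans {P.- mulP (P.- const (y j)) rhs} {P.- (P.- mulP (const (y j)) rhs)} {mulP (const (y j)) rhs}
               (P.-‿cong {mulP (P.- const (y j)) rhs} {P.- mulP (const (y j)) rhs}
                 (P.sym {P.- mulP (const (y j)) rhs} {mulP (P.- const (y j)) rhs} (PProps.-‿distribˡ-* (const (y j)) rhs)))
               (PProps.-‿involutive (mulP (const (y j)) rhs)) ⟩
        mulP (const (y j)) rhs ≈ᴾ-Reasoning.∎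
        where rhs = mulP (H j) (product (removeAt G j))

    principal-components : principal (concat (tabulate C)) ≈ᴾ product G
    principal-components = P.trans {principal (concat (tabulate C))} {product PC} {product G}
      (principal-concat C disconnected) (product-cong PC G G≈)

    -- By `v-nbr` the product of the two entries between `v` and its j-th neighbour is -yⱼ, which is
    -- where skew-symmetry enters: it turns the minus signs of `principal-star` into the plus signs
    -- of the partial fractions.
    principal-recursion : principal (v ∷ concat (tabulate C)) ≈ᴾ
      addP (mulP X (product G)) (sum λ j → mulP (const (y j)) (mulP (H j) (product (removeAt G j))))
    principal-recursion = ≈ᴾ-Reasoning.begin
      principal (v ∷ concat (tabulate C))
        ≈ᴾ-Reasoning.≈⟨ principal-star nbr rest v∉ v-disconnected disconnected ⟩
      addP (mulP (entry v v) (product PC)) (P.- sum terms)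
        ≈ᴾ-Reasoning.≈⟨ P.+-cong {mulP (entry v v) (product PC)} {mulP X (product G)} {P.- sum terms}
             {sum (λ j → mulP (const (y j)) (mulP (H j) (product (removeAt G j))))}
             (P.*-cong {entry v v} {X} {product PC} {product G} (entry-diagonal v-v) (product-cong PC G G≈))
             (P.trans {P.- sum terms} {sum (λ j → P.- terms j)} {sum (λ j → mulP (const (y j)) (mulP (H j) (product (removeAt G j))))}
               (neg-sum terms) (sum-cong (λ j → P.- terms j) (λ j → mulP (const (y j)) (mulP (H j) (product (removeAt G j)))) term≈)) ⟩
      addP (mulP X (product G)) (sum λ j → mulP (const (y j)) (mulP (H j) (product (removeAt G j)))) ≈ᴾ-Reasoning.∎
      where
      terms : Vector Poly (suc d)
      terms j = mulP (mulP (entry v (nbr j)) (entry (nbr j) v)) (mulP (principal (rest j)) (others PC j))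

-- Spectra of the constructed matrices

difference-of-squares : ∀ {c ℓ} (K : CommutativeRing c ℓ) → let open CommutativeRing K in
  ∀ x y → (x + y) * (x + - y) ≈ x * x + - (y * y)
difference-of-squares K = solve 2 (λ x y → (x :+ y) :* (x :+ :- y) := x :* x :+ :- (y :* y)) (CommutativeRing.refl K)
  where open IntegerRingSolver K

module Spectra {c ℓ₁ ℓ₂} (ℝ : RealNumbers c ℓ₁ ℓ₂) (ℂ : ComplexNumbers ℝ) {n} (A : Matrix (RealNumbers.Carrier ℝ) n) where
  open SignCounting ℝ hiding (_-_)
  open ImaginaryRoots ℝ ℂ using (module C; i; withRoots; imag-cong)
  open PartialFractions ℝ ℂ using (roots-↭)
  open ComplexNumbers ℂ using (real; imag; real-cong; real-0; real-*; real-neg; imag≈i*real; i*i≈-1) renaming (ring to ℂ-ring)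
  open PolynomialRing ℂ-ring
  open LinearFactors ℂ-ring
  open RingOps polyRing using (sum; product)
  module P = CommutativeRing polynomialRing

  B : Matrix C.Carrier n
  B x y = real (A x y)

  open PrincipalCharPoly ℂ-ring B hiding (module P)

  Spectral : ∀ {m} → Subset n → Vector R m → Set _
  Spectral S α = charPoly (B [ S ]) ≈ᴾ withRoots α

  B-0 : ∀ {x y} → A x y ≈ 0# → B x y C.≈ C.0#
  B-0 A≈0 = C.trans (real-cong A≈0) real-0

  imag-0 : ∀ {a} → a ≈ 0# → imag a C.≈ C.0#
  imag-0 a≈0 = C.trans (imag≈i*real _) (C.trans (C.*-congˡ (C.trans (real-cong a≈0) real-0)) (C.zeroʳ i))

  imag-neg : ∀ a → imag (- a) C.≈ C.- imag a
  imag-neg a = C.begin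
    imag (- a)            C.≈⟨ imag≈i*real (- a) ⟩
    i C.* real (- a)      C.≈⟨ C.*-congˡ (real-neg a) ⟩
    i C.* (C.- real a)    C.≈⟨ C.solve 2 (λ i x → i C.:* C.:- x C.:= C.:- (i C.:* x)) C.refl i (real a) ⟩
    C.- (i C.* real a)    C.≈⟨ C.-‿cong (imag≈i*real a) ⟨
    C.- imag a            C.∎

  imag-square : ∀ a → imag a C.* imag a C.≈ C.- (real a C.* real a)
  imag-square a = C.begin
    imag a C.* imag a                     C.≈⟨ C.*-cong (imag≈i*real a) (imag≈i*real a) ⟩
    (i C.* real a) C.* (i C.* real a)     C.≈⟨ C.solve 2 (λ i x → (i C.:* x) C.:* (i C.:* x) C.:= (i C.:* i) C.:* (x C.:* x)) C.refl i (real a) ⟩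
    (i C.* i) C.* (real a C.* real a)     C.≈⟨ C.*-congʳ i*i≈-1 ⟩
    (C.- C.1#) C.* (real a C.* real a)    C.≈⟨ C.solve 2 (λ o x → (C.:- o) C.:* x C.:= C.:- (o C.:* x)) C.refl C.1# _ ⟩
    C.- (C.1# C.* (real a C.* real a))    C.≈⟨ C.-‿cong (C.*-identityˡ _) ⟩
    C.- (real a C.* real a)               C.∎

  withRoots-0 : (α : Vector R 1) → α zero ≈ 0# → withRoots α ≈ᴾ X
  withRoots-0 α α≈0 = P.trans {withRoots α} {linear (imag (α zero))} {X} (P.*-identityʳ (linear (imag (α zero)))) λ where
    zero    → C.trans (C.+-identityˡ _) (C.trans (C.-‿cong (imag-0 α≈0)) (Algebra.Properties.Ring.-0#≈0# (CommutativeRing.ring ℂ-ring)))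
    (suc k) → C.refl

  withRoots-opposite : (α : Vector R 2) → α (suc zero) ≈ - α zero →
    withRoots α ≈ᴾ addP (mulP X X) (P.- const (C.- (real (α zero) C.* real (α zero))))
  withRoots-opposite α anti = P.trans {withRoots α} {mulP (addP X (const (C.- a))) (addP X (P.- const (C.- a)))} {rhs}
    (P.*-cong {linear a} {addP X (const (C.- a))} {mulP (linear b) P.1#} {addP X (P.- const (C.- a))} (P.refl {linear a})
      (P.trans {mulP (linear b) P.1#} {linear b} {addP X (P.- const (C.- a))} (P.*-identityʳ (linear b)) λ where
        zero    → C.+-congˡ (C.-‿cong (C.trans (imag-cong anti) (imag-neg (α zero))))
        (suc k) → C.refl))
    (P.trans {mulP (addP X (const (C.- a))) (addP X (P.- const (C.- a)))} {addP (mulP X X) (P.- mulP (const (C.- a)) (const (C.- a)))} {rhs}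
      (difference-of-squares polynomialRing X (const (C.- a)))
      (P.+-congˡ {mulP X X} {P.- mulP (const (C.- a)) (const (C.- a))} {P.- const (C.- (real (α zero) C.* real (α zero)))}
        (P.-‿cong {mulP (const (C.- a)) (const (C.- a))} {const (C.- (real (α zero) C.* real (α zero)))}
          (P.trans {mulP (const (C.- a)) (const (C.- a))} {const (C.- a C.* C.- a)} {const (C.- (real (α zero) C.* real (α zero)))}
            (const-* (C.- a) (C.- a)) (const-cong (C.trans (C.solve 1 (λ a → C.:- a C.:* C.:- a C.:= a C.:* a) C.refl a) (imag-square (α zero))))))))
    where
    a b : C.Carrier
    a = imag (α zero)
    b = imag (α (suc zero))
    rhs : Poly
    rhs = addP (mulP X X) (P.- const (C.- (real (α zero) C.* real (α zero))))

  -- The characteristic polynomial may be computed in whatever order of the vertices suits the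
  -- expansion, since `principal` is invariant under permutation.
  spectral-↭ : ∀ {S m xs p} {α : Vector R m} → elementList S ↭ xs → principal xs ≈ᴾ p → withRoots α ≈ᴾ p → Spectral S α
  spectral-↭ {S} {m} {xs} {p} {α} S↭xs xs≈p α≈p = P.trans {charPoly (B [ S ])} {principal (elementList S)} {withRoots α} (charPoly-principal S)
    (P.trans {principal (elementList S)} {principal xs} {withRoots α} (principal-↭ S↭xs)
      (P.trans {principal xs} {p} {withRoots α} xs≈p (P.sym {withRoots α} {p} α≈p)))

  spectral-empty : ∀ {S} (α : Vector R 0) → ∣ S ∣ ≡ 0 → Spectral S α
  spectral-empty {S} α size = spectral-↭ {S} {xs = []} {p = P.1#} {α} S↭[] (P.refl {P.1#}) (P.refl {P.1#})
    where
    S↭[] : elementList S ↭ []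
    S↭[] = ↭-sym (unique-⊆⇒↭ [] (λ ()) (ℕ.≤-reflexive (≡.trans (elementList-length S) size)))

  spectral-singleton : ∀ {S x} (α : Vector R 1) → x ∈ S → ∣ S ∣ ≡ 1 → A x x ≈ 0# → α zero ≈ 0# → Spectral S α
  spectral-singleton {S} {x} α x∈S size A≈0 α≈0 = spectral-↭ {S} {xs = x ∷ []} {p = X} {α} S↭x
    (principal-singleton (B-0 A≈0)) (withRoots-0 α α≈0)
    where
    S↭x : elementList S ↭ x ∷ []
    S↭x = ↭-sym (unique-⊆⇒↭ ([] ∷ []) (λ { (here ≡.refl) → ∈-elementList⁺ x∈S })
      (ℕ.≤-reflexive (≡.trans (elementList-length S) size)))

  spectral-pair : ∀ {S p q} (α : Vector R 2) → p ∈ S → q ∈ S → p ≢ q → ∣ S ∣ ≡ 2 → A p p ≈ 0# → A q q ≈ 0# →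
                  A p q ≈ α zero → A q p ≈ - α zero → α (suc zero) ≈ - α zero → Spectral S α
  spectral-pair {S} {p} {q} α p∈S q∈S p≢q size App≈0 Aqq≈0 Apq≈α Aqp≈-α anti = spectral-↭ {S} {xs = p ∷ q ∷ []}
      {p = addP (mulP X X) (P.- const (C.- (real (α zero) C.* real (α zero))))} {α} S↭pq
      (P.trans {principal (p ∷ q ∷ [])} {addP (mulP X X) (P.- const (B p q C.* B q p))} {addP (mulP X X) (P.- const (C.- (real (α zero) C.* real (α zero))))}
        (principal-pair p≢q (B-0 App≈0) (B-0 Aqq≈0))
        (P.+-congˡ {mulP X X} {P.- const (B p q C.* B q p)} {P.- const (C.- (real (α zero) C.* real (α zero)))}
          (P.-‿cong {const (B p q C.* B q p)} {const (C.- (real (α zero) C.* real (α zero)))} (const-cong weight))))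
      (withRoots-opposite α anti)
    where
    S↭pq : elementList S ↭ p ∷ q ∷ []
    S↭pq = ↭-sym (unique-⊆⇒↭ ((p≢q ∷ []) ∷ [] ∷ []) (λ { (here ≡.refl) → ∈-elementList⁺ p∈S ; (there (here ≡.refl)) → ∈-elementList⁺ q∈S })
      (ℕ.≤-reflexive (≡.trans (elementList-length S) size)))
    weight : B p q C.* B q p C.≈ C.- (real (α zero) C.* real (α zero))
    weight = C.trans (C.*-cong (real-cong Apq≈α) (C.trans (real-cong Aqp≈-α) (real-neg (α zero))))
      (C.solve 1 (λ x → x C.:* C.:- x C.:= C.:- (x C.:* x)) C.refl (real (α zero)))

  module _ (T : Graph n 0ℓ) {S v m d} (v∈S : v ∈ S) (size : ∣ S ∣ ≡ suc m) (reach : Components.ReachableFrom T S v)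
    (nbr : Fin (suc d) → Fin n)
    (nbr-complete : ∀ u → AdjIn T S v u ⇔ (∃ λ j → nbr j ≡ u))
    (comp : Fin (suc d) → Subset n) (isComp : ∀ j → IsComponent T (S - v) (nbr j) (comp j))
    {e : Fin (suc d) → ℕ} (comp-size : ∀ j → ∣ comp j ∣ ≡ suc (e j))
    (λs : Vector R (suc m)) (μs : Vector R m)
    (gRoots : ∀ j → Vector R (suc (e j))) (hRoots : ∀ j → Vector R (e j)) (y √y : Vector R (suc d))
    (factorization : withRoots μs ≈ᴾ product λ j → withRoots (gRoots j))
    (partialFractions : withRoots λs ≈ᴾ addP (mulP X (withRoots μs)) (sum λ j →
        mulP (const (real (y j))) (mulP (withRoots (hRoots j)) (product (removeAt (λ i → withRoots (gRoots i)) j)))))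
    (√y²≈y : ∀ j → √y j * √y j ≈ y j)
    (A-nbr : ∀ j → A v (nbr j) ≈ √y j × A (nbr j) v ≈ - √y j)
    (zeros : ∀ {k l} → k ∈ S → l ∈ S → ¬ (k ≡ v × Graph.Adj T v l) → ¬ (l ≡ v × Graph.Adj T v k) →
             (∀ j → ¬ (k ∈ comp j × l ∈ comp j)) → A k l ≈ 0#)
    where
    open Graph T using (Adj) renaming (irrefl to loopless)
    open Components T hiding (nbr-adjacent; components-↭; components-disjoint)

    private
      rest : Fin (suc d) → List (Fin n)
      rest j = elementList (comp j - nbr j)

      S-v-size : ∣ S - v ∣ ≡ m
      S-v-size = ℕ.suc-injective (≡.trans (≡.sym (size-remove v∈S)) size)

      -- Each component has as many vertices as its `gⱼ` has roots, and by `roots-↭` these are the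
      -- μ's all together, as many as `S - v` has vertices. This is the count that `components-↭`
      -- asks for.
      S-v↭ : elementList (S - v) ↭ concat (tabulate (elementList ∘ comp))
      S-v↭ = Components.components-↭ T v∈S reach nbr nbr-complete comp isComp (≡.trans
        (length-concat-tabulate (elementList ∘ comp) (λ j → tabulate (gRoots j)) (λ j →
          ≡.trans (elementList-length (comp j)) (≡.trans (comp-size j) (≡.sym (List.length-tabulate (gRoots j))))))
        (≡.trans (≡.sym (SetoidPermutationProperties.xs↭ys⇒|xs|≡|ys| setoid (roots-↭ λs μs gRoots hRoots y factorization partialFractions)))
          (≡.trans (List.length-tabulate μs) (≡.sym S-v-size))))

      disjoint : ∀ {i j x} → i ≢ j → x ∈ comp i → x ∉ comp j
      disjoint = Components.components-disjoint T v∈S reach nbr nbr-complete comp isComp S-v↭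

      ⊆S : ∀ j {x} → x ∈ comp j → x ∈ S
      ⊆S j x∈ = p─q⊆p S _ (component-⊆ (isComp j) x∈)

      ≢v : ∀ j {x} → x ∈ comp j → x ≢ v
      ≢v j x∈ = x∈p-y⇒x≢y (component-⊆ (isComp j) x∈)

      comp↭ : ∀ j → elementList (comp j) ↭ nbr j ∷ rest j
      comp↭ j = elementList-remove (component-root (isComp j))

      ∈comp : ∀ j {x} → x ∈ˡ nbr j ∷ rest j → x ∈ comp j
      ∈comp j x∈ = ∈-elementList⁻ (↭.∈-resp-↭ (↭-sym (comp↭ j)) x∈)

      -- A neighbour of `v` is some `nbr k`. For k = j it has been removed from `rest j`; otherwise
      -- its own component would meet `comp j`.
      ¬adjacent : ∀ j {x} → x ∈ˡ rest j → ¬ Adj v x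
      ¬adjacent j {x} x∈ v-x with Equivalence.to (nbr-complete x) (v∈S , ⊆S j (∈comp j (there x∈)) , v-x)
      ... | k , ≡.refl with k ≟ j
      ...   | yes ≡.refl = x∈p-y⇒x≢y (∈-elementList⁻ x∈) ≡.refl
      ...   | no  k≢j    = disjoint k≢j (component-root (isComp k)) (∈comp j (there x∈))

      A-vv : A v v ≈ 0#
      A-vv = zeros v∈S v∈S (loopless ∘ proj₂) (loopless ∘ proj₂) (λ j (v∈ , _) → ≢v j v∈ ≡.refl)

      A-rest : ∀ j {x} → x ∈ˡ rest j → B v x C.≈ C.0# × B x v C.≈ C.0#
      A-rest j x∈ =
          B-0 (zeros v∈S (⊆S j x∈C) (¬adjacent j x∈ ∘ proj₂) (≢v j x∈C ∘ proj₁) (λ k (v∈ , _) → ≢v k v∈ ≡.refl))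
        , B-0 (zeros (⊆S j x∈C) v∈S (≢v j x∈C ∘ proj₁) (¬adjacent j x∈ ∘ proj₂) (λ k (_ , v∈) → ≢v k v∈ ≡.refl))
        where x∈C = ∈comp j (there x∈)

      separate : ∀ {i j x z} → i ≢ j → x ∈ comp i → z ∈ comp j → x ≢ z × B x z C.≈ C.0# × B z x C.≈ C.0#
      separate {i} {j} i≢j x∈ z∈ = (λ { ≡.refl → disjoint i≢j x∈ z∈ })
        , B-0 (zeros (⊆S i x∈) (⊆S j z∈) (≢v i x∈ ∘ proj₁) (≢v j z∈ ∘ proj₁) (λ k (x∈k , z∈k) → same-component k x∈k z∈k))
        , B-0 (zeros (⊆S j z∈) (⊆S i x∈) (≢v j z∈ ∘ proj₁) (≢v i x∈ ∘ proj₁) (λ k (z∈k , x∈k) → same-component k x∈k z∈k))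
        where
        same-component : ∀ k → _ ∈ comp k → _ ∈ comp k → _
        same-component k x∈k z∈k with i ≟ k
        ... | yes ≡.refl = disjoint i≢j z∈k z∈
        ... | no  i≢k    = disjoint i≢k x∈ x∈k

      weight : ∀ j → B v (nbr j) C.* B (nbr j) v C.≈ C.- real (y j)
      weight j = C.begin
        B v (nbr j) C.* B (nbr j) v                 C.≈⟨ C.*-cong (real-cong (proj₁ (A-nbr j))) (C.trans (real-cong (proj₂ (A-nbr j))) (real-neg (√y j))) ⟩
        real (√y j) C.* (C.- real (√y j))           C.≈⟨ C.solve 1 (λ x → x C.:* C.:- x C.:= C.:- (x C.:* x)) C.refl (real (√y j)) ⟩
        C.- (real (√y j) C.* real (√y j))           C.≈⟨ C.-‿cong (real-* (√y j) (√y j)) ⟨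
        C.- real (√y j * √y j)                      C.≈⟨ C.-‿cong (real-cong (√y²≈y j)) ⟩
        C.- real (y j)                              C.∎

    module _ (g-spectral : ∀ j → Spectral (comp j) (gRoots j)) (h-spectral : ∀ j → Spectral (comp j - nbr j) (hRoots j)) where

      private
        g′ h′ : Vector Poly (suc d)
        g′ j = withRoots (gRoots j)
        h′ j = withRoots (hRoots j)

        G≈ : ∀ j → principal (nbr j ∷ rest j) ≈ᴾ g′ j
        G≈ j = P.trans {principal (nbr j ∷ rest j)} {principal (elementList (comp j))} {g′ j} (principal-↭ (↭-sym (comp↭ j)))
          (P.trans {principal (elementList (comp j))} {charPoly (B [ comp j ])} {g′ j}
            (P.sym {charPoly (B [ comp j ])} {principal (elementList (comp j))} (charPoly-principal (comp j))) (g-spectral j))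

        H≈ : ∀ j → principal (rest j) ≈ᴾ h′ j
        H≈ j = P.trans {principal (rest j)} {charPoly (B [ comp j - nbr j ])} {h′ j}
          (P.sym {charPoly (B [ comp j - nbr j ])} {principal (rest j)} (charPoly-principal (comp j - nbr j))) (h-spectral j)

        C↭ : elementList (S - v) ↭ concat (tabulate (λ j → nbr j ∷ rest j))
        C↭ = ↭-trans S-v↭ (concat-tabulate-↭ (elementList ∘ comp) (λ j → nbr j ∷ rest j) comp↭)

        v∉ : ∀ j {x} → x ∈ˡ nbr j ∷ rest j → x ≢ v
        v∉ j x∈ = ≢v j (∈comp j x∈)

        separate′ : ∀ {i j x z} → i ≢ j → x ∈ˡ nbr i ∷ rest i → z ∈ˡ nbr j ∷ rest j → x ≢ z × B x z C.≈ C.0# × B z x C.≈ C.0#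
        separate′ {i} {j} i≢j x∈ z∈ = separate i≢j (∈comp i x∈) (∈comp j z∈)

        tail-sum : Poly
        tail-sum = sum λ j → mulP (const (real (y j))) (mulP (h′ j) (product (removeAt g′ j)))

      components-spectral : Spectral (S - v) μs
      components-spectral = spectral-↭ {S - v} {xs = concat (tabulate (λ j → nbr j ∷ rest j))} {p = product g′} {μs} C↭
        (principal-components nbr rest (λ j → real (y j)) v∉ (B-0 A-vv) weight A-rest separate′ {G = g′} {H = h′} G≈ H≈) factorization

      tree-spectral : Spectral S λs
      tree-spectral = spectral-↭ {S} {xs = v ∷ concat (tabulate (λ j → nbr j ∷ rest j))} {p = addP (mulP X (product g′)) tail-sum} {λs}
        (↭-trans (elementList-remove v∈S) (prep v C↭))
        (principal-recursion nbr rest (λ j → real (y j)) v∉ (B-0 A-vv) weight A-rest separate′ {G = g′} {H = h′} G≈ H≈)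
        (P.trans {withRoots λs} {addP (mulP X (withRoots μs)) tail-sum} {addP (mulP X (product g′)) tail-sum} partialFractions
          (P.+-congʳ {tail-sum} {mulP X (withRoots μs)} {mulP X (product g′)} (P.*-congˡ {X} {withRoots μs} {product g′} factorization)))

singleton-≡ : ∀ {n x z} {S : Subset n} → ∣ S ∣ ≡ 1 → x ∈ S → z ∈ S → z ≡ x
singleton-≡ {x = x} {z} {S} size x∈S z∈S with ↭.∈-resp-↭ S↭x (∈-elementList⁺ z∈S)
  where
  S↭x : elementList S ↭ x ∷ []
  S↭x = ↭-sym (unique-⊆⇒↭ ([] ∷ []) (λ { (here ≡.refl) → ∈-elementList⁺ x∈S })
    (ℕ.≤-reflexive (≡.trans (elementList-length S) size)))
... | here z≡x = z≡x

-- Induction along the construction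

module Construction {c ℓ₁ ℓ₂} (ℝ : RealNumbers c ℓ₁ ℓ₂) {n} (T : Graph n 0ℓ) (A : Matrix (RealNumbers.Carrier ℝ) n) where
  open Skew ℝ
  open SignCounting ℝ using (R; _≈_; _+_; -_; 0#; ≈-trans; ≈-sym; +-congˡ; -‿inverseʳ; x+x≈0⇒x≈0; <-trans)
  open Components T using (ReachableFrom; component-reachable; component-unique; component-⊆; component-root)

  ℂ′ : ComplexNumbers ℝ
  ℂ′ = ComplexPairs.complexNumbers ℝ

  module Spectral = Spectra ℝ ℂ′ A
  module Fractions = PartialFractions ℝ ℂ′

  antisymmetric-0 : ∀ {α} → α ≈ - α → α ≈ 0#
  antisymmetric-0 {α} α≈-α = x+x≈0⇒x≈0 (≈-trans (+-congˡ α≈-α) (-‿inverseʳ α))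

  module _ (same : ∀ k l → Graph.Adj (graph A) k l ⇔ Graph.Adj T k l) where

    to-T : ∀ {S x y} → AdjIn (graph A) S x y → AdjIn T S x y
    to-T (x∈S , y∈S , x-y) = x∈S , y∈S , Equivalence.to (same _ _) x-y

    from-T : ∀ {S x y} → AdjIn T S x y → AdjIn (graph A) S x y
    from-T (x∈S , y∈S , x-y) = x∈S , y∈S , Equivalence.from (same _ _) x-y

    component-T : ∀ {S u C} → IsComponent (graph A) S u C → IsComponent T S u C
    component-T (u∈S , C⇔) = u∈S , λ x → mk⇔ (Star.map to-T ∘ Equivalence.to (C⇔ x)) (Equivalence.from (C⇔ x) ∘ Star.map from-T)

    -- The spectra are carried along with the Duarte property because those of the components
    -- determine those of the whole. `ReachableFrom` is connectedness in the form that passes to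
    -- components, and the condition for m = 1 is what the matrix of order two requires;
    -- `child-root-0` renews it one level down.
    produced⇒duarte : ∀ {S v m} {λs : Vector R (suc m)} {μs : Vector R m} → Produced T A S v λs μs →
      ReachableFrom S v → StrictlyInterlaces μs λs → Antisymmetric λs → (m ≡ 1 → ∀ k → μs k ≈ 0#) →
      Spectrum (A [ S ]) λs × Spectrum (A [ S - v ]) μs × Duarte A S v
    produced⇒duarte {S} {v} {λs = λs} {μs} (size-1 v∈S size A≈0) reach inter anti μ≈0 =
        Spectral.spectral-singleton {S} λs v∈S size A≈0 (antisymmetric-0 (anti zero))
      , Spectral.spectral-empty {S - v} μs (ℕ.suc-injective (≡.trans (≡.sym (size-remove v∈S)) size))
      , single v∈S size
    produced⇒duarte {S} {v} {λs = λs} {μs} (size-2 {p = p} {q} v∈S size p∈S q∈S p<q App≈0 Apq≈λ Aqp≈-λ Aqq≈0) reach inter anti μ≈0 =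
        λs-spectrum , μs-spectrum , branch v∈S (ℕ.≤-reflexive (≡.sym size)) λs μs λs-spectrum μs-spectrum inter children
      where
      p≢q : p ≢ q
      p≢q p≡q = <ᶠ-irrefl p≡q p<q

      λs-spectrum : Spectrum (A [ S ]) λs
      λs-spectrum = Spectral.spectral-pair {S} λs p∈S q∈S p≢q size App≈0 Aqq≈0 Apq≈λ Aqp≈-λ (anti (suc zero))

      S-v-size : ∣ S - v ∣ ≡ 1
      S-v-size = ℕ.suc-injective (≡.trans (≡.sym (size-remove v∈S)) size)

      other : ∃ λ u → u ∈ S - v × A u u ≈ 0#
      other with v ≟ p
      ... | yes ≡.refl = q , x∈p∧x≢y⇒x∈p-y q∈S (p≢q ∘ ≡.sym) , Aqq≈0
      ... | no  v≢p    = p , x∈p∧x≢y⇒x∈p-y p∈S (v≢p ∘ ≡.sym) , App≈0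

      μs-spectrum : Spectrum (A [ S - v ]) μs
      μs-spectrum = Spectral.spectral-singleton {S - v} μs (proj₁ (proj₂ other)) S-v-size (proj₂ (proj₂ other)) (μ≈0 ≡.refl zero)

      children : ∀ u C → AdjIn (graph A) S v u → IsComponent (graph A) (S - v) u C → Duarte A C u
      children u C _ isC′ = single (component-root isC) (≡.trans (≡.sym (elementList-length C)) (↭.↭-length C↭u))
        where
        isC : IsComponent T (S - v) u C
        isC = component-T isC′
        C↭u : elementList C ↭ u ∷ []
        C↭u = unique-⊆⇒↭ (elementList-unique C)
          (λ x∈ → here (singleton-≡ S-v-size (component-⊆ isC (component-root isC)) (component-⊆ isC (∈-elementList⁻ x∈))))
          (nonempty (∈-elementList⁺ (component-root isC)))
          where
          nonempty : ∀ {xs : List (Fin n)} → u ∈ˡ xs → 1 ℕ.≤ length xs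
          nonempty (here _)  = ℕ.s≤s ℕ.z≤n
          nonempty (there _) = ℕ.s≤s ℕ.z≤n
    produced⇒duarte {S} {v} {m} {λs} {μs} (size≥3 s produced) reach inter anti μ≈0 =
        λs-spectrum , μs-spectrum , branch v∈S (ℕ.≤-trans (ℕ.n≤1+n 2) 3≤size) λs μs λs-spectrum μs-spectrum inter children
      where
      open Step s renaming (size≥3 to 3≤size)

      children-interlace : ∀ j → StrictlyInterlaces (hRoots j) (gRoots j)
      children-interlace = Fractions.children-interlace λs μs gRoots hRoots y factorization partialFractions
        inter gRoots-increasing hRoots-increasing √y (proj₂ ∘ √y-sqrt)

      children-root-0 : ∀ j → e j ≡ 1 → ∀ k → hRoots j k ≈ 0#
      children-root-0 = Fractions.child-root-0 λs μs gRoots hRoots y factorization partialFractions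
        inter gRoots-increasing hRoots-increasing √y (proj₂ ∘ √y-sqrt) anti gRoots-conjugate

      child : ∀ j → Spectrum (A [ comp j ]) (gRoots j) × Spectrum (A [ comp j - nbr j ]) (hRoots j) × Duarte A (comp j) (nbr j)
      child j = produced⇒duarte (produced j) (component-reachable (isComp j))
        (children-interlace j) (gRoots-conjugate j) (children-root-0 j)

      λs-spectrum : Spectrum (A [ S ]) λs
      λs-spectrum = Spectral.tree-spectral T v∈S size reach nbr nbr-complete comp isComp comp-size
        λs μs gRoots hRoots y √y factorization partialFractions (proj₂ ∘ √y-sqrt) entry zeros
        (λ j → proj₁ (child j)) (λ j → proj₁ (proj₂ (child j)))

      μs-spectrum : Spectrum (A [ S - v ]) μs
      μs-spectrum = Spectral.components-spectral T v∈S size reach nbr nbr-complete comp isComp comp-size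
        λs μs gRoots hRoots y √y factorization partialFractions (proj₂ ∘ √y-sqrt) entry zeros
        (λ j → proj₁ (child j)) (λ j → proj₁ (proj₂ (child j)))

      children : ∀ u C → AdjIn (graph A) S v u → IsComponent (graph A) (S - v) u C → Duarte A C u
      children u C v-u isC = at (Equivalence.to (nbr-complete u) (to-T v-u))
        where
        at : (∃ λ j → nbr j ≡ u) → Duarte A C u
        -- A component in the graph of `A` is one in `T`, and there its root determines it, so `C`
        -- is `comp j`.
        at (j , ≡.refl) = ≡.subst (λ C → Duarte A C u) (component-unique (isComp j) (component-T isC)) (proj₂ (proj₂ (child j)))

open import Data.Nat.Base using (_≤_)

corollary3p5 : ∀ {c ℓ₁ ℓ₂} (ℝ : RealNumbers c ℓ₁ ℓ₂) →
    let open Skew ℝ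
        R = RealNumbers.Carrier ℝ
    in
    ∀ m → 2 ≤ suc m →
    (T : Graph (suc m) 0ℓ) → IsTree T →
    (λs : Vector R (suc m)) (μs : Vector R m) →
    StrictlyInterlaces μs λs → Antisymmetric λs → Antisymmetric μs →
    (v : Fin (suc m)) → NEB T ⊤ v →
    (A : Matrix R (suc m)) → A ∈S⁻ T →
    Spectrum A λs → Spectrum (A [ ⊤ - v ]) μs →
    Produced T A ⊤ v λs μs →
    Duarte A ⊤ v
corollary3p5 ℝ m _ T (connected , _) λs μs inter λs-anti μs-anti v _ A A∈S⁻ _ _ produced =
  proj₂ (proj₂ (produced⇒duarte (_∈S⁻_.sameGraph A∈S⁻) produced
    (λ {x} _ → Star.map (λ x-y → ∈⊤ , ∈⊤ , x-y) (connected v x)) inter λs-anti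
    -- With a single μ the only index is its own opposite, so μ = -μ and μ vanishes.
    λ { ≡.refl zero → antisymmetric-0 (μs-anti zero) }))
  where
  open Skew ℝ
  open Construction ℝ T A
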